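{- Consider the algebra $B$ of shifted symmetric functions with basis of shifted Schur functions $s_\lambda=s^*_\lambda$, the family $h^{(r)}_k=\phi^r h^*_{k+r}$, and the associated operators $\psi_k,\psi^*_k,D_p,D^{(p)}$. For $m\in\mathbb Z$ set $$\Psi(u,m)=\sum_{k\in\mathbb Z}\psi_k|_{\mathcal B^{(m)}}u^k,\qquad \Psi^*(u,m)=\sum_{k\in\mathbb Z}\psi^*_k|_{\mathcal B^{(m)}}u^{ -k},$$ $$\tilde\Psi(u,m)=\sum_{k\in\mathbb Z}\psi_k|_{\mathcal B^{(m)}}\frac1{(u|k-1)},\qquad \tilde\Psi^*(u,m)=\sum_{k\in\mathbb Z}\psi^*_k|_{\mathcal B^{(m)}}(-u|k+1).$$ Then $$\Psi(1/u,m)=z\,u^{ -m-1}\sum_{p\ge0}(\partial_u-1)^p\bigl(H(1/u)\bigr)\,D_p\,u^p,$$ $$\Psi^*(1/u,m)=z^{ -1}u^m\sum_{p\ge0}(\partial_u+1)^p\bigl(E(-1/u)\bigr)\,D^{(-p-1)}\,u^p,$$ $$\tilde\Psi(u,m)=z\,\frac1{(u|m)}\,\tilde H(u-m)\,D\tilde E(u-m),$$ $$\tilde\Psi^*(u,m)=z^{ -1}(-u|m)\,\tilde E(u+m)\,D\tilde H(u+m-1),$$ where $$E(u)=\sum_{r\in\mathbb Z}e^*_ru^r,\quad H(u)=\sum_{r\in\mathbb Z}h^*_ru^r,\quad \tilde E(u)=\sum_{r\in\mathbb Z}\frac{e^*_r}{(u|r)},\quad \tilde H(u)=\sum_{r\in\mathbb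 Z}\frac{h^*_r}{(u|r)},$$ $$D\tilde E(u)=\sum_{p\in\mathbb Z}D_p\frac{(-1)^p}{(u|-p)},\qquad D\tilde H(u)=\sum_{p\in\mathbb Z}D^{(p)}\frac{(-1)^p}{(u|p)}.$$
   Context: Shifted powers: $(x|k)=x(x-1)\cdots(x-k+1)$ for $k\ge1$, $(x|0)=1$, and $(x|k)=\dfrac1{(x+1)(x+2)\cdots(x+(-k))}$ for $k\le-1$. Shifted Schur functions: the shifted Schur polynomial of a partition $\lambda$ is $s^*_\lambda(x_1,\dots,x_n)=\dfrac{\det[(x_i+n-i\,|\,\lambda_j+n-j)]_{1\le i,j\le n}}{\det[(x_i+n-i\,|\,n-j)]_{1\le i,j\le n}}$; these are stable under setting $x_{n+1}=0$ and define shifted Schur functions $s^*_\lambda=s^*_\lambda(x_1,x_2,\dots)$. Put $h^*_r=s^*_{(r)}=\sum_{i_1\le\dots\le i_r}(x_{i_1}-r+1)(x_{i_2}-r+2)\cdots x_{i_r}$ and $e^*_r=s^*_{(1^r)}=\sum_{i_1<\dots<i_r}(x_{i_1}+r-1)(x_{i_2}+r-2)\cdots x_{i_r}$ for $r\ge 1$, $h^*_0=e^*_0=1$, $h^*_r=e^*_r=0$ for $r<0$. The algebra $B$ of shifted symmetric functions over $\mathbb C$ is the polynomial ring $\mathbb C[h^*_1,h^*_2,\dots]$, and the $s^*_\lambda$ (all partitions $\lambda$) form a linear basis (known facts). Let $\phi$ be the automorphism of $B$ with $\phi(h^*_k)=h^*_k+(k-1)h^*_{k-1}$, and set $h^{(r)}_k=\phi^r(h^*_{k+r})$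 for $k,r\in\mathbb Z$. It is known (Okounkov–Olshanski) that $s^*_\lambda=\det[\phi^{j-1}h^*_{\lambda_i-i+j}]_{1\le i,j\le l}=\det[h^{(j-1)}_{\lambda_i-i+1}]_{1\le i,j\le l}$. For any integer vector $\lambda=(\lambda_1,\dots,\lambda_l)$ (parts may be negative and in any order), extended by $\lambda_i=0$ for $i>l$, let $s_\lambda$ be the stable value, for large $N$, of $\det[h^{(j-1)}_{\lambda_i-i+1}]_{1\le i,j\le N}$ (the same for all $N\ge l$); for partitions $s_\lambda=s^*_\lambda$. Let $z$ be a variable, $\mathcal B^{(m)}=z^mB$, $\mathcal B=\bigoplus_{m\in\mathbb Z}\mathcal B^{(m)}=B[z,z^{ -1}]$. Linear operators $\psi_k,\psi_k^*$ on $\mathcal B$ are defined on the basis $\{s_\lambda z^m\}$ ($\lambda$ a partition, $m\in\mathbb Z$) by $$\psi_k(s_\lambda z^m)=s_{(k-m-1,\lambda_1,\lambda_2,\dots)}z^{m+1},$$ $$\psi^*_k(s_\lambda z^m)=\sum_{t=1}^\infty(-1)^{t+1}\delta_{k-m-1,\,\lambda_t-t}\;s_{(\lambda_1+1,\dots,\lambda_{t-1}+1,\lambda_{t+1},\lambda_{t+2},\dots)}z^{m-1}.$$ Linear operators $D_p$ and $D^{(p)}$ ($p\in\mathbb Z$) on $B$ are defined on $s_\lambda$, $\lambda=(\lambda_1\ge\dots\ge\lambda_l\ge0)$ a partition, by $$D_p(s_\lambda)=\det\left[h^{(j)}_{\lambda_i-i}\right]_{i=1,\dots,l;\;j=0,1,\dots,\widehat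 p,\dots,l}\ \text{ if }0\le p\le l,\qquad D_p(s_\lambda)=0\ \text{ otherwise}$$ (the column $j=p$ is omitted), and $$D^{(p)}(s_\lambda)=\sum_{t=1}^\infty(-1)^{t+1}h^{(p)}_{\lambda_t-t+2}\,s_{(\lambda_1+1,\dots,\lambda_{t-1}+1,\lambda_{t+1},\lambda_{t+2},\dots)},$$ where $\lambda_t=0$ for $t>l$ (a finite sum). They are extended to $\mathcal B$ by commuting with $z^{\pm1}$. For each fixed element of $B$ only finitely many $D_p$ and finitely many $D^{(p)}$ are nonzero on it ($D_p=0$ for $p<0$, $D^{(p)}=0$ for $p\ge0$, $D^{(p)}(s_\lambda)=0$ for $-p>\lambda_1+1$). Conventions: elements of $B$ act by multiplication, after the operators $D_p,D^{(p)}$. $\partial_u=\partial/\partial u$ acts coefficientwise, only on the series $H(1/u)=\sum_r h^*_ru^{ -r}$, resp. $E(-1/u)=\sum_r e^*_r(-u)^{ -r}$. All expressions are formal series; the functions $1/(u|k)$ and $(\pm u|k)$, and their shifts in $u$, are expanded as formal Laurent series in $u^{ -1}$, so that each side applied to an element of $\mathcal B^{(m)}$ is a well-defined formal Laurent series in $u^{ -1}$. -}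

module Defs where

open import Level using (0ℓ; _⊔_)
open import Algebra.Bundles using (CommutativeRing)
open import Algebra.Apartness.Bundles using (HeytingField; HeytingCommutativeRing)
open import Algebra.Module.Bundles.Raw using (RawLeftModule)
open import Algebra.Module.Morphism.Structures using (module LeftModuleMorphisms)
open import Data.Empty using (⊥)
open import Data.Fin.Base using (Fin; zero; suc; toℕ; fromℕ<; punchIn)
open import Data.Integer.Base as ℤ using (ℤ; +_; -[1+_]; 0ℤ; 1ℤ; -1ℤ)
import Data.Integer.Properties as ℤₚ
open import Data.List.Base using (List; []; _∷_; length; map; replicate)
open import Data.List.Relation.Unary.Linked using (Linked)
open import Data.Nat.Base as ℕ using (ℕ; zero; suc; _∸_)
import Data.Nat.Properties as ℕₚ
open import Data.Nat.GeneralisedArithmetic using (fold)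
open import Data.Product.Base using (∃; _×_; _,_)
open import Relation.Binary.Core using (Rel)
open import Relation.Nullary.Decidable.Core using (yes; no; does)
open import Relation.Nullary.Negation.Core using (¬_)
open import Data.Bool.Base using (if_then_else_)

field→ring : ∀ {c ℓ₁ ℓ₂} → HeytingField c ℓ₁ ℓ₂ → CommutativeRing c ℓ₁
field→ring K =
  HeytingCommutativeRing.commutativeRing (HeytingField.heytingCommutativeRing K)

module RingNotions {c ℓ} (R : CommutativeRing c ℓ) where
  open CommutativeRing R hiding (zero)
  open import Algebra.Definitions.RawMonoid +-rawMonoid using () renaming (_×_ to _·_)
  open import Algebra.Properties.Monoid.Sum +-monoid using (sum-syntax)
  open import Algebra.Properties.Semiring.Exp semiring using (_^_)

  fromℕ : ℕ → Carrier
  fromℕ n = n · 1#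

  fromℤ : ℤ → Carrier
  fromℤ (+ n)    = fromℕ n
  fromℤ -[1+ n ] = - fromℕ (suc n)

  CharacteristicZero : Set ℓ
  CharacteristicZero = ∀ n → ¬ (fromℕ (suc n) ≈ 0#)

  sgn : ℕ → Carrier
  sgn n = (- 1#) ^ n

  δ : ℤ → ℤ → Carrier
  δ i j = if does (i ℤₚ.≟ j) then 1# else 0#

  det : ∀ {n} → (Fin n → Fin n → Carrier) → Carrier
  det {zero}  M = 1#
  det {suc n} M =
    ∑[ j < suc n ] (sgn (toℕ j) * M zero j * det (λ i k → M (suc i) (punchIn j k)))

  -- f has only finitely many nonzero terms, and S is their sum.
  HasSumℕ : (ℕ → Carrier) → Carrier → Set ℓ
  HasSumℕ f S = ∃ λ N →
    (∀ n → N ℕ.≤ n → f n ≈ 0#) ×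
    S ≈ (∑[ i < N ] f (toℕ i))

  HasSumℤ : (ℤ → Carrier) → Carrier → Set ℓ
  HasSumℤ f S = ∃ λ N →
    (∀ n → N ℕ.≤ n → f (+ n) ≈ 0# × f -[1+ n ] ≈ 0#) ×
    S ≈ (∑[ i < N ] (f (+ toℕ i) + f -[1+ toℕ i ]))

data Affine : Set where
  u+_ -u+_ : ℤ → Affine

module LaurentSeries {c ℓ} (R : CommutativeRing c ℓ) where
  open CommutativeRing R hiding (zero)
  open RingNotions R
  open import Algebra.Properties.Monoid.Sum +-monoid using (sum-syntax)
  open import Algebra.Properties.Semiring.Exp semiring using (_^_)

  infix  4 _▷_
  infixl 7 _✶_
  infixl 6 _⊞_

  -- d ▷ a  is  Σ_{i≥0} aᵢ u^{d-i}.
  record Laurent : Set c where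
    constructor _▷_
    field
      top    : ℤ
      coeffs : ℕ → Carrier

  at : (ℕ → Carrier) → ℤ → Carrier
  at a (+ i)    = a i
  at a -[1+ _ ] = 0#

  coeff : Laurent → ℤ → Carrier
  coeff (d ▷ a) n = at a (d ℤ.- n)

  const : Carrier → Laurent
  const x = 0ℤ ▷ λ { zero → x ; (suc _) → 0# }

  u^_ : ℤ → Laurent
  u^ n = n ▷ λ { zero → 1# ; (suc _) → 0# }

  _⊞_ : Laurent → Laurent → Laurent
  f ⊞ g = d ▷ λ i → coeff f (d ℤ.- + i) + coeff g (d ℤ.- + i)
    where d = Laurent.top f ℤ.⊔ Laurent.top g

  ⊟_ : Laurent → Laurent
  ⊟ (d ▷ a) = d ▷ λ i → - a i

  _✶_ : Laurent → Laurent → Laurent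
  (d ▷ a) ✶ (e ▷ b) = (d ℤ.+ e) ▷ λ n → ∑[ i < suc n ] (a (toℕ i) * b (n ∸ toℕ i))

  ∂ : Laurent → Laurent
  ∂ (d ▷ a) = ℤ.pred d ▷ λ i → fromℤ (d ℤ.- + i) * a i

  -- The sum of an infinite family, coefficient by coefficient: each power of u
  -- occurs in only finitely many members of the family.
  LSumℕ : (ℕ → Laurent) → Laurent → Set ℓ
  LSumℕ f S = ∀ n → HasSumℕ (λ k → coeff (f k) n) (coeff S n)

  LSumℤ : (ℤ → Laurent) → Laurent → Set ℓ
  LSumℤ f S = ∀ n → HasSumℤ (λ k → coeff (f k) n) (coeff S n)

  linear : Affine → Laurent
  linear (u+ a)  = 1ℤ ▷ λ { 0 → 1#   ; 1 → fromℤ a ; _ → 0# }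
  linear (-u+ a) = 1ℤ ▷ λ { 0 → - 1# ; 1 → fromℤ a ; _ → 0# }

  -- The geometric expansions of 1/(u+a) and 1/(-u+a) in powers of u⁻¹.
  linear⁻¹ : Affine → Laurent
  linear⁻¹ (u+ a)  = -1ℤ ▷ λ i → fromℤ (ℤ.- a) ^ i
  linear⁻¹ (-u+ a) = -1ℤ ▷ λ i → - (fromℤ a ^ i)

  shift : Affine → ℤ → Affine
  shift (u+ a)  j = u+ (a ℤ.+ j)
  shift (-u+ a) j = -u+ (a ℤ.+ j)

  ∏ : ℕ → (ℕ → Laurent) → Laurent
  ∏ zero    f = const 1#
  ∏ (suc n) f = ∏ n f ✶ f n

  -- (x|k) for x = ±u+a:  x(x-1)⋯(x-k+1)  or  1/((x+1)⋯(x+(-k))).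
  ⟨_∣_⟩ : Affine → ℤ → Laurent
  ⟨ x ∣ + k ⟩      = ∏ k       λ j → linear   (shift x (ℤ.- + j))
  ⟨ x ∣ -[1+ k ] ⟩ = ∏ (suc k) λ j → linear⁻¹ (shift x (+ suc j))

  1/⟨_∣_⟩ : Affine → ℤ → Laurent
  1/⟨ x ∣ + k ⟩      = ∏ k       λ j → linear⁻¹ (shift x (ℤ.- + j))
  1/⟨ x ∣ -[1+ k ] ⟩ = ∏ (suc k) λ j → linear   (shift x (+ suc j))

-- Terms for the commutative R-algebra R[X]/(∼) with generators X and relations ∼;
-- elements of R enter as con, so 0 and 1 are con 0 and con 1.
module Presentation {c ℓ} (R : CommutativeRing c ℓ) (X : Set) where
  private module R = CommutativeRing R

  infixl 7 _*_
  infixl 6 _+_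
  infix  8 -_

  data Term : Set c where
    con     : R.Carrier → Term
    var     : X → Term
    _+_ _*_ : Term → Term → Term
    -_      : Term → Term

  module Quotient (_∼_ : Rel Term 0ℓ) where
    infix 4 _≈_

    data _≈_ : Rel Term (c ⊔ ℓ) where
      relation    : ∀ {s t} → s ∼ t → s ≈ t
      refl        : ∀ {s} → s ≈ s
      sym         : ∀ {s t} → s ≈ t → t ≈ s
      trans       : ∀ {s t r} → s ≈ t → t ≈ r → s ≈ r
      +-cong      : ∀ {s s′ t t′} → s ≈ s′ → t ≈ t′ → s + t ≈ s′ + t′
      *-cong      : ∀ {s s′ t t′} → s ≈ s′ → t ≈ t′ → s * t ≈ s′ * t′
      neg-cong    : ∀ {s s′} → s ≈ s′ → - s ≈ - s′
      con-cong    : ∀ {a b} → a R.≈ b → con a ≈ con b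
      con-+       : ∀ a b → con (a R.+ b) ≈ con a + con b
      con-*       : ∀ a b → con (a R.* b) ≈ con a * con b
      +-assoc     : ∀ s t r → (s + t) + r ≈ s + (t + r)
      +-comm      : ∀ s t → s + t ≈ t + s
      +-identityˡ : ∀ s → con R.0# + s ≈ s
      +-inverseˡ  : ∀ s → - s + s ≈ con R.0#
      *-assoc     : ∀ s t r → (s * t) * r ≈ s * (t * r)
      *-comm      : ∀ s t → s * t ≈ t * s
      *-identityˡ : ∀ s → con R.1# * s ≈ s
      distribˡ    : ∀ s t r → s * (t + r) ≈ s * t + s * r

    algebra : CommutativeRing c (c ⊔ ℓ)
    algebra = record
      { Carrier = Term ; _≈_ = _≈_
      ; _+_ = _+_ ; _*_ = _*_ ; -_ = -_ ; 0# = con R.0# ; 1# = con R.1#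
      ; isCommutativeRing = record
        { isRing = record
          { +-isAbelianGroup = record
            { isGroup = record
              { isMonoid = record
                { isSemigroup = record
                  { isMagma = record
                    { isEquivalence = record { refl = refl ; sym = sym ; trans = trans }
                    ; ∙-cong = +-cong }
                  ; assoc = +-assoc }
                ; identity = +-identityˡ , λ s → trans (+-comm s _) (+-identityˡ s) }
              ; inverse = +-inverseˡ , λ s → trans (+-comm s _) (+-inverseˡ s)
              ; ⁻¹-cong = neg-cong }
            ; comm = +-comm }
          ; *-cong = *-cong
          ; *-assoc = *-assoc
          ; *-identity = *-identityˡ , λ s → trans (*-comm s _) (*-identityˡ s)
          ; distrib = distribˡ , λ s t r →
              trans (*-comm _ s) (trans (distribˡ s t r) (+-cong (*-comm s t) (*-comm s r))) }
        ; *-comm = *-comm } }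

  substitute : (X → Term) → Term → Term
  substitute f (con a) = con a
  substitute f (var x) = f x
  substitute f (s + t) = substitute f s + substitute f t
  substitute f (s * t) = substitute f s * substitute f t
  substitute f (- s)   = - substitute f s

-- λ_{t+1} for t ≥ 0, an integer vector being extended by zeros.
part : List ℤ → ℕ → ℤ
part []       _       = 0ℤ
part (a ∷ as) zero    = a
part (a ∷ as) (suc t) = part as t

-- (λ₁+1,…,λ_t+1,λ_{t+2},λ_{t+3},…): the entry of index t+1 is removed.
strip : ℕ → List ℤ → List ℤ
strip zero    []       = []
strip zero    (a ∷ as) = as
strip (suc t) []       = 1ℤ ∷ strip t []
strip (suc t) (a ∷ as) = (a ℤ.+ 1ℤ) ∷ strip t as

-- Trailing zeros are allowed.
record Partition : Set where
  constructor partition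
  field
    parts      : List ℕ
    decreasing : Linked ℕ._≥_ parts

  vector : List ℤ
  vector = map +_ parts

module ShiftedSymmetric {c ℓ} (K : CommutativeRing c ℓ) where
  private module K = CommutativeRing K

  -- B = K[h*₁,h*₂,…], with var n standing for h*_{n+1}.
  module BTerm = Presentation K ℕ
  module BQuot = BTerm.Quotient (λ _ _ → ⊥)
  open BTerm using (con; var; substitute)

  B-ring : CommutativeRing c (c ⊔ ℓ)
  B-ring = BQuot.algebra

  open CommutativeRing B-ring using () renaming (Carrier to B) public
  private
    module B  = CommutativeRing B-ring
    module BN = RingNotions B-ring

  h* : ℤ → B
  h* (+ zero)  = B.1#
  h* (+ suc n) = var n
  h* -[1+ _ ]  = B.0#

  φ : B → B
  φ = substitute λ n → var n B.+ BN.fromℕ n B.* h* (+ n)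

  -- φ⁻¹(h*_k) = h*_k - (k-1) φ⁻¹(h*_{k-1})
  φ⁻¹h : ℕ → B
  φ⁻¹h zero    = B.1#
  φ⁻¹h (suc n) = var n B.- BN.fromℕ n B.* φ⁻¹h n

  φ⁻¹ : B → B
  φ⁻¹ = substitute λ n → φ⁻¹h (suc n)

  φ^ : ℤ → B → B
  φ^ (+ n)    b = fold b φ n
  φ^ -[1+ n ] b = fold b φ⁻¹ (suc n)

  module _ where
    open BQuot

    substitute-cong : ∀ f {a b} → a B.≈ b → substitute f a B.≈ substitute f b
    substitute-cong f refl              = refl
    substitute-cong f (sym p)           = sym (substitute-cong f p)
    substitute-cong f (trans p q)       = trans (substitute-cong f p) (substitute-cong f q)
    substitute-cong f (+-cong p q)      = +-cong (substitute-cong f p) (substitute-cong f q)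
    substitute-cong f (*-cong p q)      = *-cong (substitute-cong f p) (substitute-cong f q)
    substitute-cong f (neg-cong p)      = neg-cong (substitute-cong f p)
    substitute-cong f (con-cong p)      = con-cong p
    substitute-cong f (con-+ a b)       = con-+ a b
    substitute-cong f (con-* a b)       = con-* a b
    substitute-cong f (+-assoc s t r)   = +-assoc _ _ _
    substitute-cong f (+-comm s t)      = +-comm _ _
    substitute-cong f (+-identityˡ s)   = +-identityˡ _
    substitute-cong f (+-inverseˡ s)    = +-inverseˡ _
    substitute-cong f (*-assoc s t r)   = *-assoc _ _ _
    substitute-cong f (*-comm s t)      = *-comm _ _
    substitute-cong f (*-identityˡ s)   = *-identityˡ _
    substitute-cong f (distribˡ s t r)  = distribˡ _ _ _

    private
      substitute-fromℕ : ∀ f n → substitute f (BN.fromℕ n) B.≈ BN.fromℕ n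
      substitute-fromℕ f zero    = refl
      substitute-fromℕ f (suc n) = +-cong refl (substitute-fromℕ f n)

      substitute-inverse : ∀ f g → (∀ n → substitute f (g n) B.≈ var n) →
                           ∀ b → substitute f (substitute g b) B.≈ b
      substitute-inverse f g p (con a)       = refl
      substitute-inverse f g p (var n)       = p n
      substitute-inverse f g p (s BTerm.+ t) =
        +-cong (substitute-inverse f g p s) (substitute-inverse f g p t)
      substitute-inverse f g p (s BTerm.* t) =
        *-cong (substitute-inverse f g p s) (substitute-inverse f g p t)
      substitute-inverse f g p (BTerm.- s)   = neg-cong (substitute-inverse f g p s)

      a-b+b : ∀ a b → (a B.- b) B.+ b B.≈ a
      a-b+b a b = trans (+-assoc a _ b)
                    (trans (+-cong refl (+-inverseˡ b)) (B.+-identityʳ a))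

      a+b-b : ∀ a b → (a B.+ b) B.- b B.≈ a
      a+b-b a b = trans (+-assoc a b _)
                    (trans (+-cong refl (B.-‿inverseʳ b)) (B.+-identityʳ a))

      φ⁻¹-h* : ∀ n → φ⁻¹ (h* (+ n)) B.≈ φ⁻¹h n
      φ⁻¹-h* zero    = refl
      φ⁻¹-h* (suc n) = refl

      φ-φ⁻¹h : ∀ n → φ (φ⁻¹h n) B.≈ h* (+ n)
      φ-φ⁻¹h zero    = refl
      φ-φ⁻¹h (suc n) =
        trans (+-cong refl (neg-cong (*-cong (substitute-fromℕ _ n) (φ-φ⁻¹h n))))
              (a+b-b (var n) _)

    φ∘φ⁻¹ : ∀ b → φ (φ⁻¹ b) B.≈ b
    φ∘φ⁻¹ = substitute-inverse _ _ λ n → φ-φ⁻¹h (suc n)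

    φ⁻¹∘φ : ∀ b → φ⁻¹ (φ b) B.≈ b
    φ⁻¹∘φ = substitute-inverse _ _ λ n →
      trans (+-cong refl (*-cong (substitute-fromℕ _ n) (φ⁻¹-h* n))) (a-b+b (var n) _)

  -- h^{(r)}_k
  h⟨_⟩ : ℤ → ℤ → B
  h⟨ r ⟩ k = φ^ r (h* (k ℤ.+ r))

  -- The stable value: the determinant of size N = l, which any N ≥ l also gives.  On
  -- partitions this is the Jacobi-Trudi formula for s*_λ.  With rows and columns counted
  -- from 0 the entry h^{(j-1)}_{λ_i-i+1} reads h⟨ j ⟩ (λ_{i+1} - i).
  s : List ℤ → B
  s α = BN.det {length α} λ i j → h⟨ + toℕ j ⟩ (part α (toℕ i) ℤ.- + toℕ i)

  -- e*_r = s*_{(1^r)}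
  e* : ℤ → B
  e* (+ r)    = s (replicate r 1ℤ)
  e* -[1+ _ ] = B.0#

  -- 𝓑 = B[z,z⁻¹]
  data Generator : Set where
    Z Z⁻¹ : Generator

  module 𝓑Term = Presentation B-ring Generator

  data Invertibility : Rel 𝓑Term.Term 0ℓ where
    z*z⁻¹≈1 : Invertibility (𝓑Term.var Z 𝓑Term.* 𝓑Term.var Z⁻¹) (𝓑Term.con B.1#)

  module 𝓑Quot = 𝓑Term.Quotient Invertibility

  𝓑-ring : CommutativeRing c (c ⊔ ℓ)
  𝓑-ring = 𝓑Quot.algebra

  open CommutativeRing 𝓑-ring using () renaming (Carrier to 𝓑) public
  open LaurentSeries 𝓑-ring public
  private
    module 𝓑  = CommutativeRing 𝓑-ring
    module 𝓑N = RingNotions 𝓑-ring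

  open import Algebra.Properties.Semiring.Exp 𝓑.semiring using (_^_)

  ι : B → 𝓑
  ι = 𝓑Term.con

  z z⁻¹ : 𝓑
  z   = 𝓑Term.var Z
  z⁻¹ = 𝓑Term.var Z⁻¹

  -- b z^ m, for b in B, is the general element of 𝓑^{(m)} = z^m B.
  infix 5 _z^_
  _z^_ : B → ℤ → 𝓑
  b z^ (+ n)    = ι b 𝓑.* z ^ n
  b z^ -[1+ n ] = ι b 𝓑.* z⁻¹ ^ suc n

  𝓑-module : RawLeftModule K.Carrier c (c ⊔ ℓ)
  𝓑-module = record
    { Carrierᴹ = 𝓑
    ; _≈ᴹ_     = 𝓑._≈_
    ; _+ᴹ_     = 𝓑._+_
    ; _*ₗ_     = λ a x → ι (con a) 𝓑.* x
    ; 0ᴹ       = 𝓑.0#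
    ; -ᴹ_      = 𝓑.-_
    }

  IsLinear : (𝓑 → 𝓑) → Set (c ⊔ ℓ)
  IsLinear = LeftModuleMorphisms.IsLeftModuleHomomorphism 𝓑-module 𝓑-module

  -- D_p(s_λ).  Omitting the column p from 0,…,l is punchIn p : Fin l → Fin (l+1).
  D-on-s : ℤ → List ℤ → B
  D-on-s -[1+ _ ] α = B.0#
  D-on-s (+ p)    α with p ℕₚ.<? suc (length α)
  ... | no  _    = B.0#
  ... | yes p≤l  = BN.det {length α} λ i j →
    h⟨ + toℕ (punchIn (fromℕ< p≤l) j) ⟩ (part α (toℕ i) ℤ.- + suc (toℕ i))

  -- Linear operators are specified by their values on the basis s_λ z^m.  The sums
  -- over t ≥ 1 are reindexed by t-1, so that the sign (-1)^{t+1} becomes sgn t.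
  record AreTheOperators (ψ ψ* D D⁽_⁾ : ℤ → 𝓑 → 𝓑) : Set (c ⊔ ℓ) where
    field
      ψ-linear  : ∀ k → IsLinear (ψ k)
      ψ-basis   : ∀ k (lam : Partition) m → let α = Partition.vector lam in
        ψ k (s α z^ m) 𝓑.≈ (s ((k ℤ.- m ℤ.- 1ℤ) ∷ α) z^ (m ℤ.+ 1ℤ))

      ψ*-linear : ∀ k → IsLinear (ψ* k)
      ψ*-basis  : ∀ k (lam : Partition) m → let α = Partition.vector lam in
        𝓑N.HasSumℕ
          (λ t → 𝓑N.sgn t 𝓑.* 𝓑N.δ (k ℤ.- m ℤ.- 1ℤ) (part α t ℤ.- + suc t)
                 𝓑.* (s (strip t α) z^ (m ℤ.- 1ℤ)))
          (ψ* k (s α z^ m))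

      D-linear  : ∀ p → IsLinear (D p)
      D-z       : ∀ p x → D p (z 𝓑.* x) 𝓑.≈ z 𝓑.* D p x
      D-z⁻¹     : ∀ p x → D p (z⁻¹ 𝓑.* x) 𝓑.≈ z⁻¹ 𝓑.* D p x
      D-basis   : ∀ p (lam : Partition) → let α = Partition.vector lam in
        D p (ι (s α)) 𝓑.≈ ι (D-on-s p α)

      D⁽⁾-linear : ∀ p → IsLinear D⁽ p ⁾
      D⁽⁾-z      : ∀ p x → D⁽ p ⁾ (z 𝓑.* x) 𝓑.≈ z 𝓑.* D⁽ p ⁾ x
      D⁽⁾-z⁻¹    : ∀ p x → D⁽ p ⁾ (z⁻¹ 𝓑.* x) 𝓑.≈ z⁻¹ 𝓑.* D⁽ p ⁾ x
      D⁽⁾-basis  : ∀ p (lam : Partition) → let α = Partition.vector lam in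
        𝓑N.HasSumℕ
          (λ t → 𝓑N.sgn t 𝓑.* ι (h⟨ p ⟩ (part α t ℤ.- + suc t ℤ.+ + 2))
                 𝓑.* ι (s (strip t α)))
          (D⁽ p ⁾ (ι (s α)))

  H[1/u] E[-1/u] : Laurent
  H[1/u]  = 0ℤ ▷ λ r → ι (h* (+ r))
  E[-1/u] = 0ℤ ▷ λ r → 𝓑N.sgn r 𝓑.* ι (e* (+ r))

  [∂-1]^_ [∂+1]^_ : ℕ → Laurent → Laurent
  ([∂-1]^ p) f = fold f (λ g → ∂ g ⊞ ⊟ g) p
  ([∂+1]^ p) f = fold f (λ g → ∂ g ⊞ g) p

  ±_ : ℤ → Laurent
  ± p = const (𝓑N.sgn ℤ.∣ p ∣)

{-# OPTIONS --safe #-}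
module Submission where

open import Defs
open import Algebra.Apartness.Bundles using (HeytingField)
open import Algebra.Bundles using (CommutativeRing)
open import Algebra.Module.Morphism.Structures using (module LeftModuleMorphisms)
import Algebra.Properties.CommutativeMonoid.Sum
import Algebra.Properties.Ring
import Algebra.Properties.Semiring.Mult
import Algebra.Properties.Semiring.Sum
import Algebra.Solver.Ring
open import Algebra.Solver.Ring.AlmostCommutativeRing using (fromCommutativeRing; _-Raw-AlmostCommutative⟶_)
open import Data.Fin.Base using (Fin; zero; suc; toℕ; punchIn)
import Data.Fin.Properties as Finₚ
open import Data.Integer.Base as ℤ using (ℤ; +_; -[1+_]; 0ℤ; 1ℤ; -1ℤ)
import Data.Integer.Properties as ℤₚ
import Data.Integer.Solver
open import Data.List.Base using (List; []; _∷_; _++_; length; tabulate; _∷ʳ_; foldr; map; replicate)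
import Data.List.Properties as Listₚ
open import Data.List.Relation.Unary.All using (All; []; _∷_)
open import Data.List.Relation.Unary.Linked using (Linked; []; [-]; _∷_)
open import Data.Maybe.Base using () renaming (map to mapMaybe)
open import Data.Nat.Base as ℕ using (ℕ; zero; suc; _∸_; z≤n; s≤s)
open import Data.Nat.ListAction using () renaming (sum to sumℕ)
import Data.Nat.Properties as ℕₚ
open import Data.Product.Base using (∃; _×_; _,_; proj₁; proj₂; ∃-syntax)
open import Data.Sum.Base using (inj₁; inj₂; _⊎_)
open import Function.Base using (_∘_)
import Level
open import Relation.Binary.Definitions using (tri<; tri≈; tri>)
open import Relation.Binary.PropositionalEquality as ≡ using (_≡_; _≢_)
import Relation.Binary.Reasoning.Setoid
open import Relation.Nullary.Decidable.Core using (yes; no; dec⇒maybe)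
open import Relation.Nullary.Negation.Core using (contradiction)

-- Expanding det along its first row gives ψ_k x = Σ_j (-1)^j h⟨j⟩_{k-m-1} z D_j x.  For ψ* the
-- identity Σ_r (-1)^r φ^{-n-r}(e*_r) h⟨-n-r-1⟩_{a+1} = δ_{n,a}, applied under the sum over the
-- stripped vectors, gives ψ*_k x = Σ_p φ^{-p}(ε_{p-k+m}) z⁻¹ D⁽-p-1⁾ x with ε_r = (-1)^r e*_r; the
-- terms p < 0 vanish, being determinants with a repeated column.  All four formulas then follow
-- from two recurrences, h⟨r+1⟩_k = h⟨r⟩_{k+1} + (k+r) h⟨r⟩_k and φ⁻¹(ε_r) = ε_r - (r-1) ε_{r-1}:
-- they say that passing from p to p+1 is ∂ ∓ 1 on the series in powers of u, and multiplication
-- by a linear factor on the series in shifted powers.  The operators are known only on the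
-- s_λ z^m, so one also needs that the s_λ span B.

-- The two recurrences differ in depth. The one for h is the definition of φ. The one for ε cannot
-- be read off the determinants e*_r. It comes from h by uniqueness: the defect of the recurrence,
-- convolved with the h*_i (twisted by powers of φ), vanishes, and since h*_0 = 1 this convolution
-- is triangular. Spanning goes by induction on degree. Expanding s_(k,α) along its first row, the
-- leading cofactor is φ(s_α), not s_α; hence one shows that h*_k φ(b) stays in the span and takes
-- φ⁻¹ of the given element for b. The other cofactors have lower degree, and s_(k,α) is plus or
-- minus some s_β, or zero, by exchanging rows. All sums are sums of finitely supported families,
-- coefficient by coefficient. Two uniformities make this enough: for a fixed element a single bound
-- works for the `D` and `D⁽_⁾` of every index, whatever `k` is, and a sum of Laurent series may be
-- multiplied by a series because all its members vanish above a common power of u.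

-- Integer arithmetic of indices and exponents.

module ℤ-identities where
  open Data.Integer.Solver.+-*-Solver
  open import Data.Integer.Base using (_+_; _-_; -_)

  -1-k+[c+1]≡c-k : ∀ c k → -1ℤ - k + (c + 1ℤ) ≡ c - k
  -1-k+[c+1]≡c-k = solve 2 (λ c k → con -1ℤ :- k :+ (c :+ con 1ℤ) := c :- k) ≡.refl

  i+k+c≡k+[i+c] : ∀ i k c → i + k + c ≡ k + (i + c)
  i+k+c≡k+[i+c] = solve 3 (λ i k c → i :+ k :+ c := k :+ (i :+ c)) ≡.refl

  k-c+c≡k : ∀ k c → k - c + c ≡ k
  k-c+c≡k = solve 2 (λ k c → k :- c :+ c := k) ≡.refl

  k+c-c≡k : ∀ k c → k + c - c ≡ k
  k+c-c≡k = solve 2 (λ k c → k :+ c :- c := k) ≡.refl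

  d-[d-n]≡n : ∀ d n → d - (d - n) ≡ n
  d-[d-n]≡n = solve 2 (λ d n → d :- (d :- n) := n) ≡.refl

  e-[n-[d-j]]≡d+e-n-j : ∀ d e n j → e - (n - (d - j)) ≡ d + e - n - j
  e-[n-[d-j]]≡d+e-n-j = solve 4 (λ d e n j → e :- (n :- (d :- j)) := d :+ e :- n :- j) ≡.refl

  pos-sub : ∀ {m n} → m ℕ.≤ n → + n - + m ≡ + (n ∸ m)
  pos-sub {m} {n} m≤n = ≡.trans (ℤₚ.m-n≡m⊖n n m) (ℤₚ.⊖-≥ m≤n)

  neg⇒<0 : ∀ {i n} → i ≡ -[1+ n ] → i ℤ.< 0ℤ
  neg⇒<0 ≡.refl = ℤ.-<+

  <0-sub : ∀ {m n} → m ℤ.< n → m - n ℤ.< 0ℤ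
  <0-sub {m} {n} m<n = ≡.subst (m - n ℤ.<_) (ℤₚ.+-inverseʳ n) (ℤₚ.+-monoˡ-< (- n) m<n)

  -- Here and below successors are written `1ℤ + _` and predecessors `-1ℤ + _`: `ℤ.suc` and `ℤ.pred`
  -- unfold to these, and `1ℤ + + n` computes to `+ suc n`, so one identity covers all these forms.
  k+[1+r]≡1+k+r : ∀ k r → k + (1ℤ + r) ≡ 1ℤ + k + r
  k+[1+r]≡1+k+r = solve 2 (λ k r → k :+ (con 1ℤ :+ r) := con 1ℤ :+ k :+ r) ≡.refl

  k+[1+r]-1≡k+r : ∀ k r → k + (1ℤ + r) - 1ℤ ≡ k + r
  k+[1+r]-1≡k+r = solve 2 (λ k r → k :+ (con 1ℤ :+ r) :- con 1ℤ := k :+ r) ≡.refl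

  k+j≡-1+k+[1+j] : ∀ j k → k + j ≡ -1ℤ + k + (1ℤ + j)
  k+j≡-1+k+[1+j] = solve 2 (λ j k → k :+ j := con -1ℤ :+ k :+ (con 1ℤ :+ j)) ≡.refl

  -1+[a-o]≡a-[1+o] : ∀ a o → -1ℤ + (a - o) ≡ a - (1ℤ + o)
  -1+[a-o]≡a-[1+o] = solve 2 (λ a o → con -1ℤ :+ (a :- o) := a :- (con 1ℤ :+ o)) ≡.refl

  1-[1+i]+i≡0 : ∀ i → 1ℤ - (1ℤ + i) + i ≡ 0ℤ
  1-[1+i]+i≡0 = solve 1 (λ i → con 1ℤ :- (con 1ℤ :+ i) :+ i := con 0ℤ) ≡.refl

  1-[1+[1+[i+m]]]+i≡-[1+m] : ∀ i m → 1ℤ - (1ℤ + (1ℤ + (i + m))) + i ≡ - (1ℤ + m)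
  1-[1+[1+[i+m]]]+i≡-[1+m] = solve 2 (λ i m → con 1ℤ :- (con 1ℤ :+ (con 1ℤ :+ (i :+ m))) :+ i := :- (con 1ℤ :+ m)) ≡.refl

  N-i≡-1+N-[-1+i] : ∀ N i → N - i ≡ -1ℤ + N - (-1ℤ + i)
  N-i≡-1+N-[-1+i] = solve 2 (λ N i → N :- i := con -1ℤ :+ N :- (con -1ℤ :+ i)) ≡.refl

  N-i-1≡N-1-i : ∀ N i → N - i - 1ℤ ≡ N - 1ℤ - i
  N-i-1≡N-1-i = solve 2 (λ N i → N :- i :- con 1ℤ := N :- con 1ℤ :- i) ≡.refl

  i-1≡-1+i : ∀ i → i - 1ℤ ≡ -1ℤ + i
  i-1≡-1+i = solve 1 (λ i → i :- con 1ℤ := con -1ℤ :+ i) ≡.refl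

  -a-1+[a-p]≡-p-1 : ∀ a p → - a - 1ℤ + (a - p) ≡ - p - 1ℤ
  -a-1+[a-p]≡-p-1 = solve 2 (λ a p → :- a :- con 1ℤ :+ (a :- p) := :- p :- con 1ℤ) ≡.refl

  a+1+[-p-1]≡a-p : ∀ a p → a + 1ℤ + (- p - 1ℤ) ≡ a - p
  a+1+[-p-1]≡a-p = solve 2 (λ a p → a :+ con 1ℤ :+ (:- p :- con 1ℤ) := a :- p) ≡.refl

  a-n-[a-p]≡p-n : ∀ a n p → a - n - (a - p) ≡ p - n
  a-n-[a-p]≡p-n = solve 3 (λ a n p → a :- n :- (a :- p) := p :- n) ≡.refl

  -p-1+1≡-p : ∀ p → - p - 1ℤ + 1ℤ ≡ - p
  -p-1+1≡-p = solve 1 (λ p → :- p :- con 1ℤ :+ con 1ℤ := :- p) ≡.refl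

  a-o≡1+[a-[1+o]] : ∀ a o → a - o ≡ 1ℤ + (a - (1ℤ + o))
  a-o≡1+[a-[1+o]] = solve 2 (λ a o → a :- o := con 1ℤ :+ (a :- (con 1ℤ :+ o))) ≡.refl

  a+1-o≡1+[a-o] : ∀ a o → a + 1ℤ - o ≡ 1ℤ + (a - o)
  a+1-o≡1+[a-o] = solve 2 (λ a o → a :+ con 1ℤ :- o := con 1ℤ :+ (a :- o)) ≡.refl

  1+[a-t]≡a-[1+t]+2 : ∀ a t → 1ℤ + (a - t) ≡ a - (1ℤ + t) + + 2
  1+[a-t]≡a-[1+t]+2 = solve 2 (λ a t → con 1ℤ :+ (a :- t) := a :- (con 1ℤ :+ t) :+ con (+ 2)) ≡.refl

  0-[1+t]+2+p≡p+1-t : ∀ t p → 0ℤ - (1ℤ + t) + + 2 + p ≡ p + 1ℤ - t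
  0-[1+t]+2+p≡p+1-t = solve 2 (λ t p → con 0ℤ :- (con 1ℤ :+ t) :+ con (+ 2) :+ p := p :+ con 1ℤ :- t) ≡.refl

  a-[1+t]+2+[-[1+q]]≡a-[q+t] : ∀ a t q → a - (1ℤ + t) + + 2 + (- (1ℤ + q)) ≡ a - (q + t)
  a-[1+t]+2+[-[1+q]]≡a-[q+t] = solve 3 (λ a t q → a :- (con 1ℤ :+ t) :+ con (+ 2) :+ (:- (con 1ℤ :+ q)) := a :- (q :+ t)) ≡.refl

  a+1+1≡a+2 : ∀ a → a + 1ℤ + 1ℤ ≡ a + + 2
  a+1+1≡a+2 = solve 1 (λ a → a :+ con 1ℤ :+ con 1ℤ := a :+ con (+ 2)) ≡.refl

  i≤∣i∣ : ∀ i → i ℤ.≤ + ℤ.∣ i ∣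
  i≤∣i∣ (+ i)    = ℤₚ.≤-refl
  i≤∣i∣ -[1+ i ] = ℤ.-≤+

  a+c+[d+w]≡a+d+[c+w] : ∀ a c d w → a + c + (d + w) ≡ a + d + (c + w)
  a+c+[d+w]≡a+d+[c+w] = solve 4 (λ a c d w → a :+ c :+ (d :+ w) := a :+ d :+ (c :+ w)) ≡.refl

  a+[d+c]+w≡a+d+[c+w] : ∀ a c d w → a + (d + c) + w ≡ a + d + (c + w)
  a+[d+c]+w≡a+d+[c+w] = solve 4 (λ a c d w → a :+ (d :+ c) :+ w := a :+ d :+ (c :+ w)) ≡.refl

  d+c+w≡d+[c+w] : ∀ c d w → d + c + w ≡ d + (c + w)
  d+c+w≡d+[c+w] = solve 3 (λ c d w → d :+ c :+ w := d :+ (c :+ w)) ≡.refl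

  a-o+l+[o+c]≡a+[l+c] : ∀ a o l c → a - o + l + (o + c) ≡ a + (l + c)
  a-o+l+[o+c]≡a+[l+c] = solve 4 (λ a o l c → a :- o :+ l :+ (o :+ c) := a :+ (l :+ c)) ≡.refl

  d+[c+w]-c≡d+w : ∀ c d w → d + (c + w) - c ≡ d + w
  d+[c+w]-c≡d+w = solve 3 (λ c d w → d :+ (c :+ w) :- c := d :+ w) ≡.refl

  k-o≡1+k-[1+o] : ∀ o k → k - o ≡ 1ℤ + k - (1ℤ + o)
  k-o≡1+k-[1+o] = solve 2 (λ o k → k :- o := con 1ℤ :+ k :- (con 1ℤ :+ o)) ≡.refl

  k+c+[d+w]≡k+[d+[c+w]] : ∀ k c d w → k + c + (d + w) ≡ k + (d + (c + w))
  k+c+[d+w]≡k+[d+[c+w]] = solve 4 (λ k c d w → k :+ c :+ (d :+ w) := k :+ (d :+ (c :+ w))) ≡.refl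

  k+[d+c+w]≡k+[d+[c+w]] : ∀ k c d w → k + (d + c + w) ≡ k + (d + (c + w))
  k+[d+c+w]≡k+[d+[c+w]] = solve 4 (λ k c d w → k :+ (d :+ c :+ w) := k :+ (d :+ (c :+ w))) ≡.refl

  a+-[k+m]≡a+-m+-k : ∀ a m k → a + - (k + m) ≡ a + - m + - k
  a+-[k+m]≡a+-m+-k = solve 3 (λ a m k → a :+ :- (k :+ m) := a :+ :- m :+ :- k) ≡.refl

  1+k+m≡1+[k+m] : ∀ k m → 1ℤ + k + m ≡ 1ℤ + (k + m)
  1+k+m≡1+[k+m] = solve 2 (λ k m → con 1ℤ :+ k :+ m := con 1ℤ :+ (k :+ m)) ≡.refl

  C-n+[n-k]≡C-k : ∀ C n k → C - n + (n - k) ≡ C - k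
  C-n+[n-k]≡C-k = solve 3 (λ C n k → C :- n :+ (n :- k) := C :- k) ≡.refl

  k+[n-k]≡n : ∀ n k → k + (n - k) ≡ n
  k+[n-k]≡n = solve 2 (λ n k → k :+ (n :- k) := n) ≡.refl

  C-n<k⇒C-k<n : ∀ C n k → C - n ℤ.< k → C - k ℤ.< n
  C-n<k⇒C-k<n C n k lt = ≡.subst₂ ℤ._<_ (C-n+[n-k]≡C-k C n k) (k+[n-k]≡n n k) (ℤₚ.+-monoˡ-< (n - k) lt)

  -[-1+k]+[k+j]≡1+j : ∀ j k → - (-1ℤ + k) + (k + j) ≡ 1ℤ + j
  -[-1+k]+[k+j]≡1+j = solve 2 (λ j k → :- (con -1ℤ :+ k) :+ (k :+ j) := con 1ℤ :+ j) ≡.refl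

  -[1+p-r]≡-[1+p]+r : ∀ p r → - (1ℤ + p - r) ≡ - (1ℤ + p) + r
  -[1+p-r]≡-[1+p]+r = solve 2 (λ p r → :- (con 1ℤ :+ p :- r) := :- (con 1ℤ :+ p) :+ r) ≡.refl

  1+p-[-1+r]≡1+[1+p-r] : ∀ p r → 1ℤ + p - (-1ℤ + r) ≡ 1ℤ + (1ℤ + p - r)
  1+p-[-1+r]≡1+[1+p-r] = solve 2 (λ p r → con 1ℤ :+ p :- (con -1ℤ :+ r) := con 1ℤ :+ (con 1ℤ :+ p :- r)) ≡.refl

  1+[1+p]-r≡1+[1+p-r] : ∀ p r → 1ℤ + (1ℤ + p) - r ≡ 1ℤ + (1ℤ + p - r)
  1+[1+p]-r≡1+[1+p-r] = solve 2 (λ p r → con 1ℤ :+ (con 1ℤ :+ p) :- r := con 1ℤ :+ (con 1ℤ :+ p :- r)) ≡.refl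

  1+[1-[1+r]]≡1-r : ∀ r → 1ℤ + (1ℤ - (1ℤ + r)) ≡ 1ℤ - r
  1+[1-[1+r]]≡1-r = solve 1 (λ r → con 1ℤ :+ (con 1ℤ :- (con 1ℤ :+ r)) := con 1ℤ :- r) ≡.refl

  -a+-[1-[1+r]]≡-[a+-r] : ∀ a r → - a + - (1ℤ - (1ℤ + r)) ≡ - (a + - r)
  -a+-[1-[1+r]]≡-[a+-r] = solve 2 (λ a r → :- a :+ :- (con 1ℤ :- (con 1ℤ :+ r)) := :- (a :+ :- r)) ≡.refl

  -a+-[1+p]≡-[a-1+[1+[1+p]]] : ∀ a p → - a + - (1ℤ + p) ≡ - (a - 1ℤ + (1ℤ + (1ℤ + p)))
  -a+-[1+p]≡-[a-1+[1+[1+p]]] = solve 2 (λ a p → :- a :+ :- (con 1ℤ :+ p) := :- (a :- con 1ℤ :+ (con 1ℤ :+ (con 1ℤ :+ p)))) ≡.refl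

  r-1≡-1+r : ∀ r → r - 1ℤ ≡ -1ℤ + r
  r-1≡-1+r = solve 1 (λ r → r :- con 1ℤ := con -1ℤ :+ r) ≡.refl

  -[1+p]≡-p+-1 : ∀ p → - (1ℤ + p) ≡ - p + -1ℤ
  -[1+p]≡-p+-1 = solve 1 (λ p → :- (con 1ℤ :+ p) := :- p :+ con -1ℤ) ≡.refl

  1+-[1+j]≡-j : ∀ j → 1ℤ + -[1+ j ] ≡ - (+ j)
  1+-[1+j]≡-j zero    = ≡.refl
  1+-[1+j]≡-j (suc j) = ≡.refl

  k<-j⇒k+j<0 : ∀ {k j} → k ℤ.< - j → k + j ℤ.< 0ℤ
  k<-j⇒k+j<0 {k} {j} lt = ≡.subst (k + j ℤ.<_) (ℤₚ.+-inverseˡ j) (ℤₚ.+-monoˡ-< j lt)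

  1+[-n-[1+p]]≡-n-p : ∀ n p → 1ℤ + (- n - (1ℤ + p)) ≡ - n - p
  1+[-n-[1+p]]≡-n-p = solve 2 (λ n p → con 1ℤ :+ (:- n :- (con 1ℤ :+ p)) := :- n :- p) ≡.refl

  -n-[1+p]+p≡-[1+n] : ∀ n p → - n - (1ℤ + p) + p ≡ - (1ℤ + n)
  -n-[1+p]+p≡-[1+n] = solve 2 (λ n p → :- n :- (con 1ℤ :+ p) :+ p := :- (con 1ℤ :+ n)) ≡.refl

  -n-[1+p]≡-[1+n]-p : ∀ n p → - n - (1ℤ + p) ≡ - (1ℤ + n) - p
  -n-[1+p]≡-[1+n]-p = solve 2 (λ n p → :- n :- (con 1ℤ :+ p) := :- (con 1ℤ :+ n) :- p) ≡.refl

  -1+-n≡-[1+n] : ∀ n → -1ℤ + - n ≡ - (1ℤ + n)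
  -1+-n≡-[1+n] = solve 1 (λ n → con -1ℤ :+ :- n := :- (con 1ℤ :+ n)) ≡.refl

  -[n-[-m-1]-p]-p≡-n-m-1 : ∀ n m p → - (n - (- m - 1ℤ) - p) - p ≡ - n - m - 1ℤ
  -[n-[-m-1]-p]-p≡-n-m-1 = solve 3 (λ n m p → :- (n :- (:- m :- con 1ℤ) :- p) :- p := :- n :- m :- con 1ℤ) ≡.refl

  -[n-m-p]≡p-[n-m] : ∀ n m p → - (n - m - p) ≡ p - (n - m)
  -[n-m-p]≡p-[n-m] = solve 3 (λ n m p → :- (n :- m :- p) := p :- (n :- m)) ≡.refl

  k+[-m-1]≡k-m-1 : ∀ k m → k + (- m - 1ℤ) ≡ k - m - 1ℤ
  k+[-m-1]≡k-m-1 = solve 2 (λ k m → k :+ (:- m :- con 1ℤ) := k :- m :- con 1ℤ) ≡.refl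

  k-m-1+m≡k-1 : ∀ k m → k - m - 1ℤ + m ≡ k - 1ℤ
  k-m-1+m≡k-1 = solve 2 (λ k m → k :- m :- con 1ℤ :+ m := k :- con 1ℤ) ≡.refl

  p+m-k≡p-[k-m] : ∀ p m k → p + m - k ≡ p - (k - m)
  p+m-k≡p-[k-m] = solve 3 (λ p m k → p :+ m :- k := p :- (k :- m)) ≡.refl

  1+p-[p+m-k]≡k+1-m : ∀ p m k → 1ℤ + p - (p + m - k) ≡ k + 1ℤ - m
  1+p-[p+m-k]≡k+1-m = solve 3 (λ p m k → con 1ℤ :+ p :- (p :+ m :- k) := k :+ con 1ℤ :- m) ≡.refl

  -p-1≡-[1+p] : ∀ p → - (+ p) - 1ℤ ≡ -[1+ p ]
  -p-1≡-[1+p] zero    = ≡.refl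
  -p-1≡-[1+p] (suc p) = ≡.cong (λ i → -[1+ suc i ]) (ℕₚ.+-identityʳ p)

-- Commutative rings: integer multiples, finite sums, finitely supported sums over ℕ and ℤ.

module RingTools {c ℓ} (R : CommutativeRing c ℓ) where
  open CommutativeRing R hiding (zero)
  open RingNotions R public
  open Algebra.Properties.CommutativeMonoid.Sum +-commutativeMonoid public
    using (sum; sum-syntax; sum-cong-≋; ∑-distrib-+; ∑-comm; sum-init-last)
  open Algebra.Properties.Semiring.Sum semiring public using (*-distribˡ-sum; *-distribʳ-sum)
  open import Algebra.Properties.Semiring.Exp semiring public using (_^_)
  open Algebra.Properties.Ring ring public
    using (-0#≈0#; -‿distribˡ-*; -‿distribʳ-*; -‿+-comm; -‿involutive; -1*x≈-x; x+x≈x⇒x≈0)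
  private module M = Algebra.Properties.Semiring.Mult semiring
  open Relation.Binary.Reasoning.Setoid setoid

  reflexive-cong : ∀ {a} {A : Set a} (f : A → Carrier) {x y} → x ≡ y → f x ≈ f y
  reflexive-cong f p = reflexive (≡.cong f p)

  fromℤ-⊖ : ∀ m n → fromℤ (m ℤ.⊖ n) ≈ fromℕ m - fromℕ n
  fromℤ-⊖ m zero = sym (trans (+-congˡ -0#≈0#) (+-identityʳ _))
  fromℤ-⊖ zero (suc n) = sym (+-identityˡ _)
  fromℤ-⊖ (suc m) (suc n) = begin
    fromℤ (suc m ℤ.⊖ suc n)            ≈⟨ reflexive-cong fromℤ (ℤₚ.[1+m]⊖[1+n]≡m⊖n m n) ⟩
    fromℤ (m ℤ.⊖ n)                    ≈⟨ fromℤ-⊖ m n ⟩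
    fromℕ m - fromℕ n                  ≈⟨ +-congʳ (+-identityˡ _) ⟨
    0# + fromℕ m - fromℕ n             ≈⟨ +-congʳ (+-congʳ (-‿inverseʳ 1#)) ⟨
    1# - 1# + fromℕ m - fromℕ n        ≈⟨ +-congʳ (trans (+-assoc _ _ _) (trans (+-congˡ (+-comm _ _)) (sym (+-assoc _ _ _)))) ⟩
    1# + fromℕ m - 1# - fromℕ n        ≈⟨ +-assoc _ _ _ ⟩
    1# + fromℕ m + (- 1# - fromℕ n)    ≈⟨ +-congˡ (-‿+-comm _ _) ⟩
    fromℕ (suc m) - fromℕ (suc n)      ∎

  fromℤ-+ : ∀ a b → fromℤ (a ℤ.+ b) ≈ fromℤ a + fromℤ b
  fromℤ-+ (+ m)    (+ n)    = M.×-homo-+ 1# m n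
  fromℤ-+ (+ m)    -[1+ n ] = fromℤ-⊖ m (suc n)
  fromℤ-+ -[1+ m ] (+ n)    = trans (fromℤ-⊖ n (suc m)) (+-comm _ _)
  fromℤ-+ -[1+ m ] -[1+ n ] = begin
    - fromℕ (suc (suc (m ℕ.+ n)))       ≈⟨ -‿cong (reflexive-cong fromℕ (≡.cong suc (≡.sym (ℕₚ.+-suc m n)))) ⟩
    - fromℕ (suc m ℕ.+ suc n)           ≈⟨ -‿cong (M.×-homo-+ 1# (suc m) (suc n)) ⟩
    - (fromℕ (suc m) + fromℕ (suc n))   ≈⟨ -‿+-comm _ _ ⟨
    - fromℕ (suc m) - fromℕ (suc n)     ∎

  fromℤ-neg : ∀ a → fromℤ (ℤ.- a) ≈ - fromℤ a
  fromℤ-neg (+ zero)  = sym -0#≈0#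
  fromℤ-neg (+ suc n) = refl
  fromℤ-neg -[1+ n ]  = sym (-‿involutive _)

  private
    fromℤ-*⁺ : ∀ m b → fromℤ (+ m ℤ.* b) ≈ fromℕ m * fromℤ b
    fromℤ-*⁺ m (+ n) = trans (reflexive-cong fromℤ (≡.sym (ℤₚ.pos-* m n))) (M.×1-homo-* m n)
    fromℤ-*⁺ m -[1+ n ] = begin
      fromℤ (+ m ℤ.* -[1+ n ])        ≈⟨ reflexive-cong fromℤ (ℤₚ.neg-distribʳ-* (+ m) (+ suc n)) ⟨
      fromℤ (ℤ.- (+ m ℤ.* + suc n))   ≈⟨ fromℤ-neg (+ m ℤ.* + suc n) ⟩
      - fromℤ (+ m ℤ.* + suc n)       ≈⟨ -‿cong (fromℤ-*⁺ m (+ suc n)) ⟩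
      - (fromℕ m * fromℕ (suc n))     ≈⟨ -‿distribʳ-* _ _ ⟩
      fromℕ m * - fromℕ (suc n)       ∎

  fromℤ-* : ∀ a b → fromℤ (a ℤ.* b) ≈ fromℤ a * fromℤ b
  fromℤ-* (+ m) b = fromℤ-*⁺ m b
  fromℤ-* -[1+ m ] b = begin
    fromℤ (-[1+ m ] ℤ.* b)          ≈⟨ reflexive-cong fromℤ (ℤₚ.neg-distribˡ-* (+ suc m) b) ⟨
    fromℤ (ℤ.- (+ suc m ℤ.* b))     ≈⟨ fromℤ-neg (+ suc m ℤ.* b) ⟩
    - fromℤ (+ suc m ℤ.* b)         ≈⟨ -‿cong (fromℤ-*⁺ (suc m) b) ⟩
    - (fromℕ (suc m) * fromℤ b)     ≈⟨ -‿distribˡ-* _ _ ⟩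
    - fromℕ (suc m) * fromℤ b       ∎

  -- fromℤ 1 is 1# + 0#; the constant 1 of the ring solver has to be 1# itself.
  ⟦_⟧ℤ : ℤ → Carrier
  ⟦ + 1 ⟧ℤ = 1#
  ⟦ a ⟧ℤ   = fromℤ a

  ⟦⟧ℤ≈fromℤ : ∀ a → ⟦ a ⟧ℤ ≈ fromℤ a
  ⟦⟧ℤ≈fromℤ (+ 0)           = refl
  ⟦⟧ℤ≈fromℤ (+ 1)           = sym (+-identityʳ 1#)
  ⟦⟧ℤ≈fromℤ (+ suc (suc n)) = refl
  ⟦⟧ℤ≈fromℤ -[1+ n ]        = refl

  -- Equality in `R` is not assumed decidable, so normal forms have integer coefficients, mapped to
  -- `R` by `⟦_⟧ℤ`.
  ℤ-coefficients : ℤ.+-*-rawRing -Raw-AlmostCommutative⟶ fromCommutativeRing R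
  ℤ-coefficients = record
    { ⟦_⟧    = ⟦_⟧ℤ
    ; +-homo = λ a b → trans (⟦⟧ℤ≈fromℤ (a ℤ.+ b)) (trans (fromℤ-+ a b) (sym (+-cong (⟦⟧ℤ≈fromℤ a) (⟦⟧ℤ≈fromℤ b))))
    ; *-homo = λ a b → trans (⟦⟧ℤ≈fromℤ (a ℤ.* b)) (trans (fromℤ-* a b) (sym (*-cong (⟦⟧ℤ≈fromℤ a) (⟦⟧ℤ≈fromℤ b))))
    ; -‿homo = λ a → trans (⟦⟧ℤ≈fromℤ (ℤ.- a)) (trans (fromℤ-neg a) (sym (-‿cong (⟦⟧ℤ≈fromℤ a))))
    ; 0-homo = refl
    ; 1-homo = refl
    }

  open Algebra.Solver.Ring ℤ.+-*-rawRing (fromCommutativeRing R) ℤ-coefficients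
    (λ a b → mapMaybe (reflexive-cong ⟦_⟧ℤ) (dec⇒maybe (a ℤₚ.≟ b)))
    public using (solve; _:=_; _:+_; _:*_; _:-_; :-_; con)

  sgn-suc : ∀ n x → sgn (suc n) * x ≈ - (sgn n * x)
  sgn-suc n x = solve 2 (λ s x → (:- con 1ℤ) :* s :* x := :- (s :* x)) refl (sgn n) x

  sgn² : ∀ n → sgn n * sgn n ≈ 1#
  sgn² zero    = *-identityˡ 1#
  sgn² (suc n) = trans (solve 1 (λ s → (:- con 1ℤ) :* s :* ((:- con 1ℤ) :* s) := s :* s) refl (sgn n)) (sgn² n)

  ∑-cong : ∀ n {f g : ℕ → Carrier} → (∀ i → f i ≈ g i) → ∑[ i < n ] f (toℕ i) ≈ ∑[ i < n ] g (toℕ i)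
  ∑-cong n eq = sum-cong-≋ {n} (λ i → eq (toℕ i))

  ∑-cong-< : ∀ n {f g : ℕ → Carrier} → (∀ i → i ℕ.< n → f i ≈ g i) → ∑[ i < n ] f (toℕ i) ≈ ∑[ i < n ] g (toℕ i)
  ∑-cong-< zero    eq = refl
  ∑-cong-< (suc n) eq = +-cong (eq 0 (s≤s z≤n)) (∑-cong-< n (λ i i<n → eq (suc i) (s≤s i<n)))

  ∑-zero : ∀ n {f : ℕ → Carrier} → (∀ i → f i ≈ 0#) → ∑[ i < n ] f (toℕ i) ≈ 0#
  ∑-zero zero    eq = refl
  ∑-zero (suc n) eq = trans (+-cong (eq 0) (∑-zero n (λ i → eq (suc i)))) (+-identityˡ 0#)

  ∑-extend : ∀ {m n} {f : ℕ → Carrier} → (∀ i → m ℕ.≤ i → f i ≈ 0#) → m ℕ.≤ n →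
             ∑[ i < n ] f (toℕ i) ≈ ∑[ i < m ] f (toℕ i)
  ∑-extend {n = n} vanish z≤n       = ∑-zero n (λ i → vanish i z≤n)
  ∑-extend         vanish (s≤s m≤n) = +-congˡ (∑-extend (λ i m≤i → vanish (suc i) (s≤s m≤i)) m≤n)

  ∑-+ : ∀ n (f g : ℕ → Carrier) →
        ∑[ i < n ] (f (toℕ i) + g (toℕ i)) ≈ ∑[ i < n ] f (toℕ i) + ∑[ i < n ] g (toℕ i)
  ∑-+ n f g = ∑-distrib-+ {n} (λ i → f (toℕ i)) (λ i → g (toℕ i))

  ∑-* : ∀ n x (f : ℕ → Carrier) → x * ∑[ i < n ] f (toℕ i) ≈ ∑[ i < n ] (x * f (toℕ i))
  ∑-* n x f = *-distribˡ-sum x (λ (i : Fin n) → f (toℕ i))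

  -- Records around HasSumℕ and HasSumℤ, so that the summand can be inferred.
  record Sumℕ (f : ℕ → Carrier) (S : Carrier) : Set ℓ where
    constructor summed
    field hasSum : HasSumℕ f S
  open Sumℕ public

  record Sumℤ (f : ℤ → Carrier) (S : Carrier) : Set ℓ where
    constructor summed
    field hasSum : HasSumℤ f S
  open Sumℤ public

  module Σℕ where
    private variable
      f g : ℕ → Carrier
      S T : Carrier

    -- A bound may be enlarged at will, so two sums can be compared or added at the common bound
    -- `N ℕ.⊔ M`.
    resize : Sumℕ f S → ∃ λ N → ∀ M → N ℕ.≤ M → (∀ n → M ℕ.≤ n → f n ≈ 0#) × S ≈ ∑[ i < M ] f (toℕ i)
    resize (summed (N , v , e)) = N , λ M N≤M →
      (λ n M≤n → v n (ℕₚ.≤-trans N≤M M≤n)) , trans e (sym (∑-extend v N≤M))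

    respˡ : (∀ k → f k ≈ g k) → Sumℕ f S → Sumℕ g S
    respˡ eq (summed (N , v , e)) =
      summed (N , (λ n N≤n → trans (sym (eq n)) (v n N≤n)) , trans e (∑-cong N eq))

    respʳ : S ≈ T → Sumℕ f S → Sumℕ f T
    respʳ S≈T (summed (N , v , e)) = summed (N , v , trans (sym S≈T) e)

    -- The usual way below to prove an equation: both sides are exhibited as sums of one family.
    unique : Sumℕ f S → Sumℕ f T → S ≈ T
    unique p q with resize p | resize q
    ... | N , p′ | M , q′ =
      trans (proj₂ (p′ (N ℕ.⊔ M) (ℕₚ.m≤m⊔n N M))) (sym (proj₂ (q′ (N ℕ.⊔ M) (ℕₚ.m≤n⊔m N M))))

    finite : ∀ N → (∀ n → N ℕ.≤ n → f n ≈ 0#) → Sumℕ f (∑[ i < N ] f (toℕ i))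
    finite N v = summed (N , v , refl)

    value : ∀ N → (∀ n → N ℕ.≤ n → f n ≈ 0#) → Sumℕ f S → S ≈ ∑[ i < N ] f (toℕ i)
    value N v p = unique p (finite N v)

    plus : Sumℕ f S → Sumℕ g T → Sumℕ (λ k → f k + g k) (S + T)
    plus {f = f} {g = g} p q with resize p | resize q
    ... | N , p′ | M , q′ with p′ (N ℕ.⊔ M) (ℕₚ.m≤m⊔n N M) | q′ (N ℕ.⊔ M) (ℕₚ.m≤n⊔m N M)
    ... | v , e | w , d = summed (N ℕ.⊔ M ,
      (λ n le → trans (+-cong (v n le) (w n le)) (+-identityˡ 0#)) ,
      trans (+-cong e d) (sym (∑-+ (N ℕ.⊔ M) f g)))

    scale : ∀ x → Sumℕ f S → Sumℕ (λ k → x * f k) (x * S)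
    scale {f = f} x (summed (N , v , e)) = summed (N , (λ n le → trans (*-congˡ (v n le)) (zeroʳ x)) ,
      trans (*-congˡ e) (∑-* N x f))

    suc-shift : Sumℕ (f ∘ suc) S → Sumℕ f (f 0 + S)
    suc-shift (summed (N , v , e)) = summed (suc N , (λ { (suc n) (s≤s le) → v n le }) , +-congˡ e)

    suc-drop : Sumℕ f S → ∃ λ T → Sumℕ (f ∘ suc) T × S ≈ f 0 + T
    suc-drop {f = f} (summed (N , v , e)) = _ , h , unique (summed (N , v , e)) (suc-shift h)
      where
      h : Sumℕ (f ∘ suc) (∑[ i < N ] f (suc (toℕ i)))
      h = finite N (λ n le → v (suc n) (ℕₚ.m≤n⇒m≤1+n le))

  module Σℤ where
    private variable
      f g : ℤ → Carrier
      S T : Carrier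

    halves : Sumℕ (λ n → f (+ n)) S → Sumℕ (λ n → f -[1+ n ]) T → Sumℤ f (S + T)
    halves {f = f} p q with Σℕ.resize p | Σℕ.resize q
    ... | N , p′ | M , q′ with p′ (N ℕ.⊔ M) (ℕₚ.m≤m⊔n N M) | q′ (N ℕ.⊔ M) (ℕₚ.m≤n⊔m N M)
    ... | v , e | w , d = summed (N ℕ.⊔ M , (λ n le → v n le , w n le) ,
      trans (+-cong e d) (sym (∑-+ (N ℕ.⊔ M) (λ n → f (+ n)) (λ n → f -[1+ n ]))))

    split : Sumℤ f S → ∃ λ P → ∃ λ Q → Sumℕ (λ n → f (+ n)) P × Sumℕ (λ n → f -[1+ n ]) Q × S ≈ P + Q
    split {f = f} (summed (N , v , e)) = _ , _ , Σℕ.finite N (λ n le → proj₁ (v n le)) ,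
      Σℕ.finite N (λ n le → proj₂ (v n le)) , trans e (∑-+ N (λ n → f (+ n)) (λ n → f -[1+ n ]))

    toℕ-sum : Sumℤ f S → Sumℕ (λ n → f (+ n) + f -[1+ n ]) S
    toℕ-sum (summed (N , v , e)) =
      summed (N , (λ n le → trans (+-cong (proj₁ (v n le)) (proj₂ (v n le))) (+-identityˡ 0#)) , e)

    respˡ : (∀ k → f k ≈ g k) → Sumℤ f S → Sumℤ g S
    respˡ eq (summed (N , v , e)) = summed (N ,
      (λ n le → trans (sym (eq (+ n))) (proj₁ (v n le)) , trans (sym (eq -[1+ n ])) (proj₂ (v n le))) ,
      trans e (∑-cong N (λ i → +-cong (eq (+ i)) (eq -[1+ i ]))))

    respʳ : S ≈ T → Sumℤ f S → Sumℤ f T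
    respʳ S≈T (summed (N , v , e)) = summed (N , v , trans (sym S≈T) e)

    unique : Sumℤ f S → Sumℤ f T → S ≈ T
    unique p q = Σℕ.unique (toℕ-sum p) (toℕ-sum q)

    plus : Sumℤ f S → Sumℤ g T → Sumℤ (λ k → f k + g k) (S + T)
    plus p q with split p | split q
    ... | _ , _ , p₁ , p₂ , e | _ , _ , q₁ , q₂ , d =
      respʳ (trans (solve 4 (λ a b c d → (a :+ b) :+ (c :+ d) := (a :+ c) :+ (b :+ d)) refl _ _ _ _)
                   (+-cong (sym e) (sym d)))
            (halves (Σℕ.plus p₁ q₁) (Σℕ.plus p₂ q₂))

    scale : ∀ x → Sumℤ f S → Sumℤ (λ k → x * f k) (x * S)
    scale x p with split p
    ... | _ , _ , p₁ , p₂ , e =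
      respʳ (trans (sym (distribˡ _ _ _)) (*-congˡ (sym e))) (halves (Σℕ.scale x p₁) (Σℕ.scale x p₂))

    zero-sum : (∀ k → f k ≈ 0#) → Sumℤ f 0#
    zero-sum eq = summed (0 , (λ n _ → eq (+ n) , eq -[1+ n ]) , refl)

    finite-sum : ∀ n {f : ℕ → ℤ → Carrier} {S : ℕ → Carrier} → (∀ i → Sumℤ (f i) (S i)) →
                 Sumℤ (λ k → ∑[ i < n ] f (toℕ i) k) (∑[ i < n ] S (toℕ i))
    finite-sum zero    p = zero-sum (λ _ → refl)
    finite-sum (suc n) p = plus (p 0) (finite-sum n (λ i → p (suc i)))

    -- The reflection k ↦ -1-k exchanges `+ n` and `-[1+ n]`, so it merely interchanges the two
    -- halves. The other reflections, and the shift by -1, are composed from it.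
    swap : Sumℤ f S → Sumℤ (λ k → f (-1ℤ ℤ.- k)) S
    swap {f = f} p with split p
    ... | _ , _ , p₁ , p₂ , e = respʳ (trans (+-comm _ _) (sym e))
      (halves (Σℕ.respˡ (λ n → reflexive-cong f (neg-pos n)) p₂) p₁)
      where
      neg-pos : ∀ n → -[1+ n ] ≡ -1ℤ ℤ.- + n
      neg-pos zero    = ≡.refl
      neg-pos (suc n) = ≡.refl

    -- The value at `0ℤ` leaves the nonnegative half and becomes the first term of the negative
    -- half.
    suc-shift : Sumℤ f S → Sumℤ (λ k → f (ℤ.suc k)) S
    suc-shift p with split p
    ... | P , Q , p₁ , p₂ , e with Σℕ.suc-drop p₁
    ... | T , p₃ , d = respʳ
      (trans (trans (sym (+-assoc _ _ _)) (+-congʳ (trans (+-comm _ _) (sym d)))) (sym e))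
      (halves p₃ (Σℕ.suc-shift p₂))

    pred-shift : Sumℤ f S → Sumℤ (λ k → f (ℤ.pred k)) S
    pred-shift {f = f} p = respˡ (λ k → reflexive-cong f (pred-eq k)) (swap (suc-shift (swap p)))
      where
      pred-eq : ∀ k → -1ℤ ℤ.- ℤ.suc (-1ℤ ℤ.- k) ≡ ℤ.pred k
      pred-eq (+ zero)        = ≡.refl
      pred-eq (+ suc zero)    = ≡.refl
      pred-eq (+ suc (suc n)) = ≡.refl
      pred-eq -[1+ n ]        = ≡.refl

    shift : ∀ c → Sumℤ f S → Sumℤ (λ k → f (k ℤ.+ c)) S
    shift {f = f} (+ zero) p = respˡ (λ k → reflexive-cong f (≡.sym (ℤₚ.+-identityʳ k))) p
    shift {f = f} (+ suc n) p =
      respˡ (λ k → reflexive-cong f (ℤ-identities.i+k+c≡k+[i+c] 1ℤ k (+ n))) (suc-shift (shift {f} (+ n) p))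
    shift {f = f} -[1+ zero ] p = respˡ (λ k → reflexive-cong f (ℤₚ.+-comm -1ℤ k)) (pred-shift p)
    shift {f = f} -[1+ suc n ] p =
      respˡ (λ k → reflexive-cong f (ℤ-identities.i+k+c≡k+[i+c] -1ℤ k -[1+ n ])) (pred-shift (shift {f} -[1+ n ] p))

    reflect : ∀ c → Sumℤ f S → Sumℤ (λ k → f (c ℤ.- k)) S
    reflect {f = f} c p =
      respˡ (λ k → reflexive-cong f (ℤ-identities.-1-k+[c+1]≡c-k c k)) (swap (shift {f} (c ℤ.+ 1ℤ) p))

    private
      ∣∣-bound : ∀ lo hi n → ℤ.∣ lo ∣ ℕ.⊔ ℤ.∣ hi ∣ ℕ.≤ n → hi ℤ.≤ + n × -[1+ n ] ℤ.< lo
      ∣∣-bound lo hi n le =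
        upper hi (ℕₚ.≤-trans (ℕₚ.m≤n⊔m ℤ.∣ lo ∣ _) le) , lower lo (ℕₚ.≤-trans (ℕₚ.m≤m⊔n _ ℤ.∣ hi ∣) le)
        where
        upper : ∀ i → ℤ.∣ i ∣ ℕ.≤ n → i ℤ.≤ + n
        upper (+ i)    le = ℤ.+≤+ le
        upper -[1+ i ] le = ℤ.-≤+
        lower : ∀ i → ℤ.∣ i ∣ ℕ.≤ n → -[1+ n ] ℤ.< i
        lower (+ i)    le = ℤ.-<+
        lower -[1+ i ] le = ℤ.-<- le

    -- Names a sum whose value need not be known: the family only has to vanish outside lo ≤ k < hi.
    exists : ∀ lo hi → (∀ k → k ℤ.< lo → f k ≈ 0#) → (∀ k → hi ℤ.≤ k → f k ≈ 0#) → ∃ λ S → Sumℤ f S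
    exists lo hi below above = _ , summed (ℤ.∣ lo ∣ ℕ.⊔ ℤ.∣ hi ∣ ,
      (λ n le → above (+ n) (proj₁ (∣∣-bound lo hi n le)) , below -[1+ n ] (proj₂ (∣∣-bound lo hi n le))) , refl)

    from-ℕ : (∀ n → f -[1+ n ] ≈ 0#) → Sumℕ (λ n → f (+ n)) S → Sumℤ f S
    from-ℕ neg p = respʳ (+-identityʳ _) (halves p (Σℕ.finite 0 (λ n _ → neg n)))

    to-ℕ : (∀ n → f -[1+ n ] ≈ 0#) → Sumℤ f S → Sumℕ (λ n → f (+ n)) S
    to-ℕ neg p = Σℕ.respˡ (λ n → trans (+-congˡ (neg n)) (+-identityʳ _)) (toℕ-sum p)

    single : ∀ c → (∀ k → k ≢ c → f k ≈ 0#) → Sumℤ f (f c)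
    single {f = f} c off = respˡ (λ k → reflexive-cong f (ℤ-identities.k-c+c≡k k c))
        (shift {λ k → f (k ℤ.+ c)} (ℤ.- c) (respʳ (reflexive-cong f (ℤₚ.+-identityˡ c)) at0))
      where
      nonzero : ∀ k → k ≢ 0ℤ → k ℤ.+ c ≢ c
      nonzero k k≢0 e = k≢0 (≡.trans (≡.sym (ℤ-identities.k+c-c≡k k c)) (ℤₚ.i≡j⇒i-j≡0 e))
      at0 : Sumℤ (λ k → f (k ℤ.+ c)) (f (0ℤ ℤ.+ c))
      at0 = from-ℕ (λ n → off _ (nonzero -[1+ n ] λ ()))
        (Σℕ.respʳ (+-identityʳ _) (Σℕ.finite 1 (λ { (suc n) _ → off _ (nonzero (+ suc n) λ ()) })))

-- Images of finitely supported sums under additive maps.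

module SumMap {a b ℓa ℓb} (R : CommutativeRing a ℓa) (R′ : CommutativeRing b ℓb) where
  private
    module R  = CommutativeRing R
    module R′ = CommutativeRing R′
    module T  = RingTools R
    module T′ = RingTools R′

  module _ {H : R.Carrier → R′.Carrier} (H-cong : ∀ {x y} → x R.≈ y → H x R′.≈ H y) (H-0 : H R.0# R′.≈ R′.0#)
           (H-+ : ∀ x y → H (x R.+ y) R′.≈ H x R′.+ H y) where

    private
      H-∑ : ∀ N (t : ℕ → R.Carrier) {t′ : ℕ → R′.Carrier} → (∀ n → H (t n) R′.≈ t′ n) →
            H (T.∑[ i < N ] t (toℕ i)) R′.≈ T′.∑[ i < N ] t′ (toℕ i)
      H-∑ zero    t eq = H-0
      H-∑ (suc N) t eq = R′.trans (H-+ _ _) (R′.+-cong (eq 0) (H-∑ N (λ n → t (suc n)) (λ n → eq (suc n))))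

    mapℤ : ∀ {f S} → T.Sumℤ f S → T′.Sumℤ (λ k → H (f k)) (H S)
    mapℤ {f} (T.summed (N , v , e)) = T′.summed (N ,
      (λ n le → R′.trans (H-cong (proj₁ (v n le))) H-0 , R′.trans (H-cong (proj₂ (v n le))) H-0) ,
      R′.trans (H-cong e) (H-∑ N (λ n → f (+ n) R.+ f -[1+ n ]) (λ n → H-+ _ _)))

    mapℕ : ∀ {f S} → T.Sumℕ f S → T′.Sumℕ (λ k → H (f k)) (H S)
    mapℕ {f} (T.summed (N , v , e)) = T′.summed (N ,
      (λ n le → R′.trans (H-cong (v n le)) H-0) , R′.trans (H-cong e) (H-∑ N f (λ n → R′.refl)))

-- Determinants as alternating forms on lists of columns.

module Forms {c ℓ} (R : CommutativeRing c ℓ) (Column : Set) where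
  open CommutativeRing R hiding (zero)
  open RingTools R
  open Relation.Binary.Reasoning.Setoid setoid

  -- A form takes a list of columns of any length, so that contraction with a column, the basic
  -- operation of every induction here, is `F ∘ (c ∷_)` and involves no reindexing by `punchIn`.
  Row Form : Set c
  Row  = Column → Carrier
  Form = List Column → Carrier

  infixr 6 _∧_

  -- Expansion along a new first row; F ∘ (c ∷_) is the form F contracted with the column c.
  _∧_ : Row → Form → Form
  (r ∧ F) []       = 0#
  (r ∧ F) (c ∷ cs) = r c * F cs - (r ∧ (F ∘ (c ∷_))) cs

  -- The value 0 on nonempty lists makes `minor rs` vanish unless there are as many columns as rows.
  unit : Form
  unit []      = 1#
  unit (_ ∷ _) = 0#

  minor : List Row → Form
  minor = foldr _∧_ unit

  ∧-cong : ∀ {r s F G} → (∀ c → r c ≈ s c) → (∀ cs → F cs ≈ G cs) → ∀ cs → (r ∧ F) cs ≈ (s ∧ G) cs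
  ∧-cong r≈s F≈G []       = refl
  ∧-cong r≈s F≈G (c ∷ cs) =
    +-cong (*-cong (r≈s c) (F≈G cs)) (-‿cong (∧-cong r≈s (λ ds → F≈G (c ∷ ds)) cs))

  ∧-linear : ∀ r x F G cs → (r ∧ (λ ds → x * F ds + G ds)) cs ≈ x * (r ∧ F) cs + (r ∧ G) cs
  ∧-linear r x F G []       = solve 1 (λ x → con 0ℤ := x :* con 0ℤ :+ con 0ℤ) refl x
  ∧-linear r x F G (c ∷ cs) = trans (+-congˡ (-‿cong (∧-linear r x _ _ cs)))
    (solve 6 (λ x rc f g f′ g′ → rc :* (x :* f :+ g) :- (x :* f′ :+ g′) := x :* (rc :* f :- f′) :+ (rc :* g :- g′))
      refl x (r c) (F cs) (G cs) _ _)

  ∧-zero : ∀ r cs → (r ∧ (λ _ → 0#)) cs ≈ 0#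
  ∧-zero r []       = refl
  ∧-zero r (c ∷ cs) = trans (+-congˡ (-‿cong (∧-zero r cs)))
    (solve 1 (λ x → x :* con 0ℤ :- con 0ℤ := con 0ℤ) refl (r c))

  ∧-neg : ∀ r F cs → (r ∧ (λ ds → - F ds)) cs ≈ - (r ∧ F) cs
  ∧-neg r F cs = begin
    (r ∧ (λ ds → - F ds)) cs               ≈⟨ ∧-cong (λ _ → refl) (λ ds → solve 1 (λ f → :- f := (:- con 1ℤ) :* f :+ con 0ℤ) refl (F ds)) cs ⟩
    (r ∧ (λ ds → - 1# * F ds + 0#)) cs     ≈⟨ ∧-linear r (- 1#) F (λ _ → 0#) cs ⟩
    - 1# * (r ∧ F) cs + (r ∧ (λ _ → 0#)) cs ≈⟨ +-congˡ (∧-zero r cs) ⟩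
    - 1# * (r ∧ F) cs + 0#                 ≈⟨ solve 1 (λ f → (:- con 1ℤ) :* f :+ con 0ℤ := :- f) refl _ ⟩
    - (r ∧ F) cs                           ∎

  ∧-sum : ∀ r n (x : ℕ → Carrier) (F : ℕ → Form) cs →
          (r ∧ (λ ds → ∑[ t < n ] (x (toℕ t) * F (toℕ t) ds))) cs ≈ ∑[ t < n ] (x (toℕ t) * (r ∧ F (toℕ t)) cs)
  ∧-sum r zero    x F cs = ∧-zero r cs
  ∧-sum r (suc n) x F cs = trans (∧-linear r (x 0) (F 0) _ cs) (+-congˡ (∧-sum r n (x ∘ suc) (F ∘ suc) cs))

  private
    ∧-contract : ∀ r s F c cs → (r ∧ (λ ds → (s ∧ F) (c ∷ ds))) cs ≈ s c * (r ∧ F) cs - (r ∧ s ∧ (F ∘ (c ∷_))) cs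
    ∧-contract r s F c cs = trans (∧-linear r (s c) F (λ ds → - (s ∧ (F ∘ (c ∷_))) ds) cs) (+-congˡ (∧-neg r _ cs))

  -- Contracting with the first column produces r c · (s ∧ F) and s c · (r ∧ F) with opposite signs;
  -- what remains is the same claim for the contracted form.
  ∧-swap : ∀ r s F cs → (r ∧ s ∧ F) cs ≈ - (s ∧ r ∧ F) cs
  ∧-swap r s F []       = sym -0#≈0#
  ∧-swap r s F (c ∷ cs) = begin
    r c * (s ∧ F) cs - (r ∧ (λ ds → (s ∧ F) (c ∷ ds))) cs
      ≈⟨ +-congˡ (-‿cong (trans (∧-contract r s F c cs) (+-congˡ (-‿cong (∧-swap r s _ cs))))) ⟩
    r c * (s ∧ F) cs - (s c * (r ∧ F) cs - - (s ∧ r ∧ (F ∘ (c ∷_))) cs)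
      ≈⟨ solve 5 (λ rc sF sc rF srF → rc :* sF :- (sc :* rF :- :- srF) := :- (sc :* rF :- (rc :* sF :- srF))) refl _ _ _ _ _ ⟩
    - (s c * (r ∧ F) cs - (r c * (s ∧ F) cs - (s ∧ r ∧ (F ∘ (c ∷_))) cs))
      ≈⟨ -‿cong (+-congˡ (-‿cong (∧-contract s r F c cs))) ⟨
    - (s c * (r ∧ F) cs - (s ∧ (λ ds → (r ∧ F) (c ∷ ds))) cs)
      ∎

  -- Needs its own induction: `∧-swap` only says that this value equals its negative.
  ∧-self : ∀ r F cs → (r ∧ r ∧ F) cs ≈ 0#
  ∧-self r F []       = refl
  ∧-self r F (c ∷ cs) = begin
    r c * (r ∧ F) cs - (r ∧ (λ ds → (r ∧ F) (c ∷ ds))) cs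
      ≈⟨ +-congˡ (-‿cong (trans (∧-contract r r F c cs) (+-congˡ (-‿cong (∧-self r _ cs))))) ⟩
    r c * (r ∧ F) cs - (r c * (r ∧ F) cs - 0#)
      ≈⟨ solve 1 (λ x → x :- (x :- con 0ℤ) := con 0ℤ) refl _ ⟩
    0# ∎

  -- Only adjacent columns are mentioned, but after an arbitrary prefix; this is what makes the
  -- property pass to contractions.
  record Alternating (F : Form) : Set (c Level.⊔ ℓ) where
    field
      exchange : ∀ pre a b post → F (pre ++ a ∷ b ∷ post) ≈ - F (pre ++ b ∷ a ∷ post)
      repeat   : ∀ pre a post → F (pre ++ a ∷ a ∷ post) ≈ 0#
  open Alternating

  contract-alternating : ∀ {F} → Alternating F → ∀ c → Alternating (F ∘ (c ∷_))
  contract-alternating alt c .exchange pre = exchange alt (c ∷ pre)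
  contract-alternating alt c .repeat   pre = repeat alt (c ∷ pre)

  unit-alternating : Alternating unit
  unit-alternating .exchange []      a b post = sym -0#≈0#
  unit-alternating .exchange (_ ∷ _) a b post = sym -0#≈0#
  unit-alternating .repeat   []      a post   = refl
  unit-alternating .repeat   (_ ∷ _) a post   = refl

  ∧-alternating : ∀ r {F} → Alternating F → Alternating (r ∧ F)
  ∧-alternating r {F} alt .exchange [] a b post = begin
    r a * F (b ∷ post) - (r b * F (a ∷ post) - (r ∧ (λ cs → F (a ∷ b ∷ cs))) post)
      ≈⟨ +-congˡ (-‿cong (+-congˡ (-‿cong (trans (∧-cong (λ _ → refl) (λ cs → exchange alt [] a b cs) post) (∧-neg r _ post))))) ⟩
    r a * F (b ∷ post) - (r b * F (a ∷ post) - - (r ∧ (λ cs → F (b ∷ a ∷ cs))) post)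
      ≈⟨ solve 3 (λ x y z → x :- (y :- :- z) := :- (y :- (x :- z))) refl _ _ _ ⟩
    - (r b * F (a ∷ post) - (r a * F (b ∷ post) - (r ∧ (λ cs → F (b ∷ a ∷ cs))) post)) ∎
  ∧-alternating r alt .exchange (c ∷ pre) a b post =
    trans (+-cong (*-congˡ (exchange alt pre a b post))
                  (-‿cong (exchange (∧-alternating r (contract-alternating alt c)) pre a b post)))
          (solve 3 (λ x y z → x :* :- y :- :- z := :- (x :* y :- z)) refl _ _ _)
  ∧-alternating r {F} alt .repeat [] a post = begin
    r a * F (a ∷ post) - (r a * F (a ∷ post) - (r ∧ (λ cs → F (a ∷ a ∷ cs))) post)
      ≈⟨ solve 2 (λ x z → x :- (x :- z) := z) refl _ _ ⟩
    (r ∧ (λ cs → F (a ∷ a ∷ cs))) post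
      ≈⟨ ∧-cong (λ _ → refl) (λ cs → repeat alt [] a cs) post ⟩
    (r ∧ (λ _ → 0#)) post
      ≈⟨ ∧-zero r post ⟩
    0# ∎
  ∧-alternating r alt .repeat (c ∷ pre) a post =
    trans (+-cong (*-congˡ (repeat alt pre a post))
                  (-‿cong (repeat (∧-alternating r (contract-alternating alt c)) pre a post)))
          (solve 1 (λ x → x :* con 0ℤ :- con 0ℤ := con 0ℤ) refl _)

  minor-alternating : ∀ rs → Alternating (minor rs)
  minor-alternating []       = unit-alternating
  minor-alternating (r ∷ rs) = ∧-alternating r (minor-alternating rs)

  -- Adjacent exchanges carry the first `c` to its copy, each changing only the sign.
  repeated-column : ∀ {F} → Alternating F → ∀ c pre post → F (c ∷ pre ++ c ∷ post) ≈ 0#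
  repeated-column alt c []        post = repeat alt [] c post
  repeated-column alt c (d ∷ pre) post =
    trans (exchange alt [] c d _)
      (trans (-‿cong (repeated-column (contract-alternating alt d) c pre post)) -0#≈0#)

  private
    pull : ∀ s x y → - 1# * (s * x * y) ≈ - 1# * s * x * y
    pull = solve 3 (λ s x y → (:- con 1ℤ) :* (s :* x :* y) := (:- con 1ℤ) :* s :* x :* y) refl

  ∧-expand : ∀ r F n (g : Fin (suc n) → Column) →
    (r ∧ F) (tabulate g) ≈ ∑[ j < suc n ] (sgn (toℕ j) * r (g j) * F (tabulate (g ∘ punchIn j)))
  ∧-expand r F zero g = solve 2 (λ x y → x :* y :- con 0ℤ := con 1ℤ :* x :* y :+ con 0ℤ) refl (r (g zero)) (F [])
  ∧-expand r F (suc n) g = begin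
    r (g zero) * F (tabulate (g ∘ suc)) - (r ∧ (F ∘ (g zero ∷_))) (tabulate (g ∘ suc))
      ≈⟨ +-cong (sym (*-congʳ (*-identityˡ _))) (-‿cong (∧-expand r (F ∘ (g zero ∷_)) n (g ∘ suc))) ⟩
    1# * r (g zero) * F (tabulate (g ∘ suc)) - sum rest
      ≈⟨ +-congˡ (trans (sym (-1*x≈-x _)) (*-distribˡ-sum (- 1#) rest)) ⟩
    1# * r (g zero) * F (tabulate (g ∘ suc)) + ∑[ j < suc n ] (- 1# * rest j)
      ≈⟨ +-congˡ (sum-cong-≋ {suc n} (λ j → pull (sgn (toℕ j)) (r (g (suc j))) (F (g zero ∷ tabulate (g ∘ suc ∘ punchIn j))))) ⟩
    ∑[ j < suc (suc n) ] (sgn (toℕ j) * r (g j) * F (tabulate (g ∘ punchIn j))) ∎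
    where
    rest : Fin (suc n) → Carrier
    rest j = sgn (toℕ j) * r (g (suc j)) * F (g zero ∷ tabulate (g ∘ suc ∘ punchIn j))

  det-minor : ∀ {n} (r : Fin n → Row) (g : Fin n → Column) →
              det {n} (λ i j → r i (g j)) ≈ minor (tabulate r) (tabulate g)
  det-minor {zero}  r g = refl
  det-minor {suc n} r g =
    trans (sum-cong-≋ {suc n} (λ j → *-congˡ {sgn (toℕ j) * r zero (g j)} (det-minor (r ∘ suc) (g ∘ punchIn j))))
          (sym (∧-expand (r zero) (minor (tabulate (r ∘ suc))) n g))

  rowAt : List Row → ℕ → Row
  rowAt []       _       = λ _ → 0#
  rowAt (r ∷ rs) zero    = r
  rowAt (r ∷ rs) (suc t) = rowAt rs t

  removeRow : ℕ → List Row → List Row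
  removeRow _       []       = []
  removeRow zero    (r ∷ rs) = rs
  removeRow (suc t) (r ∷ rs) = r ∷ removeRow t rs

  -- Laplace expansion along the first column, whereas `_∧_` expands along the first row. The top
  -- row gives the term t = 0; the others come from the induction hypothesis, whose sum is moved out
  -- of `r ∧_` by linearity.
  column-expand : ∀ rs c cs →
    minor rs (c ∷ cs) ≈ ∑[ t < length rs ] (sgn (toℕ t) * rowAt rs (toℕ t) c * minor (removeRow (toℕ t) rs) cs)
  column-expand []       c cs = refl
  column-expand (r ∷ rs) c cs = begin
    r c * minor rs cs - (r ∧ (minor rs ∘ (c ∷_))) cs
      ≈⟨ +-cong (sym (*-congʳ (*-identityˡ _))) (-‿cong (∧-cong (λ _ → refl) (column-expand rs c) cs)) ⟩
    1# * r c * minor rs cs - (r ∧ (λ ds → ∑[ t < length rs ] (x (toℕ t) * M (toℕ t) ds))) cs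
      ≈⟨ +-congˡ (-‿cong (∧-sum r (length rs) x M cs)) ⟩
    1# * r c * minor rs cs - ∑[ t < length rs ] (x (toℕ t) * (r ∧ M (toℕ t)) cs)
      ≈⟨ +-congˡ (trans (sym (-1*x≈-x _)) (∑-* (length rs) (- 1#) (λ t → x t * (r ∧ M t) cs))) ⟩
    1# * r c * minor rs cs + ∑[ t < length rs ] (- 1# * (x (toℕ t) * (r ∧ M (toℕ t)) cs))
      ≈⟨ +-congˡ (∑-cong (length rs) (λ t → pull (sgn t) (rowAt rs t c) ((r ∧ M t) cs))) ⟩
    ∑[ t < suc (length rs) ] (sgn (toℕ t) * rowAt (r ∷ rs) (toℕ t) c * minor (removeRow (toℕ t) (r ∷ rs)) cs) ∎
    where
    x : ℕ → Carrier
    x t = sgn t * rowAt rs t c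
    M : ℕ → Form
    M t = minor (removeRow t rs)

  ∧-vanishing-row : ∀ r F {cs} → All (λ c → r c ≈ 0#) cs → (r ∧ F) cs ≈ 0#
  ∧-vanishing-row r F []       = refl
  ∧-vanishing-row r F (p ∷ ps) = trans (+-cong (*-congʳ p) (-‿cong (∧-vanishing-row r _ ps)))
    (solve 1 (λ x → con 0ℤ :* x :- con 0ℤ := con 0ℤ) refl _)

  ∧-vanishing-form : ∀ {p} {P : Column → Set p} r F → (∀ {cs} → All P cs → F cs ≈ 0#) → ∀ {cs} → All P cs → (r ∧ F) cs ≈ 0#
  ∧-vanishing-form r F v []       = refl
  ∧-vanishing-form r F v (p ∷ ps) = trans (+-cong (*-congˡ (v ps)) (-‿cong (∧-vanishing-form r _ (λ qs → v (p ∷ qs)) ps)))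
    (solve 1 (λ x → x :* con 0ℤ :- con 0ℤ := con 0ℤ) refl _)

  minor-∷ʳ-zero : ∀ rs r {cs} → All (λ c → r c ≈ 0#) cs → minor (rs ∷ʳ r) cs ≈ 0#
  minor-∷ʳ-zero []        r ps = ∧-vanishing-row r unit ps
  minor-∷ʳ-zero (r₀ ∷ rs) r ps = ∧-vanishing-form r₀ (minor (rs ∷ʳ r)) (minor-∷ʳ-zero rs r) ps

  -- A last row that is zero except in the last column splits off its corner entry; this gives the
  -- stability of `s` under appending a zero.
  minor-∷ʳ : ∀ rs r c {cs} → All (λ d → r d ≈ 0#) cs → minor (rs ∷ʳ r) (cs ∷ʳ c) ≈ minor rs cs * r c
  minor-∷ʳ [] r c [] = solve 1 (λ x → x :* con 1ℤ :- con 0ℤ := con 1ℤ :* x) refl (r c)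
  minor-∷ʳ [] r c {d ∷ cs} (p ∷ ps) =
    trans (+-cong (*-congʳ p) (-‿cong (∧-zero r (cs ∷ʳ c)))) (solve 2 (λ x y → con 0ℤ :* x :- con 0ℤ := con 0ℤ :* y) refl _ _)
  -- The two minors are replaced by arbitrary forms `F` and `G`, because the induction over the
  -- columns contracts both of them.
  minor-∷ʳ (r₀ ∷ rs) r c ps = go (minor (rs ∷ʳ r)) (minor rs) (minor-∷ʳ-zero rs r) (minor-∷ʳ rs r c) ps
    where
    go : ∀ F G → (∀ {cs} → All (λ d → r d ≈ 0#) cs → F cs ≈ 0#) →
         (∀ {cs} → All (λ d → r d ≈ 0#) cs → F (cs ∷ʳ c) ≈ G cs * r c) →
         ∀ {cs} → All (λ d → r d ≈ 0#) cs → (r₀ ∧ F) (cs ∷ʳ c) ≈ (r₀ ∧ G) cs * r c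
    go F G v h []       = trans (+-congʳ (*-congˡ (v []))) (solve 2 (λ x y → x :* con 0ℤ :- con 0ℤ := con 0ℤ :* y) refl _ _)
    go F G v h (p ∷ ps) = trans (+-cong (*-congˡ (h ps)) (-‿cong (go _ _ (λ qs → v (p ∷ qs)) (λ qs → h (p ∷ qs)) ps)))
      (solve 4 (λ x g y z → x :* (g :* z) :- y :* z := (x :* g :- y) :* z) refl _ _ _ _)

-- The commutative ring of Laurent series in u⁻¹.

module LaurentRing {c ℓ} (R : CommutativeRing c ℓ) where
  open CommutativeRing R hiding (zero)
  open RingTools R
  open LaurentSeries R
  open Relation.Binary.Reasoning.Setoid setoid

  -- The field `top` is not canonical, as leading coefficients may be zero; hence equality compares
  -- coefficients at each power of u.
  infix 4 _≋_
  record _≋_ (f g : Laurent) : Set ℓ where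
    constructor coeffwise
    field coeff-≈ : ∀ n → coeff f n ≈ coeff g n
  open _≋_ public

  at-neg : ∀ a {i} → i ℤ.< 0ℤ → at a i ≈ 0#
  at-neg a {+ _} (ℤ.+<+ ())
  at-neg a { -[1+ n ]} _ = refl

  at-cong : ∀ {a b} → (∀ i → a i ≈ b i) → ∀ n → at a n ≈ at b n
  at-cong eq (+ n)    = eq n
  at-cong eq -[1+ n ] = refl

  same-top : ∀ {d a b} → (∀ i → a i ≈ b i) → (d ▷ a) ≋ (d ▷ b)
  same-top {d} eq = coeffwise λ n → at-cong eq (d ℤ.- n)

  above-top : ∀ f n → Laurent.top f ℤ.< n → coeff f n ≈ 0#
  above-top (d ▷ a) n d<n = at-neg a (ℤ-identities.<0-sub d<n)

  series : ℤ → (ℤ → Carrier) → Laurent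
  series d h = d ▷ λ i → h (d ℤ.- + i)

  coeff-series : ∀ d h → (∀ n → d ℤ.< n → h n ≈ 0#) → ∀ n → coeff (series d h) n ≈ h n
  coeff-series d h v n with d ℤ.- n in eq
  ... | + i      = reflexive-cong h (≡.trans (≡.cong (λ x → d ℤ.- x) (≡.sym eq)) (ℤ-identities.d-[d-n]≡n d n))
  ... | -[1+ i ] = sym (v n (ℤₚ.≰⇒> λ n≤d → contradiction (ℤₚ.i≤j⇒0≤j-i n≤d)
                         (λ p → ℤₚ.<⇒≱ (ℤ-identities.neg⇒<0 eq) p)))

  coeff-⊞ : ∀ f g n → coeff (f ⊞ g) n ≈ coeff f n + coeff g n
  coeff-⊞ f g = coeff-series (Laurent.top f ℤ.⊔ Laurent.top g) (λ n → coeff f n + coeff g n) λ n lt →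
    trans (+-cong (above-top f n (ℤₚ.≤-<-trans (ℤₚ.i≤i⊔j _ _) lt)) (above-top g n (ℤₚ.≤-<-trans (ℤₚ.i≤j⊔i _ _) lt)))
          (+-identityˡ 0#)

  coeff-⊟ : ∀ f n → coeff (⊟ f) n ≈ - coeff f n
  coeff-⊟ (d ▷ a) n with d ℤ.- n
  ... | + i      = refl
  ... | -[1+ i ] = sym -0#≈0#

  coeff-∂ : ∀ f n → coeff (∂ f) n ≈ fromℤ (ℤ.suc n) * coeff f (ℤ.suc n)
  coeff-∂ (d ▷ a) n = begin
    at b (ℤ.pred d ℤ.- n)                     ≈⟨ reflexive-cong (at b) (e₁ d n) ⟩
    at b (d ℤ.- ℤ.suc n)                      ≈⟨ go (d ℤ.- ℤ.suc n) (≡.sym (ℤ-identities.d-[d-n]≡n d (ℤ.suc n))) ⟩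
    fromℤ (ℤ.suc n) * at a (d ℤ.- ℤ.suc n)    ∎
    where
    b : ℕ → Carrier
    b i = fromℤ (d ℤ.- + i) * a i
    e₁ : ∀ d n → ℤ.pred d ℤ.- n ≡ d ℤ.- ℤ.suc n
    e₁ = S.solve 2 (λ d n → S.con -1ℤ S.:+ d S.:- n S.:= d S.:- (S.con 1ℤ S.:+ n)) ≡.refl
      where module S = Data.Integer.Solver.+-*-Solver
    go : ∀ i → ℤ.suc n ≡ d ℤ.- i → at b i ≈ fromℤ (ℤ.suc n) * at a i
    go (+ i)    e = *-congʳ (reflexive-cong fromℤ (≡.sym e))
    go -[1+ i ] e = sym (zeroʳ _)

  private
    conv : (ℕ → Carrier) → (ℕ → Carrier) → ℕ → Carrier
    conv a b n = ∑[ i < suc n ] (a (toℕ i) * b (n ∸ toℕ i))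

    at-conv : ∀ a b N → Sumℤ (λ j → at a j * at b (N ℤ.- j)) (at (conv a b) N)
    at-conv a b (+ n) = Σℤ.from-ℕ (λ _ → zeroˡ _) (Σℕ.respʳ (∑-cong-< (suc n) inside) (Σℕ.finite (suc n) outside))
      where
      inside : ∀ i → i ℕ.< suc n → a i * at b (+ n ℤ.- + i) ≈ a i * b (n ∸ i)
      inside i (s≤s i≤n) = *-congˡ (reflexive-cong (at b) (ℤ-identities.pos-sub i≤n))
      outside : ∀ i → suc n ℕ.≤ i → a i * at b (+ n ℤ.- + i) ≈ 0#
      outside i n<i = trans (*-congˡ (at-neg b (ℤ-identities.<0-sub (ℤ.+<+ n<i)))) (zeroʳ _)
    at-conv a b -[1+ n ] = Σℤ.zero-sum vanish
      where
      vanish : ∀ j → at a j * at b (-[1+ n ] ℤ.- j) ≈ 0#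
      vanish (+ j)    = trans (*-congˡ (at-neg b (ℤ-identities.<0-sub { -[1+ n ]} {+ j} ℤ.-<+))) (zeroʳ _)
      vanish -[1+ j ] = zeroˡ _

  -- As a sum over all integers the convolution no longer refers to the tops of `f` and `g`.
  -- Commutativity then becomes a reflection of the index, and congruence and distributivity are
  -- termwise.
  coeff-✶ : ∀ f g n → Sumℤ (λ i → coeff f i * coeff g (n ℤ.- i)) (coeff (f ✶ g) n)
  coeff-✶ (d ▷ a) (e ▷ b) n = Σℤ.respˡ
    (λ i → *-congˡ (reflexive-cong (at b)
       (≡.trans (≡.sym (ℤ-identities.e-[n-[d-j]]≡d+e-n-j d e n (d ℤ.- i))) (≡.cong (λ x → e ℤ.- (n ℤ.- x)) (ℤ-identities.d-[d-n]≡n d i)))))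
    (Σℤ.reflect {f = λ j → at a j * at b (d ℤ.+ e ℤ.- n ℤ.- j)} d (at-conv a b (d ℤ.+ e ℤ.- n)))

  ≋-refl : ∀ {f} → f ≋ f
  ≋-refl = coeffwise λ _ → refl

  ≋-sym : ∀ {f g} → f ≋ g → g ≋ f
  ≋-sym p = coeffwise λ n → sym (coeff-≈ p n)

  ≋-trans : ∀ {f g h} → f ≋ g → g ≋ h → f ≋ h
  ≋-trans p q = coeffwise λ n → trans (coeff-≈ p n) (coeff-≈ q n)

  ✶-cong : ∀ {f f′ g g′} → f ≋ f′ → g ≋ g′ → f ✶ g ≋ f′ ✶ g′
  ✶-cong {f} {f′} {g} {g′} p q = coeffwise λ n →
    Σℤ.unique (coeff-✶ f g n) (Σℤ.respˡ (λ i → sym (*-cong (coeff-≈ p i) (coeff-≈ q (n ℤ.- i)))) (coeff-✶ f′ g′ n))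

  ✶-comm : ∀ f g → f ✶ g ≋ g ✶ f
  ✶-comm f g = coeffwise λ n → Σℤ.unique (coeff-✶ f g n)
    (Σℤ.respˡ (λ i → trans (*-comm _ _) (*-congʳ (reflexive-cong (coeff f) (ℤ-identities.d-[d-n]≡n n i))))
      (Σℤ.reflect n (coeff-✶ g f n)))

  ⊞-cong : ∀ {f f′ g g′} → f ≋ f′ → g ≋ g′ → f ⊞ g ≋ f′ ⊞ g′
  ⊞-cong {f} {f′} {g} {g′} p q = coeffwise λ n →
    trans (coeff-⊞ f g n) (trans (+-cong (coeff-≈ p n) (coeff-≈ q n)) (sym (coeff-⊞ f′ g′ n)))

  ✶-distribˡ : ∀ f g h → f ✶ (g ⊞ h) ≋ (f ✶ g) ⊞ (f ✶ h)
  ✶-distribˡ f g h = coeffwise λ n → Σℤ.unique (coeff-✶ f (g ⊞ h) n)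
    (Σℤ.respʳ (sym (coeff-⊞ (f ✶ g) (f ✶ h) n))
      (Σℤ.respˡ (λ i → trans (sym (distribˡ _ _ _)) (*-congˡ (sym (coeff-⊞ g h (n ℤ.- i)))))
        (Σℤ.plus (coeff-✶ f g n) (coeff-✶ f h n))))

  private
    conv-linear : ∀ x a b d n → conv (λ i → x * a i + b i) d n ≈ x * conv a d n + conv b d n
    conv-linear x a b d n = begin
      ∑[ i < suc n ] ((x * a (toℕ i) + b (toℕ i)) * d (n ∸ toℕ i))
        ≈⟨ ∑-cong (suc n) (λ i → solve 4 (λ x a b d → (x :* a :+ b) :* d := x :* (a :* d) :+ b :* d) refl x (a i) (b i) (d (n ∸ i))) ⟩
      ∑[ i < suc n ] (x * (a (toℕ i) * d (n ∸ toℕ i)) + b (toℕ i) * d (n ∸ toℕ i))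
        ≈⟨ ∑-+ (suc n) (λ i → x * (a i * d (n ∸ i))) (λ i → b i * d (n ∸ i)) ⟩
      ∑[ i < suc n ] (x * (a (toℕ i) * d (n ∸ toℕ i))) + conv b d n
        ≈⟨ +-congʳ (∑-* (suc n) x (λ i → a i * d (n ∸ i))) ⟨
      x * conv a d n + conv b d n ∎

    -- Peels off `a 0`: the tail of `conv a b` is a 0 · (b ∘ suc) + conv (a ∘ suc) b, so linearity
    -- reduces the claim to `a ∘ suc` and `n`.
    conv-assoc : ∀ a b d n → conv (conv a b) d n ≈ conv a (conv b d) n
    conv-assoc a b d zero = solve 3 (λ a b d → (a :* b :+ con 0ℤ) :* d :+ con 0ℤ := a :* (b :* d :+ con 0ℤ) :+ con 0ℤ) refl (a 0) (b 0) (d 0)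
    conv-assoc a b d (suc n) = begin
      (a 0 * b 0 + 0#) * d (suc n) + conv (λ i → a 0 * b (suc i) + conv (a ∘ suc) b i) d n
        ≈⟨ +-congˡ (conv-linear (a 0) (b ∘ suc) (conv (a ∘ suc) b) d n) ⟩
      (a 0 * b 0 + 0#) * d (suc n) + (a 0 * conv (b ∘ suc) d n + conv (conv (a ∘ suc) b) d n)
        ≈⟨ +-congˡ (+-congˡ (conv-assoc (a ∘ suc) b d n)) ⟩
      (a 0 * b 0 + 0#) * d (suc n) + (a 0 * conv (b ∘ suc) d n + conv (a ∘ suc) (conv b d) n)
        ≈⟨ solve 5 (λ a b d x y → (a :* b :+ con 0ℤ) :* d :+ (a :* x :+ y) := a :* (b :* d :+ x) :+ y) refl (a 0) (b 0) (d (suc n)) _ _ ⟩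
      a 0 * (b 0 * d (suc n) + conv (b ∘ suc) d n) + conv (a ∘ suc) (conv b d) n ∎

  retop : ∀ {d e a} → d ≡ e → (d ▷ a) ≋ (e ▷ a)
  retop ≡.refl = ≋-refl

  ✶-assoc : ∀ f g h → (f ✶ g) ✶ h ≋ f ✶ (g ✶ h)
  ✶-assoc (d ▷ a) (e ▷ b) (t ▷ p) = ≋-trans (retop (ℤₚ.+-assoc d e t)) (same-top (conv-assoc a b p))

  coeff-const : ∀ x n → n ≢ 0ℤ → coeff (const x) n ≈ 0#
  coeff-const x (+ zero)  n≢0 = contradiction ≡.refl n≢0
  coeff-const x (+ suc n) n≢0 = refl
  coeff-const x -[1+ n ]  n≢0 = refl

  coeff-const✶ : ∀ x f n → coeff (const x ✶ f) n ≈ x * coeff f n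
  coeff-const✶ x f n = Σℤ.unique (coeff-✶ (const x) f n)
    (Σℤ.respʳ (*-congˡ (reflexive-cong (coeff f) (ℤₚ.+-identityʳ n)))
      (Σℤ.single 0ℤ (λ k k≢0 → trans (*-congʳ (coeff-const x k k≢0)) (zeroˡ _))))

  coeff-u^ : ∀ d n → n ≢ d → coeff (u^ d) n ≈ 0#
  coeff-u^ d n n≢d with d ℤ.- n in eq
  ... | + zero   = contradiction (≡.sym (ℤₚ.i-j≡0⇒i≡j d n eq)) n≢d
  ... | + suc _  = refl
  ... | -[1+ _ ] = refl

  coeff-u^-top : ∀ d → coeff (u^ d) d ≈ 1#
  coeff-u^-top d = reflexive-cong (at (Laurent.coeffs (u^ d))) (ℤₚ.+-inverseʳ d)

  coeff-u^✶ : ∀ d f n → coeff (u^ d ✶ f) n ≈ coeff f (n ℤ.- d)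
  coeff-u^✶ d f n = Σℤ.unique (coeff-✶ (u^ d) f n)
    (Σℤ.respʳ (trans (*-congʳ (coeff-u^-top d)) (*-identityˡ _))
      (Σℤ.single d (λ k k≢d → trans (*-congʳ (coeff-u^ d k k≢d)) (zeroˡ _))))

  coeff-✶u^ : ∀ d f n → coeff (f ✶ u^ d) n ≈ coeff f (n ℤ.- d)
  coeff-✶u^ d f n = trans (coeff-≈ (✶-comm f (u^ d)) n) (coeff-u^✶ d f n)

  coeff-✶const : ∀ x f n → coeff (f ✶ const x) n ≈ coeff f n * x
  coeff-✶const x f n = trans (coeff-≈ (✶-comm f (const x)) n) (trans (coeff-const✶ x f n) (*-comm _ _))

  private
    coeff-0 : ∀ n → coeff (const 0#) n ≈ 0#
    coeff-0 (+ zero)  = refl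
    coeff-0 (+ suc n) = refl
    coeff-0 -[1+ n ]  = refl

  ✶-identityˡ : ∀ f → const 1# ✶ f ≋ f
  ✶-identityˡ f = coeffwise λ n → trans (coeff-const✶ 1# f n) (*-identityˡ _)

  laurentRing : CommutativeRing c ℓ
  laurentRing = record
    { Carrier = Laurent ; _≈_ = _≋_
    ; _+_ = _⊞_ ; _*_ = _✶_ ; -_ = ⊟_ ; 0# = const 0# ; 1# = const 1#
    ; isCommutativeRing = record
      { isRing = record
        { +-isAbelianGroup = record
          { isGroup = record
            { isMonoid = record
              { isSemigroup = record
                { isMagma = record
                  { isEquivalence = record { refl = ≋-refl ; sym = ≋-sym ; trans = ≋-trans }
                  ; ∙-cong = ⊞-cong }
                ; assoc = λ f g h → coeffwise λ n → trans (coeff-⊞ (f ⊞ g) h n) (trans (+-congʳ (coeff-⊞ f g n))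
                    (trans (+-assoc _ _ _) (sym (trans (coeff-⊞ f (g ⊞ h) n) (+-congˡ (coeff-⊞ g h n)))))) }
              ; identity = zeroˡ′ , λ f → ≋-trans (⊞-comm f (const 0#)) (zeroˡ′ f) }
            ; inverse = inverseˡ′ , λ f → ≋-trans (⊞-comm f (⊟ f)) (inverseˡ′ f)
            ; ⁻¹-cong = λ {f} {g} p → coeffwise λ n → trans (coeff-⊟ f n) (trans (-‿cong (coeff-≈ p n)) (sym (coeff-⊟ g n))) }
          ; comm = ⊞-comm }
        ; *-cong = ✶-cong
        ; *-assoc = ✶-assoc
        ; *-identity = ✶-identityˡ , λ f → ≋-trans (✶-comm f (const 1#)) (✶-identityˡ f)
        ; distrib = ✶-distribˡ , λ f g h →
            ≋-trans (✶-comm (g ⊞ h) f) (≋-trans (✶-distribˡ f g h) (⊞-cong (✶-comm f g) (✶-comm f h))) }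
      ; *-comm = ✶-comm } }
    where
    ⊞-comm : ∀ f g → f ⊞ g ≋ g ⊞ f
    ⊞-comm f g = coeffwise λ n → trans (coeff-⊞ f g n) (trans (+-comm _ _) (sym (coeff-⊞ g f n)))
    zeroˡ′ : ∀ f → const 0# ⊞ f ≋ f
    zeroˡ′ f = coeffwise λ n → trans (coeff-⊞ (const 0#) f n) (trans (+-congʳ (coeff-0 n)) (+-identityˡ _))
    inverseˡ′ : ∀ f → ⊟ f ⊞ f ≋ const 0#
    inverseˡ′ f = coeffwise λ n →
      trans (coeff-⊞ (⊟ f) f n) (trans (+-congʳ (coeff-⊟ f n)) (trans (-‿inverseˡ _) (sym (coeff-0 n))))

  const-+ : ∀ x y → const (x + y) ≋ const x ⊞ const y
  const-+ x y = same-top λ { zero → refl ; (suc i) → sym (+-identityˡ 0#) }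

  const-* : ∀ x y → const (x * y) ≋ const x ✶ const y
  const-* x y = coeffwise λ n → sym (trans (coeff-const✶ x (const y) n) (go n))
    where
    go : ∀ n → x * coeff (const y) n ≈ coeff (const (x * y)) n
    go (+ zero)  = refl
    go (+ suc n) = zeroʳ x
    go -[1+ n ]  = zeroʳ x

  const-cong : ∀ {x y} → x ≈ y → const x ≋ const y
  const-cong eq = same-top λ { zero → eq ; (suc i) → refl }

  const-neg : ∀ x → const (- x) ≋ ⊟ const x
  const-neg x = same-top λ { zero → refl ; (suc i) → sym -0#≈0# }

  LSum : (ℤ → Laurent) → Laurent → Set ℓ
  LSum f S = ∀ n → Sumℤ (λ k → coeff (f k) n) (coeff S n)

  LSum-respˡ : ∀ {f g S} → (∀ k → f k ≋ g k) → LSum f S → LSum g S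
  LSum-respˡ eq p n = Σℤ.respˡ (λ k → coeff-≈ (eq k) n) (p n)

  LSum-respʳ : ∀ {f S T} → S ≋ T → LSum f S → LSum f T
  LSum-respʳ eq p n = Σℤ.respʳ (coeff-≈ eq n) (p n)

  BoundedBy : ℤ → (ℤ → Laurent) → Set ℓ
  BoundedBy T f = ∀ k n → T ℤ.< n → coeff (f k) n ≈ 0#

  -- The common bound `T` leaves only the first `M` coefficients of `g` in the coefficient of u^n,
  -- with `M` the same for all `k`; so a finite sum is interchanged with the sum over `k`.
  LSum-✶ : ∀ {f S} g T → BoundedBy T f → LSum f S → LSum (λ k → g ✶ f k) (g ✶ S)
  LSum-✶ {f} {S} (d ▷ a) T bounded p n = Σℤ.respʳ (sym (formula S S-bounded))
    (Σℤ.respˡ (λ k → sym (formula (f k) (bounded k)))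
      (Σℤ.finite-sum M (λ j → Σℤ.scale (a j) (p (n ℤ.- (d ℤ.- + j))))))
    where
    -- The coefficient of u^(d-j) in `g` meets the power n-(d-j) of the other factor, which exceeds
    -- `T` once j > T+d-n.
    M = suc ℤ.∣ T ℤ.+ d ℤ.- n ∣
    S-bounded : ∀ n → T ℤ.< n → coeff S n ≈ 0#
    S-bounded n lt = Σℤ.unique (p n) (Σℤ.zero-sum (λ k → bounded k n lt))
    eq : ∀ T d n j → T ℤ.- (n ℤ.- (d ℤ.- j)) ≡ T ℤ.+ d ℤ.- n ℤ.- j
    eq = S′.solve 4 (λ T d n j → T S′.:- (n S′.:- (d S′.:- j)) S′.:= T S′.:+ d S′.:- n S′.:- j) ≡.refl
      where module S′ = Data.Integer.Solver.+-*-Solver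
    far : ∀ j → M ℕ.≤ j → T ℤ.< n ℤ.- (d ℤ.- + j)
    far j le = ℤₚ.≰⇒> λ ge → ℤₚ.<⇒≱ below (≡.subst (0ℤ ℤ.≤_) (eq T d n (+ j)) (ℤₚ.i≤j⇒0≤j-i ge))
      where
      below : T ℤ.+ d ℤ.- n ℤ.- + j ℤ.< 0ℤ
      below = ℤ-identities.<0-sub {T ℤ.+ d ℤ.- n} (ℤₚ.≤-<-trans (ℤ-identities.i≤∣i∣ _) (ℤ.+<+ le))
    formula : ∀ h → (∀ n → T ℤ.< n → coeff h n ≈ 0#) →
              coeff ((d ▷ a) ✶ h) n ≈ ∑[ j < M ] (a (toℕ j) * coeff h (n ℤ.- (d ℤ.- + toℕ j)))
    formula h v = Σℕ.value M (λ j le → trans (*-congˡ (v _ (far j le))) (zeroʳ _))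
      (Σℤ.to-ℕ (λ _ → zeroˡ _)
        (Σℤ.respˡ (λ j → *-congʳ (reflexive-cong (at a) (ℤ-identities.d-[d-n]≡n d j)))
          (Σℤ.reflect d (coeff-✶ (d ▷ a) h n))))

-- The automorphism φ, the elements h⟨r⟩ and the determinants s.

module ShiftedSchur {c ℓ} (K : CommutativeRing c ℓ) where
  open ShiftedSymmetric K
  private module K = CommutativeRing K
  open CommutativeRing B-ring hiding (zero)
  open RingTools B-ring hiding (con)
  open BTerm using (con; var; substitute)
  open Forms B-ring ℤ public
  open Relation.Binary.Reasoning.Setoid setoid

  φ-cong : ∀ {a b} → a ≈ b → φ a ≈ φ b
  φ-cong = substitute-cong _

  φ⁻¹-cong : ∀ {a b} → a ≈ b → φ⁻¹ a ≈ φ⁻¹ b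
  φ⁻¹-cong = substitute-cong _

  φ^-cong : ∀ n {a b} → a ≈ b → φ^ n a ≈ φ^ n b
  φ^-cong (+ n) p = go n
    where
    go : ∀ n → φ^ (+ n) _ ≈ φ^ (+ n) _
    go zero    = p
    go (suc n) = φ-cong (go n)
  φ^-cong -[1+ n ] p = go n
    where
    go : ∀ n → φ^ -[1+ n ] _ ≈ φ^ -[1+ n ] _
    go zero    = φ⁻¹-cong p
    go (suc n) = φ⁻¹-cong (go n)

  -- This and the next laws hold as identities of terms, because substitution is structural.
  φ^-* : ∀ n a b → φ^ n (a * b) ≡ φ^ n a * φ^ n b
  φ^-* (+ zero)     a b = ≡.refl
  φ^-* (+ suc n)    a b = ≡.cong φ (φ^-* (+ n) a b)
  φ^-* -[1+ zero ]  a b = ≡.refl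
  φ^-* -[1+ suc n ] a b = ≡.cong φ⁻¹ (φ^-* -[1+ n ] a b)

  φ^-+ : ∀ n a b → φ^ n (a + b) ≡ φ^ n a + φ^ n b
  φ^-+ (+ zero)     a b = ≡.refl
  φ^-+ (+ suc n)    a b = ≡.cong φ (φ^-+ (+ n) a b)
  φ^-+ -[1+ zero ]  a b = ≡.refl
  φ^-+ -[1+ suc n ] a b = ≡.cong φ⁻¹ (φ^-+ -[1+ n ] a b)

  φ^-neg : ∀ n a → φ^ n (- a) ≡ - φ^ n a
  φ^-neg (+ zero)     a = ≡.refl
  φ^-neg (+ suc n)    a = ≡.cong φ (φ^-neg (+ n) a)
  φ^-neg -[1+ zero ]  a = ≡.refl
  φ^-neg -[1+ suc n ] a = ≡.cong φ⁻¹ (φ^-neg -[1+ n ] a)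

  φ^-con : ∀ n a → φ^ n (con a) ≡ con a
  φ^-con (+ zero)     a = ≡.refl
  φ^-con (+ suc n)    a = ≡.cong φ (φ^-con (+ n) a)
  φ^-con -[1+ zero ]  a = ≡.refl
  φ^-con -[1+ suc n ] a = ≡.cong φ⁻¹ (φ^-con -[1+ n ] a)

  φ^-fromℕ : ∀ n k → φ^ n (fromℕ k) ≡ fromℕ k
  φ^-fromℕ n zero    = φ^-con n K.0#
  φ^-fromℕ n (suc k) = ≡.trans (φ^-+ n 1# (fromℕ k)) (≡.cong₂ _+_ (φ^-con n K.1#) (φ^-fromℕ n k))

  φ^-fromℤ : ∀ n k → φ^ n (fromℤ k) ≡ fromℤ k
  φ^-fromℤ n (+ k)    = φ^-fromℕ n k
  φ^-fromℤ n -[1+ k ] = ≡.trans (φ^-neg n (fromℕ (suc k))) (≡.cong (λ x → - x) (φ^-fromℕ n (suc k)))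

  φ^-scale : ∀ n k a → φ^ n (fromℤ k * a) ≈ fromℤ k * φ^ n a
  φ^-scale n k a = trans (reflexive (φ^-* n (fromℤ k) a)) (*-congʳ (reflexive (φ^-fromℤ n k)))

  φ^-suc : ∀ n a → φ^ (ℤ.suc n) a ≈ φ (φ^ n a)
  φ^-suc (+ n)        a = refl
  φ^-suc -[1+ zero ]  a = sym (φ∘φ⁻¹ a)
  φ^-suc -[1+ suc n ] a = sym (φ∘φ⁻¹ _)

  φ^-pred : ∀ n a → φ^ (ℤ.pred n) a ≈ φ⁻¹ (φ^ n a)
  φ^-pred (+ zero)  a = refl
  φ^-pred (+ suc n) a = sym (φ⁻¹∘φ _)
  φ^-pred -[1+ n ]  a = refl

  φ^-∘ : ∀ m n a → φ^ (m ℤ.+ n) a ≈ φ^ m (φ^ n a)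
  φ^-∘ (+ zero)  n a = reflexive-cong (λ k → φ^ k a) (ℤₚ.+-identityˡ n)
  φ^-∘ (+ suc m) n a = begin
    φ^ (+ suc m ℤ.+ n) a        ≈⟨ reflexive-cong (λ k → φ^ k a) (ℤₚ.+-assoc 1ℤ (+ m) n) ⟩
    φ^ (ℤ.suc (+ m ℤ.+ n)) a    ≈⟨ φ^-suc (+ m ℤ.+ n) a ⟩
    φ (φ^ (+ m ℤ.+ n) a)        ≈⟨ φ-cong (φ^-∘ (+ m) n a) ⟩
    φ (φ^ (+ m) (φ^ n a))       ∎
  φ^-∘ -[1+ zero ] n a = φ^-pred n a
  φ^-∘ -[1+ suc m ] n a = begin
    φ^ (-[1+ suc m ] ℤ.+ n) a        ≈⟨ reflexive-cong (λ k → φ^ k a) (ℤₚ.+-assoc -1ℤ -[1+ m ] n) ⟩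
    φ^ (ℤ.pred (-[1+ m ] ℤ.+ n)) a   ≈⟨ φ^-pred (-[1+ m ] ℤ.+ n) a ⟩
    φ⁻¹ (φ^ (-[1+ m ] ℤ.+ n) a)      ≈⟨ φ⁻¹-cong (φ^-∘ -[1+ m ] n a) ⟩
    φ⁻¹ (φ^ -[1+ m ] (φ^ n a))       ∎

  φ^-φ : ∀ n a → φ^ (n ℤ.+ 1ℤ) a ≈ φ^ n (φ a)
  φ^-φ n a = φ^-∘ n 1ℤ a

  h*-neg : ∀ {k} → k ℤ.< 0ℤ → h* k ≡ 0#
  h*-neg {+ _}      (ℤ.+<+ ())
  h*-neg { -[1+ _ ]} _ = ≡.refl

  -- The rule defining φ on the generators extends to k ≤ 0, since h* vanishes at negative indices
  -- and h*_0 = 1 is fixed.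
  φ-h* : ∀ k → φ (h* k) ≈ h* k + fromℤ (k ℤ.- 1ℤ) * h* (k ℤ.- 1ℤ)
  φ-h* (+ zero)  = solve 1 (λ x → x := x :+ (:- (x :+ con′ 0ℤ)) :* con′ 0ℤ) refl 1#
    where open RingTools B-ring using () renaming (con to con′)
  φ-h* (+ suc n) = refl
  φ-h* -[1+ n ]  = trans (sym (+-identityˡ _)) (+-congˡ (sym (zeroʳ _)))

  -- Write φ^(r+1) = φ^r φ and apply the rule for φ to h* at k+r+1; the integer factor k+r is fixed
  -- by φ^r.
  h-rec : ∀ r k → h⟨ ℤ.suc r ⟩ k ≈ h⟨ r ⟩ (ℤ.suc k) + fromℤ (k ℤ.+ r) * h⟨ r ⟩ k
  h-rec r k = begin
    φ^ (ℤ.suc r) (h* j)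
      ≈⟨ reflexive-cong (λ n → φ^ n (h* j)) (ℤₚ.+-comm 1ℤ r) ⟩
    φ^ (r ℤ.+ 1ℤ) (h* j)
      ≈⟨ φ^-φ r (h* j) ⟩
    φ^ r (φ (h* j))
      ≈⟨ φ^-cong r (φ-h* j) ⟩
    φ^ r (h* j + fromℤ (j ℤ.- 1ℤ) * h* (j ℤ.- 1ℤ))
      ≈⟨ trans (reflexive (φ^-+ r _ _)) (+-congˡ (φ^-scale r (j ℤ.- 1ℤ) _)) ⟩
    φ^ r (h* j) + fromℤ (j ℤ.- 1ℤ) * φ^ r (h* (j ℤ.- 1ℤ))
      ≈⟨ +-cong (reflexive-cong (λ i → φ^ r (h* i)) (ℤ-identities.k+[1+r]≡1+k+r k r))
           (reflexive-cong (λ i → fromℤ i * φ^ r (h* i)) (ℤ-identities.k+[1+r]-1≡k+r k r)) ⟩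
    h⟨ r ⟩ (ℤ.suc k) + fromℤ (k ℤ.+ r) * h⟨ r ⟩ k ∎
    where j = k ℤ.+ ℤ.suc r

  h-vanish : ∀ r k → k ℤ.+ r ℤ.< 0ℤ → h⟨ r ⟩ k ≈ 0#
  h-vanish r k lt = reflexive (≡.trans (≡.cong (φ^ r) (h*-neg lt)) (φ^-con r K.0#))

  h-one : ∀ r k → k ℤ.+ r ≡ 0ℤ → h⟨ r ⟩ k ≈ 1#
  h-one r k eq = reflexive (≡.trans (≡.cong (φ^ r ∘ h*) eq) (φ^-con r K.1#))

  -- The index k+r of the underlying h* is unchanged. So φ acts on a minor by lowering every row
  -- label and raising every column by one.
  φ-h : ∀ r k → φ (h⟨ r ⟩ k) ≈ h⟨ ℤ.suc r ⟩ (ℤ.pred k)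
  φ-h r k = trans (φ-cong (reflexive-cong (λ i → φ^ r (h* i)) (ℤ-identities.k+j≡-1+k+[1+j] r k))) (sym (φ^-suc r _))

  row : ℤ → Row
  row a j = h⟨ j ⟩ a

  -- λ_i - i + 1 for the successive entries of a vector whose first entry has index o + 1.
  labels : ℕ → List ℤ → List ℤ
  labels o []      = []
  labels o (a ∷ α) = (a ℤ.- + o) ∷ labels (suc o) α

  columns : ℕ → ℕ → List ℤ
  columns o zero    = []
  columns o (suc n) = + o ∷ columns (suc o) n

  rows : ℕ → List ℤ → List Row
  rows o α = map row (labels o α)

  tabulate-cong : ∀ {a} {A : Set a} {n} {f g : Fin n → A} → (∀ i → f i ≡ g i) → tabulate f ≡ tabulate g
  tabulate-cong {n = zero}  eq = ≡.refl
  tabulate-cong {n = suc n} eq = ≡.cong₂ _∷_ (eq zero) (tabulate-cong (eq ∘ suc))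

  tabulate-rows : ∀ o α → tabulate {n = length α} (λ i → row (part α (toℕ i) ℤ.- + (o ℕ.+ toℕ i))) ≡ rows o α
  tabulate-rows o []      = ≡.refl
  tabulate-rows o (a ∷ α) = ≡.cong₂ _∷_ (≡.cong (λ i → row (a ℤ.- + i)) (ℕₚ.+-identityʳ o))
    (≡.trans (tabulate-cong (λ i → ≡.cong (λ j → row (part α (toℕ i) ℤ.- + j)) (ℕₚ.+-suc o (toℕ i))))
             (tabulate-rows (suc o) α))

  tabulate-columns : ∀ o n → tabulate {n = n} (λ i → + (o ℕ.+ toℕ i)) ≡ columns o n
  tabulate-columns o zero    = ≡.refl
  tabulate-columns o (suc n) = ≡.cong₂ _∷_ (≡.cong +_ (ℕₚ.+-identityʳ o))
    (≡.trans (tabulate-cong (λ i → ≡.cong +_ (ℕₚ.+-suc o (toℕ i)))) (tabulate-columns (suc o) n))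

  s-minor : ∀ α → s α ≈ minor (rows 0 α) (columns 0 (length α))
  s-minor α = trans (det-minor {length α} (λ i → row (part α (toℕ i) ℤ.- + toℕ i)) (λ j → + toℕ j))
    (reflexive (≡.cong₂ minor (tabulate-rows 0 α) (tabulate-columns 0 (length α))))

  φ-∧ : ∀ {r r′ F F′} → (∀ c → φ (r c) ≈ r′ (ℤ.suc c)) → (∀ cs → φ (F cs) ≈ F′ (map ℤ.suc cs)) →
        ∀ cs → φ ((r ∧ F) cs) ≈ (r′ ∧ F′) (map ℤ.suc cs)
  φ-∧ hr hF []       = refl
  φ-∧ hr hF (c ∷ cs) = +-cong (*-cong (hr c) (hF cs)) (-‿cong (φ-∧ hr (λ ds → hF (c ∷ ds)) cs))

  φ-minor : ∀ as cs → φ (minor (map row as) cs) ≈ minor (map row (map ℤ.pred as)) (map ℤ.suc cs)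
  φ-minor []       []       = refl
  φ-minor []       (c ∷ cs) = refl
  φ-minor (a ∷ as) cs       = φ-∧ (λ j → φ-h j a) (φ-minor as) cs

  pred-labels : ∀ o α → map ℤ.pred (labels o α) ≡ labels (suc o) α
  pred-labels o []      = ≡.refl
  pred-labels o (a ∷ α) = ≡.cong₂ _∷_ (ℤ-identities.-1+[a-o]≡a-[1+o] a (+ o)) (pred-labels (suc o) α)

  suc-columns : ∀ o n → map ℤ.suc (columns o n) ≡ columns (suc o) n
  suc-columns o zero    = ≡.refl
  suc-columns o (suc n) = ≡.cong (+ suc o ∷_) (suc-columns (suc o) n)

  -- Applying φ only increases the offset from which rows and columns are numbered.
  φ^-s : ∀ i α → φ^ (+ i) (s α) ≈ minor (rows i α) (columns i (length α))
  φ^-s zero    α = s-minor α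
  φ^-s (suc i) α = trans (φ-cong (φ^-s i α)) (trans (φ-minor (labels i α) _)
    (reflexive (≡.cong₂ minor (≡.cong (map row) (pred-labels i α)) (suc-columns i (length α)))))

  minor-zero-column : ∀ {rs c} → All (λ r → r c ≈ 0#) rs → ∀ cs → minor rs (c ∷ cs) ≈ 0#
  minor-zero-column []       cs = refl
  minor-zero-column {r ∷ rs} {c} (p ∷ ps) cs = begin
    r c * minor rs cs - (r ∧ (minor rs ∘ (c ∷_))) cs
      ≈⟨ +-cong (*-congʳ p) (-‿cong (trans (∧-cong (λ _ → refl) (minor-zero-column ps) cs) (∧-zero r cs))) ⟩
    0# * minor rs cs - 0#   ≈⟨ +-cong (zeroˡ _) -0#≈0# ⟩
    0# + 0#                 ≈⟨ +-identityˡ 0# ⟩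
    0#                      ∎

  private
    ones : ℕ → List ℤ
    ones n = replicate n 1ℤ

    length-ones : ∀ n → length (ones n) ≡ n
    length-ones zero    = ≡.refl
    length-ones (suc n) = ≡.cong suc (length-ones n)

    φ^-e : ∀ i n → φ^ (+ i) (e* (+ n)) ≈ minor (rows i (ones n)) (columns i n)
    φ^-e i n = trans (φ^-s i (ones n)) (reflexive-cong (minor (rows i (ones n)) ∘ columns i) (length-ones n))

    below-diagonal : ∀ i m n → All (λ r → r (+ i) ≈ 0#) (rows (suc (suc (i ℕ.+ m))) (ones n))
    below-diagonal i m zero    = []
    below-diagonal i m (suc n) =
      h-vanish (+ i) (1ℤ ℤ.- + suc (suc (i ℕ.+ m))) (≡.subst (ℤ._< 0ℤ) (≡.sym (ℤ-identities.1-[1+[1+[i+m]]]+i≡-[1+m] (+ i) (+ m))) ℤ.-<+) ∷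
      ≡.subst (λ j → All (λ r → r (+ i) ≈ 0#) (rows (suc (suc j)) (ones n))) (ℕₚ.+-suc i m) (below-diagonal i (suc m) n)

    -- Column `i` has the entry 1 in the first of these rows and 0 in all later ones, so contraction
    -- with it deletes that row.
    contract-e : ∀ i n cs → minor (rows (suc i) (ones (suc n))) (+ i ∷ cs) ≈ minor (rows (suc (suc i)) (ones n)) cs
    contract-e i n cs = begin
      row a (+ i) * minor rs cs - (row a ∧ (minor rs ∘ (+ i ∷_))) cs
        ≈⟨ +-cong (*-congʳ (h-one (+ i) a (ℤ-identities.1-[1+i]+i≡0 (+ i))))
             (-‿cong (trans (∧-cong (λ _ → refl) (minor-zero-column vanish) cs) (∧-zero (row a) cs))) ⟩
      1# * minor rs cs - 0#   ≈⟨ +-cong (*-identityˡ _) -0#≈0# ⟩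
      minor rs cs + 0#        ≈⟨ +-identityʳ _ ⟩
      minor rs cs             ∎
      where
      a = 1ℤ ℤ.- + suc i
      rs = rows (suc (suc i)) (ones n)
      vanish = ≡.subst (λ j → All (λ r → r (+ i) ≈ 0#) (rows (suc (suc j)) (ones n))) (ℕₚ.+-identityʳ i) (below-diagonal i 0 n)

    -- Below the arbitrary top row `r` the matrix has ones on the subdiagonal and zeros beneath.
    -- Deleting the top row and the j-th column leaves a unitriangular block and the determinant of
    -- φ^(i+j+1)(e*_(n-j)). The induction keeps `r` and moves `i`.
    hessenberg : ∀ i n r → (r ∧ minor (rows (suc i) (ones n))) (columns i (suc n)) ≈
      ∑[ j < suc n ] (sgn (toℕ j) * (r (+ (i ℕ.+ toℕ j)) * φ^ (+ suc (i ℕ.+ toℕ j)) (e* (+ (n ∸ toℕ j)))))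
    hessenberg i zero r = begin
      r (+ i) * 1# - 0#
        ≈⟨ trans (+-congˡ -0#≈0#) (+-congʳ (sym (*-identityˡ _))) ⟩
      1# * (r (+ i) * 1#) + 0#
        ≈⟨ +-congʳ (*-congˡ (*-cong (reflexive-cong (r ∘ +_) (≡.sym (ℕₚ.+-identityʳ i))) (reflexive (≡.sym (φ^-con (+ suc (i ℕ.+ 0)) K.1#))))) ⟩
      1# * (r (+ (i ℕ.+ 0)) * φ^ (+ suc (i ℕ.+ 0)) (e* (+ 0))) + 0# ∎
    hessenberg i (suc n) r = begin
      r (+ i) * M (columns (suc i) (suc n)) - (r ∧ (M ∘ (+ i ∷_))) (columns (suc i) (suc n))
        ≈⟨ +-cong (*-congˡ (sym (φ^-e (suc i) (suc n)))) (-‿cong (∧-cong {r} (λ _ → refl) (contract-e i n) (columns (suc i) (suc n)))) ⟩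
      r (+ i) * φ^ (+ suc i) (e* (+ suc n)) - (r ∧ minor (rows (suc (suc i)) (ones n))) (columns (suc i) (suc n))
        ≈⟨ +-congˡ (-‿cong (hessenberg (suc i) n r)) ⟩
      r (+ i) * φ^ (+ suc i) (e* (+ suc n)) - ∑[ j < suc n ] (sgn (toℕ j) * X (suc i ℕ.+ toℕ j) (n ∸ toℕ j))
        ≈⟨ +-cong (sym (*-identityˡ _)) (sym (-1*x≈-x _)) ⟩
      1# * X i (suc n) + - 1# * ∑[ j < suc n ] (sgn (toℕ j) * X (suc i ℕ.+ toℕ j) (n ∸ toℕ j))
        ≈⟨ +-congˡ (∑-* (suc n) (- 1#) (λ j → sgn j * X (suc i ℕ.+ j) (n ∸ j))) ⟩
      1# * X i (suc n) + ∑[ j < suc n ] (- 1# * (sgn (toℕ j) * X (suc i ℕ.+ toℕ j) (n ∸ toℕ j)))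
        ≈⟨ +-cong (*-congˡ (reflexive-cong (λ k → X k (suc n)) (≡.sym (ℕₚ.+-identityʳ i))))
             (∑-cong (suc n) (λ j → trans (sym (*-assoc (- 1#) (sgn j) _)) (*-congˡ (reflexive-cong (λ k → X k (n ∸ j)) (≡.sym (ℕₚ.+-suc i j)))))) ⟩
      1# * X (i ℕ.+ 0) (suc n) + ∑[ j < suc n ] (sgn (suc (toℕ j)) * X (i ℕ.+ suc (toℕ j)) (n ∸ toℕ j)) ∎
      where
      M = minor (rows (suc i) (ones (suc n)))
      X : ℕ → ℕ → B
      X j k = r (+ j) * φ^ (+ suc j) (e* (+ k))

  e-expand : ∀ n → e* (+ suc n) ≈ ∑[ j < suc n ] (sgn (toℕ j) * (h⟨ + toℕ j ⟩ 1ℤ * φ^ (+ suc (toℕ j)) (e* (+ (n ∸ toℕ j)))))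
  e-expand n = trans (φ^-e 0 (suc n)) (hessenberg 0 n (row 1ℤ))

-- Duality between the h* and the ε, and the recurrence for φ⁻¹(ε).

module Duality {c ℓ} (K : CommutativeRing c ℓ) where
  open ShiftedSymmetric K
  private module K = CommutativeRing K
  open CommutativeRing B-ring hiding (zero)
  open RingTools B-ring
  open ShiftedSchur K
  open Relation.Binary.Reasoning.Setoid setoid

  Sum-φ^ : ∀ n {f S} → Sumℤ f S → Sumℤ (λ k → φ^ n (f k)) (φ^ n S)
  Sum-φ^ n = SumMap.mapℤ B-ring B-ring (φ^-cong n) (reflexive (φ^-con n K.0#)) (λ x y → reflexive (φ^-+ n x y))

  δ-refl : ∀ i j → i ≡ j → δ i j ≡ 1#
  δ-refl i j eq with i ℤₚ.≟ j
  ... | yes _  = ≡.refl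
  ... | no neq = contradiction eq neq

  δ-off : ∀ i j → i ≢ j → δ i j ≡ 0#
  δ-off i j neq with i ℤₚ.≟ j
  ... | yes eq = contradiction eq neq
  ... | no _   = ≡.refl

  φ^-δ : ∀ n i j → φ^ n (δ i j) ≈ δ i j
  φ^-δ n i j with i ℤₚ.≟ j
  ... | yes _ = reflexive (φ^-con n K.1#)
  ... | no _  = reflexive (φ^-con n K.0#)

  φ^-sgn : ∀ n k → φ^ n (sgn k) ≡ sgn k
  φ^-sgn n zero    = φ^-con n K.1#
  φ^-sgn n (suc k) = ≡.trans (φ^-* n (- 1#) (sgn k))
    (≡.cong₂ _*_ (≡.trans (φ^-neg n 1#) (≡.cong (λ x → - x) (φ^-con n K.1#))) (φ^-sgn n k))

  ε : ℤ → B
  ε (+ r)    = sgn r * e* (+ r)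
  ε -[1+ _ ] = 0#

  ε-neg : ∀ {r} → r ℤ.< 0ℤ → ε r ≡ 0#
  ε-neg {+ _}      (ℤ.+<+ ())
  ε-neg { -[1+ _ ]} _ = ≡.refl

  private
    g : ℤ → B
    g r = φ (ε r)

    g-neg : ∀ {r} → r ℤ.< 0ℤ → g r ≡ 0#
    g-neg lt = ≡.cong φ (ε-neg lt)

    -- This is `e-expand` times the sign of n+1; the signs are distributed by sgn j · sgn (n-j) =
    -- sgn n.
    ε-expand : ∀ n → ε (+ suc n) + ∑[ j < suc n ] (φ^ (+ toℕ j) (h* (+ suc (toℕ j))) * φ^ (+ suc (toℕ j)) (ε (+ (n ∸ toℕ j)))) ≈ 0#
    ε-expand n = begin
      sgn (suc n) * e* (+ suc n) + ∑[ j < suc n ] Y (toℕ j)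
        ≈⟨ +-congʳ (trans (*-congˡ (e-expand n)) (∑-* (suc n) (sgn (suc n)) X)) ⟩
      ∑[ j < suc n ] (sgn (suc n) * X (toℕ j)) + ∑[ j < suc n ] Y (toℕ j)
        ≈⟨ ∑-+ (suc n) (λ j → sgn (suc n) * X j) Y ⟨
      ∑[ j < suc n ] (sgn (suc n) * X (toℕ j) + Y (toℕ j))
        ≈⟨ ∑-cong-< (suc n) {λ j → sgn (suc n) * X j + Y j} {λ _ → 0#} (λ { j (s≤s j≤n) → cancel j j≤n }) ⟩
      ∑[ j < suc n ] 0#
        ≈⟨ ∑-zero (suc n) {λ _ → 0#} (λ _ → refl) ⟩
      0# ∎
      where
      H E′ X Y : ℕ → B
      H j = φ^ (+ j) (h* (+ suc j))
      E′ j = φ^ (+ suc j) (e* (+ (n ∸ j)))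
      X j = sgn j * (h⟨ + j ⟩ 1ℤ * E′ j)
      Y j = H j * φ^ (+ suc j) (ε (+ (n ∸ j)))
      sgn-split : ∀ j → j ℕ.≤ n → sgn j * sgn (n ∸ j) ≈ sgn n
      sgn-split j j≤n = go j n j≤n
        where
        go : ∀ j n → j ℕ.≤ n → sgn j * sgn (n ∸ j) ≈ sgn n
        go zero    n       z≤n       = *-identityˡ _
        go (suc j) (suc n) (s≤s j≤n) = trans (*-assoc _ _ _) (*-congˡ (go j n j≤n))
      cancel : ∀ j → j ℕ.≤ n → sgn (suc n) * X j + Y j ≈ 0#
      cancel j j≤n = begin
        - 1# * sgn n * (sgn j * (H j * E′ j)) + H j * φ^ (+ suc j) (sgn (n ∸ j) * e* (+ (n ∸ j)))
          ≈⟨ +-congˡ (*-congˡ (trans (reflexive (φ^-* (+ suc j) (sgn (n ∸ j)) _)) (*-congʳ (reflexive (φ^-sgn (+ suc j) (n ∸ j)))))) ⟩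
        - 1# * sgn n * (sgn j * (H j * E′ j)) + H j * (sgn (n ∸ j) * E′ j)
          ≈⟨ +-congʳ (*-congʳ (*-congˡ (sgn-split j j≤n))) ⟨
        - 1# * (sgn j * sgn (n ∸ j)) * (sgn j * (H j * E′ j)) + H j * (sgn (n ∸ j) * E′ j)
          ≈⟨ solve 4 (λ s t h e → (:- con 1ℤ) :* (s :* t) :* (s :* (h :* e)) :+ h :* (t :* e) := (con 1ℤ :- s :* s) :* (h :* (t :* e))) refl (sgn j) (sgn (n ∸ j)) (H j) (E′ j) ⟩
        (1# - sgn j * sgn j) * (H j * (sgn (n ∸ j) * E′ j))
          ≈⟨ *-congʳ (trans (+-congˡ (-‿cong (sgn² j))) (-‿inverseʳ 1#)) ⟩
        0# * (H j * (sgn (n ∸ j) * E′ j))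
          ≈⟨ zeroˡ _ ⟩
        0# ∎

  -- The relation H·E = 1 twisted by φ.
  he-dual : ∀ N → Sumℤ (λ i → φ^ i (h* i * φ (ε (N ℤ.- i)))) (δ N 0ℤ)
  he-dual -[1+ N ] = Σℤ.zero-sum vanish
    where
    vanish : ∀ i → φ^ i (h* i * g (-[1+ N ] ℤ.- i)) ≈ 0#
    vanish (+ i) = trans (φ^-cong (+ i) (trans (*-congˡ (reflexive (g-neg (ℤ-identities.<0-sub {n = + i} ℤ.-<+)))) (zeroʳ _)))
      (reflexive (φ^-con (+ i) K.0#))
    vanish -[1+ i ] = trans (φ^-cong -[1+ i ] (zeroˡ _)) (reflexive (φ^-con -[1+ i ] K.0#))
  he-dual (+ N) = Σℤ.from-ℕ
    (λ i → trans (φ^-cong -[1+ i ] (zeroˡ _)) (reflexive (φ^-con -[1+ i ] K.0#)))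
    (Σℕ.respʳ (total N) (Σℕ.finite (suc N) outside))
    where
    F : ℕ → ℕ → B
    F N i = φ^ (+ i) (h* (+ i) * g (+ N ℤ.- + i))
    outside : ∀ i → suc N ℕ.≤ i → F N i ≈ 0#
    outside i N<i = trans (φ^-cong (+ i) (trans (*-congˡ (reflexive (g-neg (ℤ-identities.<0-sub (ℤ.+<+ N<i))))) (zeroʳ _)))
      (reflexive (φ^-con (+ i) K.0#))
    total : ∀ N → ∑[ i < suc N ] F N (toℕ i) ≈ δ (+ N) 0ℤ
    total zero = solve 0 (con 1ℤ :* (con 1ℤ :* con 1ℤ) :+ con 0ℤ := con 1ℤ) refl
    -- Each summand is φ of a summand of `ε-expand`: the index i = 0 gives φ(ε_(n+1)), and i = j+1
    -- gives φ(Y j).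
    total (suc n) = begin
      1# * g (+ (suc n ℕ.+ 0)) + ∑[ j < suc n ] F (suc n) (suc (toℕ j))
        ≈⟨ +-cong (trans (*-identityˡ _) (reflexive-cong (λ k → g (+ k)) (ℕₚ.+-identityʳ (suc n)))) (∑-cong-< (suc n) {λ j → F (suc n) (suc j)} {λ j → φ (Y j)} (λ { j (s≤s j≤n) → term j j≤n })) ⟩
      φ (ε (+ suc n)) + ∑[ j < suc n ] φ (Y (toℕ j))
        ≈⟨ +-congˡ (φ-sum (suc n) Y) ⟨
      φ (ε (+ suc n) + ∑[ j < suc n ] Y (toℕ j))
        ≈⟨ φ-cong (ε-expand n) ⟩
      0# ∎
      where
      Y : ℕ → B
      Y j = φ^ (+ j) (h* (+ suc j)) * φ^ (+ suc j) (ε (+ (n ∸ j)))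
      φ-sum : ∀ m (f : ℕ → B) → φ (∑[ j < m ] f (toℕ j)) ≈ ∑[ j < m ] φ (f (toℕ j))
      φ-sum zero    f = refl
      φ-sum (suc m) f = +-congˡ (φ-sum m (f ∘ suc))
      term : ∀ j → j ℕ.≤ n → F (suc n) (suc j) ≈ φ (Y j)
      term j j≤n = φ-cong (trans (reflexive (φ^-* (+ j) (h* (+ suc j)) _))
        (*-congˡ (trans (reflexive-cong (λ k → φ^ (+ j) (g k)) (ℤ-identities.pos-sub (s≤s j≤n))) (sym (φ^-φ′ j _)))))
        where
        φ^-φ′ : ∀ j b → φ^ (+ suc j) b ≈ φ^ (+ j) (φ b)
        φ^-φ′ j b = trans (reflexive-cong (λ k → φ^ k b) (ℤₚ.+-comm 1ℤ (+ j))) (φ^-φ (+ j) b)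

  private
    y : ℤ → B
    y r = fromℤ (r ℤ.- 1ℤ) * g (r ℤ.- 1ℤ) - g r + φ⁻¹ (g r)

    -- y is the defect of ε in being intertwined by φ⁻¹.  Twisted convolution with the
    -- h*_i kills it: multiplication by the degree and the commutator with a shift agree
    -- on the h*_i, both are derivations, and so they agree on the inverse series.
    y-dual : ∀ N → Sumℤ (λ i → φ^ i (h* i * y (N ℤ.- i))) 0#
    y-dual N = Σℤ.respʳ total (Σℤ.respˡ term
        (Σℤ.plus (Σℤ.plus (Σℤ.scale (fromℤ (N ℤ.- 1ℤ)) (he-dual (N ℤ.- 1ℤ)))
                          (Σℤ.plus (Σℤ.scale (- 1#) P-sum) (Σℤ.scale (- 1#) (he-dual N))))
                 (Σℤ.plus (Sum-φ^ -1ℤ (he-dual N)) (Σℤ.pred-shift P-sum))))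
      where
      X W : ℤ → B
      X i = φ^ i (h* i * g (N ℤ.- 1ℤ ℤ.- i))
      W i = φ^ i (h* i * g (N ℤ.- i))
      -- The value of this sum is irrelevant: it enters with sign -1 from the factor N-1-i of the
      -- first part of `y`, and with sign +1, shifted by one index, from the part with φ⁻¹.
      P-exists : ∃ λ P → Sumℤ (λ i → fromℤ i * X i) P
      P-exists = Σℤ.exists 0ℤ N
        (λ i i<0 → trans (*-congˡ (trans (φ^-cong i (trans (*-congʳ (reflexive (h*-neg i<0))) (zeroˡ _))) (reflexive (φ^-con i K.0#)))) (zeroʳ _))
        (λ i N≤i → trans (*-congˡ (trans (φ^-cong i (trans (*-congˡ (reflexive (g-neg (ℤ-identities.<0-sub (lt N≤i))))) (zeroʳ _))) (reflexive (φ^-con i K.0#)))) (zeroʳ _))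
        where
        lt : ∀ {i} → N ℤ.≤ i → N ℤ.- 1ℤ ℤ.< i
        lt le = ℤₚ.<-≤-trans (≡.subst (N ℤ.- 1ℤ ℤ.<_) (ℤₚ.+-identityʳ N) (ℤₚ.+-monoʳ-< N ℤ.-<+)) le
      P = proj₁ P-exists
      P-sum = proj₂ P-exists
      δ-kill : fromℤ (N ℤ.- 1ℤ) * δ (N ℤ.- 1ℤ) 0ℤ ≈ 0#
      δ-kill with N ℤ.- 1ℤ ℤₚ.≟ 0ℤ
      ... | yes eq = trans (*-congʳ (reflexive-cong fromℤ eq)) (zeroˡ _)
      ... | no _   = zeroʳ _
      total : fromℤ (N ℤ.- 1ℤ) * δ (N ℤ.- 1ℤ) 0ℤ + (- 1# * P + - 1# * δ N 0ℤ) + (φ⁻¹ (δ N 0ℤ) + P) ≈ 0#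
      total = trans (+-cong (+-congʳ δ-kill) (+-congʳ (φ^-δ -1ℤ N 0ℤ)))
        (solve 2 (λ p d → con 0ℤ :+ ((:- con 1ℤ) :* p :+ (:- con 1ℤ) :* d) :+ (d :+ p) := con 0ℤ) refl P (δ N 0ℤ))
      -- Taking φ⁻¹ out of the product turns h*_i into φ(h*_i), whose second term produces (i-1)
      -- X_(i-1).
      third : ∀ i → φ⁻¹ (W i) + fromℤ (ℤ.pred i) * X (ℤ.pred i) ≈ φ^ i (h* i * φ⁻¹ (g (N ℤ.- i)))
      third i = sym (begin
        φ^ i (h* i * φ⁻¹ G)
          ≈⟨ φ^-cong i (*-congʳ (φ⁻¹∘φ (h* i))) ⟨
        φ^ i (φ⁻¹ (φ (h* i) * G))
          ≈⟨ φ^-∘ i -1ℤ _ ⟨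
        φ^ (i ℤ.+ -1ℤ) (φ (h* i) * G)
          ≈⟨ reflexive-cong (λ k → φ^ k (φ (h* i) * G)) (ℤₚ.+-comm i -1ℤ) ⟩
        φ^ (ℤ.pred i) (φ (h* i) * G)
          ≈⟨ φ^-cong (ℤ.pred i) (*-congʳ (φ-h* i)) ⟩
        φ^ (ℤ.pred i) ((h* i + fromℤ (i ℤ.- 1ℤ) * h* (i ℤ.- 1ℤ)) * G)
          ≈⟨ φ^-cong (ℤ.pred i) (solve 4 (λ a z b G → (a :+ z :* b) :* G := a :* G :+ z :* (b :* G)) refl (h* i) (fromℤ (i ℤ.- 1ℤ)) (h* (i ℤ.- 1ℤ)) G) ⟩
        φ^ (ℤ.pred i) (h* i * G + fromℤ (i ℤ.- 1ℤ) * (h* (i ℤ.- 1ℤ) * G))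
          ≈⟨ trans (reflexive (φ^-+ (ℤ.pred i) _ _)) (+-cong (φ^-pred i _) (φ^-scale (ℤ.pred i) (i ℤ.- 1ℤ) _)) ⟩
        φ⁻¹ (W i) + fromℤ (i ℤ.- 1ℤ) * φ^ (ℤ.pred i) (h* (i ℤ.- 1ℤ) * G)
          ≈⟨ +-congˡ (reflexive (≡.cong₂ (λ j k → fromℤ j * φ^ (ℤ.pred i) (h* j * g k)) (ℤ-identities.i-1≡-1+i i)
                (≡.trans (ℤ-identities.N-i≡-1+N-[-1+i] N i) (≡.cong (ℤ._- ℤ.pred i) (≡.sym (ℤ-identities.i-1≡-1+i N)))))) ⟩
        φ⁻¹ (W i) + fromℤ (ℤ.pred i) * X (ℤ.pred i) ∎)
        where G = g (N ℤ.- i)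
      first : ∀ i → φ^ i (h* i * (fromℤ (N ℤ.- i ℤ.- 1ℤ) * g (N ℤ.- i ℤ.- 1ℤ))) ≈ fromℤ (N ℤ.- 1ℤ) * X i - fromℤ i * X i
      first i = begin
        φ^ i (h* i * (fromℤ (N ℤ.- i ℤ.- 1ℤ) * g (N ℤ.- i ℤ.- 1ℤ)))
          ≈⟨ φ^-cong i (solve 3 (λ a b c → a :* (b :* c) := b :* (a :* c)) refl (h* i) (fromℤ (N ℤ.- i ℤ.- 1ℤ)) (g (N ℤ.- i ℤ.- 1ℤ))) ⟩
        φ^ i (fromℤ (N ℤ.- i ℤ.- 1ℤ) * (h* i * g (N ℤ.- i ℤ.- 1ℤ)))
          ≈⟨ φ^-scale i (N ℤ.- i ℤ.- 1ℤ) _ ⟩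
        fromℤ (N ℤ.- i ℤ.- 1ℤ) * φ^ i (h* i * g (N ℤ.- i ℤ.- 1ℤ))
          ≈⟨ reflexive-cong (λ k → fromℤ k * φ^ i (h* i * g k)) (ℤ-identities.N-i-1≡N-1-i N i) ⟩
        fromℤ (N ℤ.- 1ℤ ℤ.- i) * X i
          ≈⟨ *-congʳ (trans (fromℤ-+ (N ℤ.- 1ℤ) (ℤ.- i)) (+-congˡ (fromℤ-neg i))) ⟩
        (fromℤ (N ℤ.- 1ℤ) - fromℤ i) * X i
          ≈⟨ solve 3 (λ a b x → (a :- b) :* x := a :* x :- b :* x) refl _ _ _ ⟩
        fromℤ (N ℤ.- 1ℤ) * X i - fromℤ i * X i ∎
      term : ∀ i → fromℤ (N ℤ.- 1ℤ) * X i + (- 1# * (fromℤ i * X i) + - 1# * W i) + (φ⁻¹ (W i) + fromℤ (ℤ.pred i) * X (ℤ.pred i))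
             ≈ φ^ i (h* i * y (N ℤ.- i))
      term i = sym (begin
        φ^ i (h* i * (fromℤ (N ℤ.- i ℤ.- 1ℤ) * g (N ℤ.- i ℤ.- 1ℤ) - g (N ℤ.- i) + φ⁻¹ (g (N ℤ.- i))))
          ≈⟨ φ^-cong i (solve 4 (λ h a b c → h :* (a :- b :+ c) := h :* a :+ (:- (h :* b) :+ h :* c)) refl (h* i) _ _ _) ⟩
        φ^ i (h* i * (fromℤ (N ℤ.- i ℤ.- 1ℤ) * g (N ℤ.- i ℤ.- 1ℤ)) + (- (h* i * g (N ℤ.- i)) + h* i * φ⁻¹ (g (N ℤ.- i))))
          ≈⟨ trans (reflexive (φ^-+ i _ _)) (+-cong (first i) (trans (reflexive (φ^-+ i _ _)) (+-cong (reflexive (φ^-neg i _)) (sym (third i))))) ⟩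
        fromℤ (N ℤ.- 1ℤ) * X i - fromℤ i * X i + (- W i + (φ⁻¹ (W i) + fromℤ (ℤ.pred i) * X (ℤ.pred i)))
          ≈⟨ solve 4 (λ a b w t → a :- b :+ (:- w :+ t) := a :+ ((:- con 1ℤ) :* b :+ (:- con 1ℤ) :* w) :+ t) refl _ _ _ _ ⟩
        fromℤ (N ℤ.- 1ℤ) * X i + (- 1# * (fromℤ i * X i) + - 1# * W i) + (φ⁻¹ (W i) + fromℤ (ℤ.pred i) * X (ℤ.pred i)) ∎)

    y-neg : ∀ r → r ℤ.< 0ℤ → y r ≈ 0#
    y-neg r r<0 = begin
      fromℤ (r ℤ.- 1ℤ) * g (r ℤ.- 1ℤ) - g r + φ⁻¹ (g r)
        ≈⟨ +-cong (+-cong (*-congˡ (reflexive (g-neg (ℤₚ.≤-<-trans (ℤₚ.i≤j⇒i-k≤j 1ℤ ℤₚ.≤-refl) r<0)))) (-‿cong (reflexive (g-neg r<0))))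
             (φ⁻¹-cong (reflexive (g-neg r<0))) ⟩
      fromℤ (r ℤ.- 1ℤ) * 0# - 0# + 0#
        ≈⟨ solve 1 (λ a → a :* con 0ℤ :- con 0ℤ :+ con 0ℤ := con 0ℤ) refl _ ⟩
      0# ∎

    -- In `y-dual` the index i = 0 contributes y r itself, as h*_0 = 1, and i > 0 contributes only y
    -- at smaller arguments, which vanish by induction.
    y-below : ∀ n r → r ℤ.< + n → y r ≈ 0#
    y-below zero    r r<0 = y-neg r r<0
    y-below (suc n) r r<n = Σℤ.unique (Σℤ.respʳ (trans (*-identityˡ _) (reflexive-cong y (ℤₚ.+-identityʳ r)))
        (Σℤ.single {f = λ i → φ^ i (h* i * y (r ℤ.- i))} 0ℤ off)) (y-dual r)
      where
      off : ∀ i → i ≢ 0ℤ → φ^ i (h* i * y (r ℤ.- i)) ≈ 0#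
      off (+ zero)  i≢0 = contradiction ≡.refl i≢0
      off (+ suc i) i≢0 = trans (φ^-cong (+ suc i) (trans (*-congˡ (y-below n _ lt)) (zeroʳ _))) (reflexive (φ^-con (+ suc i) K.0#))
        where
        lt : r ℤ.- + suc i ℤ.< + n
        lt = ℤₚ.<-≤-trans (ℤₚ.+-monoˡ-< (ℤ.- + suc i) r<n) (≡.subst (ℤ._≤ + n) (≡.sym (ℤₚ.[1+m]⊖[1+n]≡m⊖n n i)) (ℤₚ.m⊖n≤m n i))
      off -[1+ i ]  i≢0 = trans (φ^-cong -[1+ i ] (zeroˡ _)) (reflexive (φ^-con -[1+ i ] K.0#))

    y-zero : ∀ r → y r ≈ 0#
    y-zero (+ r)    = y-below (suc r) (+ r) (ℤ.+<+ ℕₚ.≤-refl)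
    y-zero -[1+ r ] = y-neg -[1+ r ] ℤ.-<+

  -- φ⁻¹ applied to y r = 0, which is written in terms of φ(ε) because that is what occurs in
  -- `he-dual`.
  φ⁻¹-ε : ∀ r → φ⁻¹ (ε r) ≈ ε r - fromℤ (r ℤ.- 1ℤ) * ε (r ℤ.- 1ℤ)
  φ⁻¹-ε r = begin
    φ⁻¹ (ε r)
      ≈⟨ solve 3 (λ e a d → e := d :- a :+ (a :- d :+ e)) refl _ A′ (ε r) ⟩
    ε r - A′ + (A′ - ε r + φ⁻¹ (ε r))
      ≈⟨ +-congˡ shifted ⟨
    ε r - A′ + φ⁻¹ (y r)
      ≈⟨ +-congˡ (φ⁻¹-cong (y-zero r)) ⟩
    ε r - A′ + 0#
      ≈⟨ +-identityʳ _ ⟩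
    ε r - A′ ∎
    where
    A′ = fromℤ (r ℤ.- 1ℤ) * ε (r ℤ.- 1ℤ)
    shifted : φ⁻¹ (y r) ≈ A′ - ε r + φ⁻¹ (ε r)
    shifted = +-cong (+-cong (trans (φ^-scale -1ℤ (r ℤ.- 1ℤ) (g (r ℤ.- 1ℤ))) (*-congˡ (φ⁻¹∘φ _))) (-‿cong (φ⁻¹∘φ _)))
      (φ⁻¹-cong (φ⁻¹∘φ (ε r)))

  -- `he-dual` at N = a-n, twisted by φ^(-a-1) and reindexed by i = a-p: the exponents add up to
  -- -p-1, and h*_(a-p) is then h⟨-p-1⟩ at a+1.
  eh-orthogonal : ∀ a n → Sumℤ (λ p → φ^ (ℤ.- p) (ε (p ℤ.- n)) * h⟨ ℤ.- p ℤ.- 1ℤ ⟩ (a ℤ.+ 1ℤ)) (δ n a)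
  eh-orthogonal a n = Σℤ.respʳ (trans (φ^-δ q (a ℤ.- n) 0ℤ) (reflexive δ-eq))
      (Σℤ.respˡ term (Σℤ.reflect {f = λ i → φ^ q (φ^ i (h* i * g (a ℤ.- n ℤ.- i)))} a (Sum-φ^ q (he-dual (a ℤ.- n)))))
    where
    q = ℤ.- a ℤ.- 1ℤ
    δ-eq : δ (a ℤ.- n) 0ℤ ≡ δ n a
    δ-eq with n ℤₚ.≟ a
    ... | yes eq = δ-refl _ _ (ℤₚ.i≡j⇒i-j≡0 (≡.sym eq))
    ... | no neq = δ-off _ _ (λ e → neq (≡.sym (ℤₚ.i-j≡0⇒i≡j a n e)))
    term : ∀ p → φ^ q (φ^ (a ℤ.- p) (h* (a ℤ.- p) * g (a ℤ.- n ℤ.- (a ℤ.- p)))) ≈ φ^ (ℤ.- p) (ε (p ℤ.- n)) * h⟨ ℤ.- p ℤ.- 1ℤ ⟩ (a ℤ.+ 1ℤ)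
    term p = begin
      φ^ q (φ^ (a ℤ.- p) (h* (a ℤ.- p) * g (a ℤ.- n ℤ.- (a ℤ.- p))))
        ≈⟨ φ^-∘ q (a ℤ.- p) _ ⟨
      φ^ (q ℤ.+ (a ℤ.- p)) (h* (a ℤ.- p) * g (a ℤ.- n ℤ.- (a ℤ.- p)))
        ≈⟨ reflexive (≡.cong₂ (λ i j → φ^ i (h* (a ℤ.- p) * g j)) (ℤ-identities.-a-1+[a-p]≡-p-1 a p) (ℤ-identities.a-n-[a-p]≡p-n a n p)) ⟩
      φ^ r (h* (a ℤ.- p) * g (p ℤ.- n))
        ≈⟨ trans (reflexive (φ^-* r _ _)) (*-comm _ _) ⟩
      φ^ r (φ (ε (p ℤ.- n))) * φ^ r (h* (a ℤ.- p))
        ≈⟨ *-cong (trans (sym (φ^-φ r _)) (reflexive-cong (λ i → φ^ i (ε (p ℤ.- n))) (ℤ-identities.-p-1+1≡-p p)))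
             (reflexive-cong (λ i → φ^ r (h* i)) (≡.sym (ℤ-identities.a+1+[-p-1]≡a-p a p))) ⟩
      φ^ (ℤ.- p) (ε (p ℤ.- n)) * h⟨ r ⟩ (a ℤ.+ 1ℤ) ∎
      where r = ℤ.- p ℤ.- 1ℤ

-- Values of the operators on s_α: added rows and removed rows.

module Strips {c ℓ} (K : CommutativeRing c ℓ) where
  open ShiftedSymmetric K
  private module K = CommutativeRing K
  open CommutativeRing B-ring hiding (zero)
  open RingTools B-ring
  open ShiftedSchur K
  open Duality K
  open Relation.Binary.Reasoning.Setoid setoid

  zeros : ℕ → List ℤ
  zeros k = replicate k 0ℤ

  -- Behind the new entry the rows of `α` stand one place lower, which is exactly the shift of
  -- labels in the definition of D_p; the omitted column is the index p.
  s-∷-expand : ∀ k α → s (k ∷ α) ≈ ∑[ j < suc (length α) ] (sgn (toℕ j) * (h⟨ + toℕ j ⟩ k * D-on-s (+ toℕ j) α))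
  s-∷-expand k α = sum-cong-≋ {suc (length α)} λ j →
    trans (*-assoc (sgn (toℕ j)) _ _) (*-congˡ (*-cong (reflexive-cong h⟨ + toℕ j ⟩ (ℤₚ.+-identityʳ k)) (omit j)))
    where
    omit : ∀ j → det {length α} (λ i m → h⟨ + toℕ (punchIn j m) ⟩ (part α (toℕ i) ℤ.- + suc (toℕ i))) ≈ D-on-s (+ toℕ j) α
    omit j with toℕ j ℕₚ.<? suc (length α)
    ... | no  j≮ = contradiction (Finₚ.toℕ<n j) j≮
    ... | yes j< = reflexive-cong (λ j → det {length α} (λ i m → h⟨ + toℕ (punchIn j m) ⟩ (part α (toℕ i) ℤ.- + suc (toℕ i))))
                     (≡.sym (Finₚ.fromℕ<-toℕ j j<))

  D-on-s-vanish : ∀ p α → length α ℕ.< p → D-on-s (+ p) α ≈ 0#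
  D-on-s-vanish p α l<p with p ℕₚ.<? suc (length α)
  ... | no  _  = refl
  ... | yes p< = contradiction (ℕₚ.≤-trans p< l<p) (ℕₚ.<-irrefl ≡.refl)

  s-∷-sum : ∀ k α → Sumℕ (λ j → sgn j * (h⟨ + j ⟩ k * D-on-s (+ j) α)) (s (k ∷ α))
  s-∷-sum k α = Σℕ.respʳ (sym (s-∷-expand k α)) (Σℕ.finite (suc (length α))
    (λ j l<j → trans (*-congˡ (trans (*-congˡ (D-on-s-vanish j α l<j)) (zeroʳ _))) (zeroʳ _)))

  labels-∷ʳ : ∀ o α a → labels o (α ∷ʳ a) ≡ labels o α ∷ʳ (a ℤ.- + (o ℕ.+ length α))
  labels-∷ʳ o []      a = ≡.cong (λ i → (a ℤ.- + i) ∷ []) (≡.sym (ℕₚ.+-identityʳ o))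
  labels-∷ʳ o (b ∷ α) a = ≡.cong (_ ∷_) (≡.trans (labels-∷ʳ (suc o) α a)
    (≡.cong (λ i → labels (suc o) α ∷ʳ (a ℤ.- + i)) (≡.sym (ℕₚ.+-suc o (length α)))))

  columns-∷ʳ : ∀ o n → columns o (suc n) ≡ columns o n ∷ʳ + (o ℕ.+ n)
  columns-∷ʳ o zero    = ≡.cong (λ i → + i ∷ []) (≡.sym (ℕₚ.+-identityʳ o))
  columns-∷ʳ o (suc n) = ≡.cong (_ ∷_) (≡.trans (columns-∷ʳ (suc o) n)
    (≡.cong (λ i → columns (suc o) n ∷ʳ + i) (≡.sym (ℕₚ.+-suc o n))))

  columns-< : ∀ {p} {P : ℤ → Set p} o n → (∀ i → i ℕ.< o ℕ.+ n → P (+ i)) → All P (columns o n)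
  columns-< o zero    h = []
  columns-< o (suc n) h = h o (ℕₚ.m<m+n o (s≤s z≤n)) ∷
    columns-< (suc o) n (λ i lt → h i (≡.subst (i ℕ.<_) (≡.sym (ℕₚ.+-suc o n)) lt))

  -- The appended row has label -l, so it vanishes in the columns below l and equals 1 in column l.
  s-∷ʳ0 : ∀ α → s (α ∷ʳ 0ℤ) ≈ s α
  s-∷ʳ0 α = begin
    s (α ∷ʳ 0ℤ)
      ≈⟨ s-minor (α ∷ʳ 0ℤ) ⟩
    minor (rows 0 (α ∷ʳ 0ℤ)) (columns 0 (length (α ∷ʳ 0ℤ)))
      ≈⟨ reflexive (≡.cong₂ minor
           (≡.trans (≡.cong (map row) (labels-∷ʳ 0 α 0ℤ)) (Listₚ.map-++ row (labels 0 α) _))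
           (≡.trans (≡.cong (columns 0) (≡.trans (Listₚ.length-++ α) (ℕₚ.+-comm l 1))) (columns-∷ʳ 0 l))) ⟩
    minor (rows 0 α ∷ʳ row last) (columns 0 l ∷ʳ + l)
      ≈⟨ minor-∷ʳ (rows 0 α) (row last) (+ l) (columns-< 0 l vanish) ⟩
    minor (rows 0 α) (columns 0 l) * row last (+ l)
      ≈⟨ *-cong (sym (s-minor α)) (h-one (+ l) last (≡.trans (≡.cong (ℤ._+ + l) (ℤₚ.+-identityˡ (ℤ.- + l))) (ℤₚ.+-inverseˡ (+ l)))) ⟩
    s α * 1#
      ≈⟨ *-identityʳ _ ⟩
    s α ∎
    where
    l = length α
    last = 0ℤ ℤ.- + l
    vanish : ∀ i → i ℕ.< l → row last (+ i) ≈ 0#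
    vanish i i<l = h-vanish (+ i) last (≡.subst (ℤ._< 0ℤ) (≡.trans (ℤₚ.+-comm (+ i) (ℤ.- + l)) (≡.cong (ℤ._+ + i) (≡.sym (ℤₚ.+-identityˡ (ℤ.- + l)))))
      (ℤ-identities.<0-sub (ℤ.+<+ i<l)))

  s-zeros : ∀ k α → s (α ++ zeros k) ≈ s α
  s-zeros zero    α = reflexive-cong s (Listₚ.++-identityʳ α)
  s-zeros (suc k) α = begin
    s (α ++ 0ℤ ∷ zeros k)       ≈⟨ reflexive-cong s (≡.sym (Listₚ.++-assoc α (0ℤ ∷ []) (zeros k))) ⟩
    s ((α ∷ʳ 0ℤ) ++ zeros k)    ≈⟨ s-zeros k (α ∷ʳ 0ℤ) ⟩
    s (α ∷ʳ 0ℤ)                 ≈⟨ s-∷ʳ0 α ⟩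
    s α                         ∎

  -- How many zeros remain depends on whether `t` lies beyond the end of `α`; the number does not
  -- affect `s`.
  strip-zeros : ∀ t α k → ∃ λ k′ → strip t (α ++ zeros k) ≡ strip t α ++ zeros k′
  strip-zeros t       []      zero    = 0 , ≡.sym (Listₚ.++-identityʳ _)
  strip-zeros zero    []      (suc k) = k , ≡.refl
  strip-zeros (suc t) []      (suc k) with strip-zeros t [] k
  ... | k′ , eq = k′ , ≡.cong (1ℤ ∷_) eq
  strip-zeros zero    (a ∷ α) k       = k , ≡.refl
  strip-zeros (suc t) (a ∷ α) k       with strip-zeros t α k
  ... | k′ , eq = k′ , ≡.cong ((a ℤ.+ 1ℤ) ∷_) eq

  s-strip-zeros : ∀ t α k → s (strip t (α ++ zeros k)) ≈ s (strip t α)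
  s-strip-zeros t α k with strip-zeros t α k
  ... | k′ , eq = trans (reflexive-cong s eq) (s-zeros k′ (strip t α))

  part-zeros : ∀ α k t → part (α ++ zeros k) t ≡ part α t
  part-zeros []      zero    t       = ≡.refl
  part-zeros []      (suc k) zero    = ≡.refl
  part-zeros []      (suc k) (suc t) = part-zeros [] k t
  part-zeros (a ∷ α) k       zero    = ≡.refl
  part-zeros (a ∷ α) k       (suc t) = part-zeros α k t

  part-beyond : ∀ α t → length α ℕ.≤ t → part α t ≡ 0ℤ
  part-beyond []      t       _        = ≡.refl
  part-beyond (a ∷ α) (suc t) (s≤s le) = part-beyond α t le

  part-bounded : ∀ α → ∃ λ P → ∀ t → part α t ℤ.≤ + P
  part-bounded []      = 0 , λ t → ℤₚ.≤-refl
  part-bounded (a ∷ α) with part-bounded α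
  ... | P , bound = ℤ.∣ a ∣ ℕ.⊔ P , λ
    { zero    → ℤₚ.≤-trans (ℤ-identities.i≤∣i∣ a) (ℤ.+≤+ (ℕₚ.m≤m⊔n _ P))
    ; (suc t) → ℤₚ.≤-trans (bound t) (ℤ.+≤+ (ℕₚ.m≤n⊔m ℤ.∣ a ∣ P)) }

  raised : ℕ → List ℤ → List Row
  raised o β = map row (map ℤ.suc (labels o β))

  -- Entries before the removed one grow by 1 in place, later ones keep their value and move up one
  -- place. Either way the label λ_i - i + 1 rises by exactly one.
  rows-strip : ∀ o t β → t ℕ.< length β → rows o (strip t β) ≡ removeRow t (raised o β)
  rows-strip o zero    (a ∷ β) _        = lower o β
    where
    lower : ∀ o β → rows o β ≡ raised (suc o) β
    lower o []      = ≡.refl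
    lower o (a ∷ β) = ≡.cong₂ _∷_ (≡.cong row (ℤ-identities.a-o≡1+[a-[1+o]] a (+ o))) (lower (suc o) β)
  rows-strip o (suc t) (a ∷ β) (s≤s lt) =
    ≡.cong₂ _∷_ (≡.cong row (ℤ-identities.a+1-o≡1+[a-o] a (+ o))) (rows-strip (suc o) t β lt)

  length-strip : ∀ t β → t ℕ.< length β → suc (length (strip t β)) ≡ length β
  length-strip zero    (a ∷ β) _        = ≡.refl
  length-strip (suc t) (a ∷ β) (s≤s lt) = ≡.cong suc (length-strip t β lt)

  rowAt-raised : ∀ o t β → t ℕ.< length β → rowAt (raised o β) t ≡ row (ℤ.suc (part β t ℤ.- + (o ℕ.+ t)))
  rowAt-raised o zero    (a ∷ β) _        = ≡.cong (λ i → row (ℤ.suc (a ℤ.- + i))) (≡.sym (ℕₚ.+-identityʳ o))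
  rowAt-raised o (suc t) (a ∷ β) (s≤s lt) = ≡.trans (rowAt-raised (suc o) t β lt)
    (≡.cong (λ i → row (ℤ.suc (part β t ℤ.- + i))) (≡.sym (ℕₚ.+-suc o t)))

  stripped : ℤ → List ℤ → ℕ → B
  stripped p α t = sgn t * (h⟨ p ⟩ (part α t ℤ.- + suc t ℤ.+ + 2) * s (strip t α))

  -- Past the end of `α` the h-factor has underlying index p+1-t, which is negative for t ≥ 2+∣p∣;
  -- hence the length of the sum.
  D⁽⁾-on-s : ℤ → List ℤ → B
  D⁽⁾-on-s p α = ∑[ t < length α ℕ.+ (2 ℕ.+ ℤ.∣ p ∣) ] stripped p α (toℕ t)

  stripped-zero : ∀ p α t → part α t ℤ.- + suc t ℤ.+ + 2 ℤ.+ p ℤ.< 0ℤ → stripped p α t ≈ 0#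
  stripped-zero p α t lt = trans (*-congˡ (trans (*-congʳ (h-vanish p (part α t ℤ.- + suc t ℤ.+ + 2) lt)) (zeroˡ _))) (zeroʳ _)

  stripped-beyond : ∀ p α t → length α ℕ.≤ t → p ℤ.+ 1ℤ ℤ.< + t → stripped p α t ≈ 0#
  stripped-beyond p α t l≤t lt = stripped-zero p α t
    (≡.subst (ℤ._< 0ℤ) (≡.sym (≡.trans (≡.cong (λ a → a ℤ.- + suc t ℤ.+ + 2 ℤ.+ p) (part-beyond α t l≤t)) (ℤ-identities.0-[1+t]+2+p≡p+1-t (+ t) p)))
      (ℤ-identities.<0-sub lt))

  D⁽⁾-on-s-sum : ∀ p α → Sumℕ (stripped p α) (D⁽⁾-on-s p α)
  D⁽⁾-on-s-sum p α = Σℕ.finite _ λ t le → stripped-beyond p α t (ℕₚ.m+n≤o⇒m≤o _ le)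
    (ℤₚ.≤-<-trans (ℤₚ.+-monoˡ-≤ 1ℤ (ℤ-identities.i≤∣i∣ p))
      (ℤ.+<+ (ℕₚ.≤-trans (ℕₚ.≤-reflexive (≡.cong suc (ℕₚ.+-comm ℤ.∣ p ∣ 1))) (ℕₚ.m+n≤o⇒n≤o (length α) le))))

  -- The sum is the expansion of a determinant with two equal columns.
  D⁽⁾-on-s-nonnegative : ∀ q α → D⁽⁾-on-s (+ q) α ≈ 0#
  D⁽⁾-on-s-nonnegative q α = begin
    ∑[ t < N ] stripped (+ q) α (toℕ t)
      ≈⟨ ∑-cong-< N term ⟩
    ∑[ t < N ] (sgn (toℕ t) * rowAt (raised 0 β) (toℕ t) (+ q) * minor (removeRow (toℕ t) (raised 0 β)) (columns 0 M))
      ≈⟨ reflexive-cong (λ n → ∑[ t < n ] (sgn (toℕ t) * rowAt (raised 0 β) (toℕ t) (+ q) * minor (removeRow (toℕ t) (raised 0 β)) (columns 0 M))) (≡.sym length-raised) ⟩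
    ∑[ t < length (raised 0 β) ] (sgn (toℕ t) * rowAt (raised 0 β) (toℕ t) (+ q) * minor (removeRow (toℕ t) (raised 0 β)) (columns 0 M))
      ≈⟨ column-expand (raised 0 β) (+ q) (columns 0 M) ⟨
    minor (raised 0 β) (+ q ∷ columns 0 M)
      ≈⟨ repeated ⟩
    0# ∎
    where
    l = length α
    N = l ℕ.+ (2 ℕ.+ q)
    M = l ℕ.+ (1 ℕ.+ q)
    -- The padding gives one row for each of the `N` summands, and enough columns 0,...,M-1 for `q`
    -- to be among them.
    β = α ++ zeros (2 ℕ.+ q)
    length-β : length β ≡ N
    length-β = ≡.trans (Listₚ.length-++ α) (≡.cong (l ℕ.+_) (Listₚ.length-replicate (2 ℕ.+ q)))
    length-raised : length (raised 0 β) ≡ N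
    length-raised = ≡.trans (≡.trans (Listₚ.length-map row (map ℤ.suc (labels 0 β))) (≡.trans (Listₚ.length-map ℤ.suc (labels 0 β)) (length-labels 0 β))) length-β
      where
      length-labels : ∀ o β → length (labels o β) ≡ length β
      length-labels o []      = ≡.refl
      length-labels o (b ∷ β) = ≡.cong suc (length-labels (suc o) β)
    term : ∀ t → t ℕ.< N → stripped (+ q) α t ≈ sgn t * rowAt (raised 0 β) t (+ q) * minor (removeRow t (raised 0 β)) (columns 0 M)
    term t t<N = trans (sym (*-assoc _ _ _)) (*-cong (*-congˡ entry) (begin
        s (strip t α)                              ≈⟨ s-strip-zeros t α (2 ℕ.+ q) ⟨
        s (strip t β)                              ≈⟨ s-minor (strip t β) ⟩
        minor (rows 0 (strip t β)) (columns 0 (length (strip t β)))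
          ≈⟨ reflexive (≡.cong₂ minor (rows-strip 0 t β t<β) (≡.cong (columns 0) (ℕₚ.suc-injective
               (≡.trans (length-strip t β t<β) (≡.trans length-β (ℕₚ.+-suc l (1 ℕ.+ q))))))) ⟩
        minor (removeRow t (raised 0 β)) (columns 0 M) ∎))
      where
      t<β = ≡.subst (t ℕ.<_) (≡.sym length-β) t<N
      entry : h⟨ + q ⟩ (part α t ℤ.- + suc t ℤ.+ + 2) ≈ rowAt (raised 0 β) t (+ q)
      entry = reflexive (≡.trans (≡.cong h⟨ + q ⟩ (≡.trans (≡.sym (ℤ-identities.1+[a-t]≡a-[1+t]+2 (part α t) (+ t)))
                  (≡.cong (λ a → ℤ.suc (a ℤ.- + t)) (≡.sym (part-zeros α (2 ℕ.+ q) t)))))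
                (≡.cong (λ r → r (+ q)) (≡.sym (rowAt-raised 0 t β t<β))))
    split : ∀ o n q → q ℕ.< n → ∃ λ pre → ∃ λ post → columns o n ≡ pre ++ + (o ℕ.+ q) ∷ post
    split o (suc n) zero    _        = [] , _ , ≡.cong (λ i → + i ∷ columns (suc o) n) (≡.sym (ℕₚ.+-identityʳ o))
    split o (suc n) (suc q) (s≤s lt) with split (suc o) n q lt
    ... | pre , post , eq = + o ∷ pre , post ,
      ≡.cong (+ o ∷_) (≡.trans eq (≡.cong (λ i → pre ++ + i ∷ post) (≡.sym (ℕₚ.+-suc o q))))
    repeated : minor (raised 0 β) (+ q ∷ columns 0 M) ≈ 0#
    repeated with split 0 M q (ℕₚ.m≤n+m (suc q) l)
    ... | pre , post , eq = trans (reflexive-cong (λ cs → minor (raised 0 β) (+ q ∷ cs)) eq)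
      (repeated-column (minor-alternating (raised 0 β)) (+ q) pre post)

  D⁽⁾-on-s-vanish : ∀ α → ∃ λ P → ∀ q → P ℕ.≤ q → D⁽⁾-on-s -[1+ q ] α ≈ 0#
  D⁽⁾-on-s-vanish α with part-bounded α
  ... | P , bound = suc P , λ q P<q → ∑-zero (length α ℕ.+ (3 ℕ.+ q)) {stripped -[1+ q ] α} λ t → stripped-zero -[1+ q ] α t
    (≡.subst (ℤ._< 0ℤ) (≡.sym (ℤ-identities.a-[1+t]+2+[-[1+q]]≡a-[q+t] (part α t) (+ t) (+ q)))
      (ℤ-identities.<0-sub {n = + q ℤ.+ + t} (ℤₚ.≤-<-trans (bound t) (ℤ.+<+ (ℕₚ.≤-trans P<q (ℕₚ.m≤m+n q t))))))

  -- The summand of ψ*_k(s_α z^m) for c = k - m - 1.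
  selected : ℤ → List ℤ → ℕ → B
  selected c α t = sgn t * (δ c (part α t ℤ.- + suc t) * s (strip t α))

  -- Each δ in the definition of ψ* is replaced by the sum over `p` from `eh-orthogonal`;
  -- interchanging it with the finite sum over `t` collects D⁽-p-1⁾(s_α).
  ψ*-expand : ∀ c α → ∃ λ S → Sumℕ (selected c α) S ×
    Sumℤ (λ p → φ^ (ℤ.- p) (ε (p ℤ.- (c ℤ.+ 1ℤ))) * D⁽⁾-on-s (ℤ.- p ℤ.- 1ℤ) α) S
  ψ*-expand c α = _ , Σℕ.finite M selected-vanish ,
      Σℤ.respʳ (∑-cong M value) (Σℤ.respˡ term
        (Σℤ.finite-sum M (λ t → Σℤ.scale (sgn t * s (strip t α)) (eh-orthogonal (a t) n))))
    where
    n = c ℤ.+ 1ℤ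
    -- One length for all `p`: beyond it every δ is zero, and so are the summands of D⁽-p-1⁾ for p ≥
    -- n.
    M = length α ℕ.+ (2 ℕ.+ ℤ.∣ n ∣)
    a : ℕ → ℤ
    a t = part α t ℤ.- + suc t ℤ.+ 1ℤ
    δ-suc : ∀ i j → δ (i ℤ.+ 1ℤ) (j ℤ.+ 1ℤ) ≡ δ i j
    δ-suc i j with i ℤₚ.≟ j
    ... | yes eq = δ-refl (i ℤ.+ 1ℤ) (j ℤ.+ 1ℤ) (≡.cong (ℤ._+ 1ℤ) eq)
    ... | no neq = δ-off (i ℤ.+ 1ℤ) (j ℤ.+ 1ℤ) (λ eq → neq (≡.trans (≡.sym (ℤ-identities.k+c-c≡k i 1ℤ)) (≡.trans (≡.cong (ℤ._- 1ℤ) eq) (ℤ-identities.k+c-c≡k j 1ℤ))))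
    value : ∀ t → sgn t * s (strip t α) * δ n (a t) ≈ selected c α t
    value t = trans (*-congˡ (reflexive (δ-suc c (part α t ℤ.- + suc t))))
      (solve 3 (λ x y z → x :* y :* z := x :* (z :* y)) refl _ _ _)
    -n≤∣n∣ : ∀ i → ℤ.- i ℤ.≤ + ℤ.∣ i ∣
    -n≤∣n∣ i = ≡.subst (λ m → ℤ.- i ℤ.≤ + m) (ℤₚ.∣-i∣≡∣i∣ i) (ℤ-identities.i≤∣i∣ (ℤ.- i))
    selected-vanish : ∀ t → M ℕ.≤ t → selected c α t ≈ 0#
    selected-vanish t M≤t = trans (*-congˡ (trans (*-congʳ (reflexive (δ-off c _ neq))) (zeroˡ _))) (zeroʳ _)
      where
      neq : c ≢ part α t ℤ.- + suc t
      neq eq = ℤₚ.<⇒≱ (ℤ.+<+ (ℕₚ.m+n≤o⇒n≤o (length α) (ℕₚ.≤-trans (ℕₚ.+-monoʳ-≤ (length α) (ℕₚ.n≤1+n _)) M≤t)))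
        (≡.subst (ℤ._≤ + ℤ.∣ n ∣) -n≡t (-n≤∣n∣ n))
        where
        flip : ∀ t → ℤ.- (0ℤ ℤ.- (1ℤ ℤ.+ t) ℤ.+ 1ℤ) ≡ t
        flip = S.solve 1 (λ t → S.:- (S.con 0ℤ S.:- (S.con 1ℤ S.:+ t) S.:+ S.con 1ℤ) S.:= t) ≡.refl
          where module S = Data.Integer.Solver.+-*-Solver
        -n≡t : ℤ.- n ≡ + t
        -n≡t = ≡.trans (≡.cong (λ i → ℤ.- (i ℤ.+ 1ℤ)) (≡.trans eq (≡.cong (ℤ._- + suc t) (part-beyond α t (ℕₚ.m+n≤o⇒m≤o _ M≤t))))) (flip (+ t))
    term : ∀ p → ∑[ t < M ] (sgn (toℕ t) * s (strip (toℕ t) α) * (φ^ (ℤ.- p) (ε (p ℤ.- n)) * h⟨ ℤ.- p ℤ.- 1ℤ ⟩ (a (toℕ t) ℤ.+ 1ℤ)))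
             ≈ φ^ (ℤ.- p) (ε (p ℤ.- n)) * D⁽⁾-on-s (ℤ.- p ℤ.- 1ℤ) α
    term p = begin
      ∑[ t < M ] (sgn (toℕ t) * s (strip (toℕ t) α) * (e * h⟨ q ⟩ (a (toℕ t) ℤ.+ 1ℤ)))
        ≈⟨ ∑-cong M (λ t → trans (solve 4 (λ x y e h → x :* y :* (e :* h) := e :* (x :* (h :* y))) refl (sgn t) (s (strip t α)) e _)
              (*-congˡ (*-congˡ (*-congʳ (reflexive-cong h⟨ q ⟩ (ℤ-identities.a+1+1≡a+2 (part α t ℤ.- + suc t))))))) ⟩
      ∑[ t < M ] (e * stripped q α (toℕ t))
        ≈⟨ ∑-* M e (stripped q α) ⟨
      e * ∑[ t < M ] stripped q α (toℕ t)
        ≈⟨ reduce ⟩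
      e * D⁽⁾-on-s q α ∎
      where
      e = φ^ (ℤ.- p) (ε (p ℤ.- n))
      q = ℤ.- p ℤ.- 1ℤ
      reduce : e * ∑[ t < M ] stripped q α (toℕ t) ≈ e * D⁽⁾-on-s q α
      -- For p < n the truncation at `M` may differ from the full sum, but then ε at p-n is zero.
      reduce with n ℤₚ.≤? p
      ... | yes n≤p = *-congˡ (Σℕ.unique (Σℕ.finite M (λ t M≤t → stripped-beyond q α t (ℕₚ.m+n≤o⇒m≤o _ M≤t)
              (≡.subst (ℤ._< + t) (≡.sym (ℤ-identities.-p-1+1≡-p p)) (ℤₚ.≤-<-trans (ℤₚ.neg-mono-≤ n≤p) (ℤₚ.≤-<-trans (-n≤∣n∣ n)
                (ℤ.+<+ (ℕₚ.m+n≤o⇒n≤o (length α) (ℕₚ.≤-trans (ℕₚ.+-monoʳ-≤ (length α) (ℕₚ.n≤1+n _)) M≤t)))))))) (D⁽⁾-on-s-sum q α))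
      ... | no n≰p = trans (*-congʳ e≈0) (trans (zeroˡ _) (sym (trans (*-congʳ e≈0) (zeroˡ _))))
        where
        e≈0 : e ≈ 0#
        e≈0 = reflexive (≡.trans (≡.cong (φ^ (ℤ.- p)) (ε-neg (ℤ-identities.<0-sub (ℤₚ.≰⇒> n≰p)))) (φ^-con (ℤ.- p) K.0#))

-- The s_λ span B: filtration, straightening, induction on degree.

module Spanning {c ℓ} (K : CommutativeRing c ℓ) where
  open ShiftedSymmetric K
  private module K = CommutativeRing K
  open CommutativeRing B-ring hiding (zero)
  open RingTools B-ring hiding (con)
  open RingTools B-ring using () renaming (con to :con)
  open ShiftedSchur K
  open Strips K
  open BTerm using (con; var)
  open BQuot using (con-+; con-*; con-cong)
  open Relation.Binary.Reasoning.Setoid setoid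

  -- The filtration of B in which h*_k has degree k.
  data Deg (d : ℤ) : B → Set (c Level.⊔ ℓ) where
    deg-0  : Deg d 0#
    deg-con : ∀ a → 0ℤ ℤ.≤ d → Deg d (con a)
    deg-var : ∀ {d′ b} k → + suc k ℤ.+ d′ ℤ.≤ d → Deg d′ b → Deg d (var k * b)
    deg-+  : ∀ {a b} → Deg d a → Deg d b → Deg d (a + b)
    deg-≈  : ∀ {a b} → a ≈ b → Deg d a → Deg d b

  deg-mono : ∀ {d e b} → d ℤ.≤ e → Deg d b → Deg e b
  deg-mono d≤e deg-0           = deg-0
  deg-mono d≤e (deg-con a le)  = deg-con a (ℤₚ.≤-trans le d≤e)
  deg-mono d≤e (deg-var k le p) = deg-var k (ℤₚ.≤-trans le d≤e) p
  deg-mono d≤e (deg-+ p q)     = deg-+ (deg-mono d≤e p) (deg-mono d≤e q)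
  deg-mono d≤e (deg-≈ eq p)    = deg-≈ eq (deg-mono d≤e p)

  deg-scale : ∀ {d b} a → Deg d b → Deg d (con a * b)
  deg-scale a deg-0            = deg-≈ (sym (zeroʳ _)) deg-0
  deg-scale a (deg-con x le)   = deg-≈ (con-* a x) (deg-con _ le)
  deg-scale a (deg-var k le p) = deg-≈ (solve 3 (λ x y z → y :* (x :* z) := x :* (y :* z)) refl _ _ _) (deg-var k le (deg-scale a p))
  deg-scale a (deg-+ p q)      = deg-≈ (sym (distribˡ _ _ _)) (deg-+ (deg-scale a p) (deg-scale a q))
  deg-scale a (deg-≈ eq p)     = deg-≈ (*-congˡ eq) (deg-scale a p)

  deg-* : ∀ {d e a b} → Deg d a → Deg e b → Deg (d ℤ.+ e) (a * b)
  deg-* deg-0 q = deg-≈ (sym (zeroˡ _)) deg-0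
  deg-* {d} {e} (deg-con a le) q = deg-mono (≡.subst (ℤ._≤ d ℤ.+ e) (ℤₚ.+-identityˡ e) (ℤₚ.+-monoˡ-≤ e le)) (deg-scale a q)
  deg-* {e = e} (deg-var {d′} k le p) q = deg-≈ (sym (*-assoc _ _ _))
    (deg-var k (ℤₚ.≤-trans (ℤₚ.≤-reflexive (≡.sym (ℤₚ.+-assoc (+ suc k) d′ e))) (ℤₚ.+-monoˡ-≤ e le)) (deg-* p q))
  deg-* (deg-+ p p′) q = deg-≈ (sym (distribʳ _ _ _)) (deg-+ (deg-* p q) (deg-* p′ q))
  deg-* (deg-≈ eq p) q = deg-≈ (*-congʳ eq) (deg-* p q)

  con-neg1 : con (K.- K.1#) ≈ - 1#
  con-neg1 = begin
    con (K.- K.1#)                        ≈⟨ solve 1 (λ x → x := x :+ :con 1ℤ :- :con 1ℤ) refl _ ⟩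
    con (K.- K.1#) + 1# - 1#              ≈⟨ +-congʳ (con-+ _ _) ⟨
    con (K.- K.1# K.+ K.1#) - 1#          ≈⟨ +-congʳ (con-cong (K.-‿inverseˡ _)) ⟩
    0# - 1#                               ≈⟨ +-identityˡ _ ⟩
    - 1#                                  ∎

  con-neg : ∀ b → con (K.- K.1#) * b ≈ - b
  con-neg b = trans (*-congʳ con-neg1) (-1*x≈-x b)

  deg-neg : ∀ {d b} → Deg d b → Deg d (- b)
  deg-neg p = deg-≈ (con-neg _) (deg-scale (K.- K.1#) p)

  deg-fromℕ : ∀ n → Deg 0ℤ (fromℕ n)
  deg-fromℕ zero    = deg-0
  deg-fromℕ (suc n) = deg-+ (deg-con _ ℤₚ.≤-refl) (deg-fromℕ n)

  deg-h* : ∀ k → Deg k (h* k)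
  deg-h* (+ zero)  = deg-con _ ℤₚ.≤-refl
  deg-h* (+ suc n) = deg-≈ (*-identityʳ _) (deg-var n (ℤₚ.≤-reflexive (ℤₚ.+-identityʳ _)) (deg-con K.1# ℤₚ.≤-refl))
  deg-h* -[1+ n ]  = deg-0

  deg-φ : ∀ {d b} → Deg d b → Deg d (φ b)
  deg-φ deg-0            = deg-0
  deg-φ (deg-con a le)   = deg-con a le
  deg-φ (deg-var k le p) = deg-mono le (deg-* (deg-+ (deg-h* (+ suc k))
    (deg-mono (ℤ.+≤+ (ℕₚ.n≤1+n k)) (deg-* (deg-fromℕ k) (deg-h* (+ k))))) (deg-φ p))
  deg-φ (deg-+ p q)      = deg-+ (deg-φ p) (deg-φ q)
  deg-φ (deg-≈ eq p)     = deg-≈ (φ-cong eq) (deg-φ p)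

  deg-φ⁻¹h : ∀ n → Deg (+ n) (φ⁻¹h n)
  deg-φ⁻¹h zero    = deg-con _ ℤₚ.≤-refl
  deg-φ⁻¹h (suc n) = deg-+ (deg-h* (+ suc n)) (deg-neg (deg-mono (ℤ.+≤+ (ℕₚ.n≤1+n n)) (deg-* (deg-fromℕ n) (deg-φ⁻¹h n))))

  deg-φ⁻¹ : ∀ {d b} → Deg d b → Deg d (φ⁻¹ b)
  deg-φ⁻¹ deg-0            = deg-0
  deg-φ⁻¹ (deg-con a le)   = deg-con a le
  deg-φ⁻¹ (deg-var k le p) = deg-mono le (deg-* (deg-φ⁻¹h (suc k)) (deg-φ⁻¹ p))
  deg-φ⁻¹ (deg-+ p q)      = deg-+ (deg-φ⁻¹ p) (deg-φ⁻¹ q)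
  deg-φ⁻¹ (deg-≈ eq p)     = deg-≈ (φ⁻¹-cong eq) (deg-φ⁻¹ p)

  deg-φ^ : ∀ n {d b} → Deg d b → Deg d (φ^ n b)
  deg-φ^ (+ zero)     p = p
  deg-φ^ (+ suc n)    p = deg-φ (deg-φ^ (+ n) p)
  deg-φ^ -[1+ zero ]  p = deg-φ⁻¹ p
  deg-φ^ -[1+ suc n ] p = deg-φ⁻¹ (deg-φ^ -[1+ n ] p)

  -- Degrees are integers, since labels of rows may be negative; this lemma supplies the base of the
  -- induction on degree.
  deg-negative : ∀ {d b} → d ℤ.< 0ℤ → Deg d b → b ≈ 0#
  deg-negative d<0 deg-0            = refl
  deg-negative d<0 (deg-con a le)   = contradiction le (ℤₚ.<⇒≱ d<0)
  deg-negative d<0 (deg-var {d′} k le p) = trans (*-congˡ (deg-negative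
    (ℤₚ.≤-<-trans (≡.subst (ℤ._≤ + suc k ℤ.+ d′) (ℤₚ.+-identityˡ d′) (ℤₚ.+-monoˡ-≤ d′ (ℤ.+≤+ z≤n))) (ℤₚ.≤-<-trans le d<0)) p)) (zeroʳ _)
  deg-negative d<0 (deg-+ p q)      = trans (+-cong (deg-negative d<0 p) (deg-negative d<0 q)) (+-identityˡ 0#)
  deg-negative d<0 (deg-≈ eq p)     = trans (sym eq) (deg-negative d<0 p)

  degree : ∀ b → ∃ λ d → Deg (+ d) b
  degree (con a) = 0 , deg-con a ℤₚ.≤-refl
  degree (var n) = suc n , deg-h* (+ suc n)
  degree (a BTerm.+ b) with degree a | degree b
  ... | d , p | e , q = d ℕ.⊔ e , deg-+ (deg-mono (ℤ.+≤+ (ℕₚ.m≤m⊔n d e)) p) (deg-mono (ℤ.+≤+ (ℕₚ.m≤n⊔m d e)) q)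
  degree (a BTerm.* b) with degree a | degree b
  ... | d , p | e , q = d ℕ.+ e , deg-* p q
  degree (BTerm.- a) with degree a
  ... | d , p = d , deg-neg p

  weight : List ℤ → ℤ
  weight []       = 0ℤ
  weight (c ∷ cs) = c ℤ.+ weight cs

  -- Strictly a bound on the filtration degree. The entry h⟨c⟩ of label a has degree at most a+c, so
  -- a minor has degree at most the sum of its labels and columns.
  Homogeneous : ℤ → Form → Set (c Level.⊔ ℓ)
  Homogeneous d F = ∀ cs → Deg (d ℤ.+ weight cs) (F cs)

  contract-homogeneous : ∀ {d F} → Homogeneous d F → ∀ c → Homogeneous (d ℤ.+ c) (F ∘ (c ∷_))
  contract-homogeneous {d} hF c cs = deg-mono (ℤₚ.≤-reflexive (≡.sym (ℤ-identities.d+c+w≡d+[c+w] c d (weight cs)))) (hF (c ∷ cs))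

  ∧-homogeneous : ∀ a {d F} → Homogeneous d F → Homogeneous (a ℤ.+ d) (row a ∧ F)
  ∧-homogeneous a hF [] = deg-0
  ∧-homogeneous a {d} hF (c ∷ cs) = deg-+
    (deg-mono (ℤₚ.≤-reflexive (ℤ-identities.a+c+[d+w]≡a+d+[c+w] a c d (weight cs))) (deg-* (deg-φ^ c (deg-h* (a ℤ.+ c))) (hF cs)))
    (deg-neg (deg-mono (ℤₚ.≤-reflexive (ℤ-identities.a+[d+c]+w≡a+d+[c+w] a c d (weight cs))) (∧-homogeneous a (contract-homogeneous {d} hF c) cs)))

  minor-homogeneous : ∀ as → Homogeneous (weight as) (minor (map row as))
  minor-homogeneous [] []       = deg-con _ ℤₚ.≤-refl
  minor-homogeneous [] (c ∷ cs) = deg-0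
  minor-homogeneous (a ∷ as)    = ∧-homogeneous a (minor-homogeneous as)

  vector : List ℕ → List ℤ
  vector = map (λ n → + n)

  -- The bound on the first part is carried along because straightening puts a new part in front of
  -- its result.
  data Decreasing (M : ℕ) : List ℕ → Set where
    []  : Decreasing M []
    _∷_ : ∀ {a α} → a ℕ.≤ M → Decreasing a α → Decreasing M (a ∷ α)

  decreasing-mono : ∀ {M N α} → M ℕ.≤ N → Decreasing M α → Decreasing N α
  decreasing-mono M≤N []       = []
  decreasing-mono M≤N (le ∷ p) = ℕₚ.≤-trans le M≤N ∷ p

  decreasing⇒linked : ∀ {M α} → Decreasing M α → Linked ℕ._≥_ α
  decreasing⇒linked []                = []
  decreasing⇒linked (_ ∷ [])          = [-]
  decreasing⇒linked (_ ∷ p@(le ∷ _)) = le ∷ decreasing⇒linked p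

  -- The bound `e` on the size of the partitions lets the spanning statement and the degree
  -- filtration feed each other in one induction.
  data Span (e : ℤ) : B → Set (c Level.⊔ ℓ) where
    span-s : ∀ {M} α → Decreasing M α → + sumℕ α ℤ.≤ e → Span e (s (vector α))
    span-0 : Span e 0#
    span-+ : ∀ {a b} → Span e a → Span e b → Span e (a + b)
    span-scale : ∀ a {b} → Span e b → Span e (con a * b)
    span-≈ : ∀ {a b} → a ≈ b → Span e a → Span e b

  span-mono : ∀ {d e b} → d ℤ.≤ e → Span d b → Span e b
  span-mono d≤e (span-s α p le)  = span-s α p (ℤₚ.≤-trans le d≤e)
  span-mono d≤e span-0           = span-0
  span-mono d≤e (span-+ p q)     = span-+ (span-mono d≤e p) (span-mono d≤e q)
  span-mono d≤e (span-scale a p) = span-scale a (span-mono d≤e p)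
  span-mono d≤e (span-≈ eq p)    = span-≈ eq (span-mono d≤e p)

  span-neg : ∀ {e b} → Span e b → Span e (- b)
  span-neg p = span-≈ (con-neg _) (span-scale (K.- K.1#) p)

  span-fromℕ : ∀ n {e b} → Span e b → Span e (fromℕ n * b)
  span-fromℕ zero    p = span-≈ (sym (zeroˡ _)) span-0
  span-fromℕ (suc n) p = span-≈ (sym (trans (distribʳ _ _ _) (+-congʳ (*-identityˡ _)))) (span-+ p (span-fromℕ n p))

  span-fromℤ : ∀ k {e b} → Span e b → Span e (fromℤ k * b)
  span-fromℤ (+ n)    p = span-fromℕ n p
  span-fromℤ -[1+ n ] p = span-≈ (-‿distribˡ-* _ _) (span-neg (span-fromℕ (suc n) p))

  span-sgn : ∀ n {e b} → Span e b → Span e (sgn n * b)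
  span-sgn zero    p = span-≈ (sym (*-identityˡ _)) p
  span-sgn (suc n) p = span-≈ (sym (sgn-suc n _)) (span-neg (span-sgn n p))

  -- s_(…,k,a,…) = - s_(…,a-1,k+1,…)
  straighten : ∀ o k M α → k ℕ.≤ M → Decreasing (suc M) α →
    (∀ cs → (row (+ k ℤ.- + o) ∧ minor (rows (suc o) (vector α))) cs ≈ 0#) ⊎
    (∃ λ β → Decreasing M β × sumℕ β ≡ k ℕ.+ sumℕ α × length β ≡ suc (length α) ×
      (∃ λ i → ∀ cs → (row (+ k ℤ.- + o) ∧ minor (rows (suc o) (vector α))) cs ≈ sgn i * minor (rows o (vector β)) cs))
  straighten o k M [] k≤M [] = inj₂ (k ∷ [] , k≤M ∷ [] , ≡.refl , ≡.refl , 0 , λ cs → sym (*-identityˡ _))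
  -- The labels k-o and a-(o+1) agree exactly for a = k+1: then two rows are equal. For smaller `a`
  -- the vector is already decreasing, for larger `a` the rows are exchanged.
  straighten o k M (a ∷ α) k≤M (a≤M ∷ p) with ℕₚ.<-cmp (suc k) a
  ... | tri> _ _ (s≤s a≤k) = inj₂ (k ∷ a ∷ α , k≤M ∷ a≤k ∷ p , ≡.refl , ≡.refl , 0 , λ cs → sym (*-identityˡ _))
  ... | tri≈ _ ≡.refl _ = inj₁ λ cs →
    trans (reflexive-cong (λ j → (row j ∧ row (+ suc k ℤ.- + suc o) ∧ minor (rows (suc (suc o)) (vector α))) cs) (ℤ-identities.k-o≡1+k-[1+o] (+ o) (+ k)))
      (∧-self (row (+ suc k ℤ.- + suc o)) _ cs)
  -- After the exchange the old part, lowered by one, stands in front and bounds the rest, while k+1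
  -- is inserted into `α`. The parts of `α` may exceed this bound by one, hence the hypothesis
  -- `Decreasing (suc M)`.
  straighten o k M (suc a ∷ α) k≤M (s≤s a≤M ∷ p) | tri< (s≤s k<a) _ _
    with straighten (suc o) (suc k) a α k<a p
  ... | inj₁ null = inj₁ λ cs → trans (swapped cs)
      (trans (-‿cong (trans (∧-cong (λ _ → refl) null cs) (∧-zero _ cs))) -0#≈0#)
    where
    F = minor (rows (suc (suc o)) (vector α))
    swapped : ∀ cs → (row (+ k ℤ.- + o) ∧ row (+ suc a ℤ.- + suc o) ∧ F) cs ≈ - (row (+ suc a ℤ.- + suc o) ∧ row (+ suc k ℤ.- + suc o) ∧ F) cs
    swapped cs = trans (∧-swap _ _ F cs) (-‿cong (reflexive-cong (λ j → (row (+ suc a ℤ.- + suc o) ∧ row j ∧ F) cs) (ℤ-identities.k-o≡1+k-[1+o] (+ o) (+ k))))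
  ... | inj₂ (β , q , tot , len , i , eq) = inj₂ (a ∷ β , a≤M ∷ q , tot′ , ≡.cong suc len , suc i , λ cs → begin
      (row (+ k ℤ.- + o) ∧ row (+ suc a ℤ.- + suc o) ∧ F) cs
        ≈⟨ ∧-swap (row (+ k ℤ.- + o)) (row (+ suc a ℤ.- + suc o)) F cs ⟩
      - (row (+ suc a ℤ.- + suc o) ∧ row (+ k ℤ.- + o) ∧ F) cs
        ≈⟨ -‿cong (reflexive (≡.cong₂ (λ i j → (row i ∧ row j ∧ F) cs) (≡.sym (ℤ-identities.k-o≡1+k-[1+o] (+ o) (+ a))) (ℤ-identities.k-o≡1+k-[1+o] (+ o) (+ k)))) ⟩
      - (row (+ a ℤ.- + o) ∧ row (+ suc k ℤ.- + suc o) ∧ F) cs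
        ≈⟨ -‿cong (∧-cong (λ _ → refl) (λ ds → trans (eq ds) (sym (+-identityʳ _))) cs) ⟩
      - (row (+ a ℤ.- + o) ∧ (λ ds → sgn i * G ds + 0#)) cs
        ≈⟨ -‿cong (trans (∧-linear (row (+ a ℤ.- + o)) (sgn i) G (λ _ → 0#) cs) (trans (+-congˡ (∧-zero (row (+ a ℤ.- + o)) cs)) (+-identityʳ _))) ⟩
      - (sgn i * (row (+ a ℤ.- + o) ∧ G) cs)
        ≈⟨ sgn-suc i _ ⟨
      sgn (suc i) * (row (+ a ℤ.- + o) ∧ G) cs ∎)
    where
    F = minor (rows (suc (suc o)) (vector α))
    G = minor (rows (suc o) (vector β))
    tot′ : a ℕ.+ sumℕ β ≡ k ℕ.+ suc (a ℕ.+ sumℕ α)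
    tot′ = ≡.trans (≡.cong (a ℕ.+_) tot) (≡.trans (≡.sym (ℕₚ.+-assoc a (suc k) _)) (≡.trans (≡.cong (ℕ._+ sumℕ α)
      (≡.trans (ℕₚ.+-comm a (suc k)) (≡.sym (ℕₚ.+-suc k a)))) (ℕₚ.+-assoc k (suc a) _)))

  -- The offsets in labels and columns cancel place by place, so the degree of s_α is the size of
  -- `α`.
  weight-rows : ∀ o α → weight (labels o (vector α)) ℤ.+ weight (columns o (length α)) ≡ + sumℕ α
  weight-rows o []      = ≡.refl
  weight-rows o (a ∷ α) = ≡.trans (ℤ-identities.a-o+l+[o+c]≡a+[l+c] (+ a) (+ o) (weight (labels (suc o) (vector α))) (weight (columns (suc o) (length α))))
    (≡.cong (λ x → + a ℤ.+ x) (weight-rows (suc o) α))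

  span-s-∷ : ∀ {M} k α → Decreasing M α → Span (+ k ℤ.+ + sumℕ α)
    ((row (+ k ℤ.- 0ℤ) ∧ minor (rows 1 (vector α))) (columns 0 (suc (length α))))
  span-s-∷ {M} k α p with straighten 0 k (k ℕ.⊔ M) α (ℕₚ.m≤m⊔n k M) (decreasing-mono (ℕₚ.m≤n⇒m≤1+n (ℕₚ.m≤n⊔m k M)) p)
  ... | inj₁ null = span-≈ (sym (null (columns 0 (suc (length α))))) span-0
  ... | inj₂ (β , q , tot , len , i , eq) = span-≈
    (trans (*-congˡ (trans (s-minor (vector β)) (reflexive-cong (λ n → minor (rows 0 (vector β)) (columns 0 n))
        (≡.trans (Listₚ.length-map (λ n → + n) β) len)))) (sym (eq (columns 0 (suc (length α))))))
    (span-sgn i (span-s β q (ℤₚ.≤-reflexive (≡.cong +_ tot))))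

  -- The two halves of the induction: `MulBelow n` implies `SpanBelow (suc n)` in `span-step`, and
  -- together they give `MulBelow (suc n)` in `mul-below`.
  SpanBelow MulBelow : ℕ → Set (c Level.⊔ ℓ)
  SpanBelow n = ∀ {d b} → d ℤ.< + n → Deg d b → Span d b
  MulBelow n  = ∀ {d b} k → d ℤ.< + n → Deg d b → Span (k ℤ.+ d) (h* k * b)

  -- The rule for φ removes one power of φ at a time, leaving h*_k and h*_(k-1), neither of higher
  -- degree.
  mul-φ^h : ∀ {n} → MulBelow n → ∀ {d b} j k → d ℤ.< + n → Deg d b → Span (k ℤ.+ d) (φ^ (+ j) (h* k) * b)
  mul-φ^h mul zero k d<n p = mul k d<n p
  mul-φ^h mul {d} {b} (suc j) k d<n p = span-≈ (sym expand)
    (span-+ (mul-φ^h mul j k d<n p)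
      (span-fromℤ (k ℤ.- 1ℤ) (span-mono (ℤₚ.+-monoˡ-≤ d (ℤₚ.i-j≤i k 1ℤ)) (mul-φ^h mul j (k ℤ.- 1ℤ) d<n p))))
    where
    expand : φ^ (+ suc j) (h* k) * b ≈ φ^ (+ j) (h* k) * b + fromℤ (k ℤ.- 1ℤ) * (φ^ (+ j) (h* (k ℤ.- 1ℤ)) * b)
    expand = begin
      φ^ (+ suc j) (h* k) * b
        ≈⟨ *-congʳ (trans (reflexive-cong (λ n → φ^ n (h* k)) (ℤₚ.+-comm 1ℤ (+ j))) (φ^-φ (+ j) (h* k))) ⟩
      φ^ (+ j) (φ (h* k)) * b
        ≈⟨ *-congʳ (trans (φ^-cong (+ j) (φ-h* k)) (trans (reflexive (φ^-+ (+ j) _ _)) (+-congˡ (φ^-scale (+ j) (k ℤ.- 1ℤ) _)))) ⟩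
      (φ^ (+ j) (h* k) + fromℤ (k ℤ.- 1ℤ) * φ^ (+ j) (h* (k ℤ.- 1ℤ))) * b
        ≈⟨ solve 4 (λ x y z b → (x :+ y :* z) :* b := x :* b :+ y :* (z :* b)) refl _ _ _ _ ⟩
      φ^ (+ j) (h* k) * b + fromℤ (k ℤ.- 1ℤ) * (φ^ (+ j) (h* (k ℤ.- 1ℤ)) * b) ∎

  -- Using up a column c ≥ 1 lowers the degree of the cofactor by c, so a total degree below n+1
  -- leaves cofactors of degree below n, to which `MulBelow n` applies.
  span-∧-positive : ∀ {n} → MulBelow n → ∀ k {d F} → Homogeneous d F → ∀ o m → d ℤ.+ weight (columns (suc o) m) ℤ.< + suc n →
    Span (k ℤ.+ (d ℤ.+ weight (columns (suc o) m))) ((row k ∧ F) (columns (suc o) m))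
  span-∧-positive mul k hF o zero    lt = span-0
  span-∧-positive {n} mul k {d} hF o (suc m) lt = span-+
    (span-mono (ℤₚ.≤-reflexive (ℤ-identities.k+c+[d+w]≡k+[d+[c+w]] k (+ suc o) d w)) (mul-φ^h mul (suc o) (k ℤ.+ + suc o) lower (hF (columns (suc (suc o)) m))))
    (span-neg (span-mono (ℤₚ.≤-reflexive (ℤ-identities.k+[d+c+w]≡k+[d+[c+w]] k (+ suc o) d w))
      (span-∧-positive mul k {d ℤ.+ + suc o} (contract-homogeneous {d} hF (+ suc o)) (suc o) m
        (≡.subst (ℤ._< + suc n) (≡.sym (ℤ-identities.d+c+w≡d+[c+w] (+ suc o) d w)) lt))))
    where
    w = weight (columns (suc (suc o)) m)
    lower : d ℤ.+ w ℤ.< + n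
    lower = ≡.subst (ℤ._< + n) (ℤ-identities.d+[c+w]-c≡d+w (+ suc o) d w)
      (ℤₚ.<-≤-trans (ℤₚ.+-monoˡ-< (ℤ.- + suc o) lt) (≡.subst (ℤ._≤ + n) (≡.sym (ℤₚ.[1+m]⊖[1+n]≡m⊖n n o)) (ℤₚ.m⊖n≤m n o)))

  -- h*_k φ(s_α) = s_(k,α) - Σ_{p≥1} (-1)^p h⟨p⟩_k D_p(s_α), where each D_p(s_α) has lower degree than s_α.
  mul-φs : ∀ {n} → MulBelow n → ∀ k {d b} → d ℤ.< + suc n → Span d b → Span (+ k ℤ.+ d) (h* (+ k) * φ b)
  mul-φs mul k d<n (span-+ p q)     = span-≈ (sym (distribˡ _ _ _)) (span-+ (mul-φs mul k d<n p) (mul-φs mul k d<n q))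
  mul-φs mul k d<n span-0           = span-≈ (sym (zeroʳ _)) span-0
  mul-φs mul k d<n (span-scale a p) = span-≈ (solve 3 (λ x y z → x :* (y :* z) := y :* (x :* z)) refl _ _ _) (span-scale a (mul-φs mul k d<n p))
  mul-φs mul k d<n (span-≈ eq p)    = span-≈ (*-congˡ (φ-cong eq)) (mul-φs mul k d<n p)
  mul-φs {n} mul k {d} d<n (span-s α p le) = span-mono (ℤₚ.+-monoʳ-≤ (+ k) le)
    (span-≈ (begin
        (row k′ ∧ F) (0ℤ ∷ columns 1 l) + (row k′ ∧ (F ∘ (0ℤ ∷_))) (columns 1 l)
          ≈⟨ solve 2 (λ x y → x :- y :+ y := x) refl (row k′ 0ℤ * F (columns 1 l)) _ ⟩
        row k′ 0ℤ * F (columns 1 l)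
          ≈⟨ *-cong (reflexive (≡.cong h* (≡.trans (ℤₚ.+-identityʳ k′) (ℤₚ.+-identityʳ (+ k))))) (sym φs) ⟩
        h* (+ k) * φ (s (vector α)) ∎)
      (span-+ (span-s-∷ k α p)
        (span-mono (ℤₚ.≤-reflexive (≡.cong₂ ℤ._+_ (ℤₚ.+-identityʳ (+ k)) size))
          (span-∧-positive mul k′ {W ℤ.+ 0ℤ} hG 0 l (≡.subst (ℤ._< + suc n) (≡.sym size) (ℤₚ.≤-<-trans le d<n))))))
    where
    l = length α
    k′ = + k ℤ.- 0ℤ
    F = minor (rows 1 (vector α))
    W = weight (labels 1 (vector α))
    hG : Homogeneous (W ℤ.+ 0ℤ) (F ∘ (0ℤ ∷_))
    hG = contract-homogeneous {W} (minor-homogeneous (labels 1 (vector α))) 0ℤ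
    size : W ℤ.+ 0ℤ ℤ.+ weight (columns 1 l) ≡ + sumℕ α
    size = ≡.trans (≡.cong (ℤ._+ weight (columns 1 l)) (ℤₚ.+-identityʳ W)) (weight-rows 1 α)
    φs : φ (s (vector α)) ≈ F (columns 1 l)
    φs = trans (φ^-s 1 (vector α)) (reflexive-cong (F ∘ columns 1) (Listₚ.length-map (λ n → + n) α))

  -- Every generator has positive degree, so in var k · b the factor `b` lies in the range of
  -- `MulBelow n`.
  span-step : ∀ {n} → MulBelow n → SpanBelow (suc n)
  span-step mul d<n deg-0           = span-0
  span-step mul d<n (deg-con a le)  = span-≈ (*-identityʳ _) (span-scale a (span-s {M = 0} [] [] le))
  span-step {n} mul {d} d<n (deg-var {d′} k le p) = span-mono le (mul (+ suc k) lower p)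
    where
    lower : d′ ℤ.< + n
    lower = ≡.subst (ℤ._< + n) (cancel (+ suc k) d′)
      (ℤₚ.<-≤-trans (ℤₚ.+-monoˡ-< (ℤ.- + suc k) (ℤₚ.≤-<-trans le d<n)) (≡.subst (ℤ._≤ + n) (≡.sym (ℤₚ.[1+m]⊖[1+n]≡m⊖n n k)) (ℤₚ.m⊖n≤m n k)))
      where
      cancel : ∀ k d → k ℤ.+ d ℤ.- k ≡ d
      cancel k d = ≡.trans (≡.cong (ℤ._- k) (ℤₚ.+-comm k d)) (ℤ-identities.k+c-c≡k d k)
  span-step mul d<n (deg-+ p q)     = span-+ (span-step mul d<n p) (span-step mul d<n q)
  span-step mul d<n (deg-≈ eq p)    = span-≈ eq (span-step mul d<n p)

  -- Since φ⁻¹ preserves degree, φ⁻¹(b) is in the span, and `mul-φs` treats h*_k φ(φ⁻¹ b).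
  mul-below : ∀ n → MulBelow n
  mul-below n -[1+ k ] d<n p = span-≈ (sym (zeroˡ _)) span-0
  mul-below zero (+ k) d<0 p = span-≈ (sym (trans (*-congˡ (deg-negative d<0 p)) (zeroʳ _))) span-0
  mul-below (suc n) (+ k) d<n p = span-≈ (*-congˡ (φ∘φ⁻¹ _))
    (mul-φs (mul-below n) k d<n (span-step (mul-below n) d<n (deg-φ⁻¹ p)))

  spanning : ∀ b → ∃ λ e → Span e b
  spanning b with degree b
  ... | d , p = + d , span-step (mul-below d) (ℤ.+<+ ℕₚ.≤-refl) p

-- The embedding of B in 𝓑 and the powers of z.

module Scalars {c ℓ} (K : CommutativeRing c ℓ) where
  open ShiftedSymmetric K
  private module B = CommutativeRing B-ring
  private module BT = RingTools B-ring
  open CommutativeRing 𝓑-ring hiding (zero)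
  open RingTools 𝓑-ring
  open BTerm using (con)
  open Relation.Binary.Reasoning.Setoid setoid

  ι-cong : ∀ {a b} → a B.≈ b → ι a ≈ ι b
  ι-cong = 𝓑Quot.con-cong

  ι-+ : ∀ a b → ι (a B.+ b) ≈ ι a + ι b
  ι-+ = 𝓑Quot.con-+

  ι-* : ∀ a b → ι (a B.* b) ≈ ι a * ι b
  ι-* = 𝓑Quot.con-*

  ι-neg : ∀ a → ι (B.- a) ≈ - ι a
  ι-neg a = begin
    ι (B.- a)                    ≈⟨ solve 2 (λ x y → x := x :+ y :- y) refl (ι (B.- a)) (ι a) ⟩
    ι (B.- a) + ι a - ι a        ≈⟨ +-congʳ (trans (sym (ι-+ _ _)) (ι-cong (B.-‿inverseˡ a))) ⟩
    0# - ι a                     ≈⟨ +-identityˡ _ ⟩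
    - ι a                        ∎

  ι-fromℕ : ∀ n → ι (BT.fromℕ n) ≈ fromℕ n
  ι-fromℕ zero    = refl
  ι-fromℕ (suc n) = trans (ι-+ _ _) (+-congˡ (ι-fromℕ n))

  ι-fromℤ : ∀ k → ι (BT.fromℤ k) ≈ fromℤ k
  ι-fromℤ (+ n)    = ι-fromℕ n
  ι-fromℤ -[1+ n ] = trans (ι-neg (BT.fromℕ (suc n))) (-‿cong (ι-fromℕ (suc n)))

  ι-sgn : ∀ n → ι (BT.sgn n) ≈ sgn n
  ι-sgn zero    = refl
  ι-sgn (suc n) = trans (ι-* _ _) (*-cong (ι-neg B.1#) (ι-sgn n))

  ι-δ : ∀ i j → ι (BT.δ i j) ≈ δ i j
  ι-δ i j with i ℤₚ.≟ j
  ... | yes _ = refl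
  ... | no _  = refl

  ι-sumℤ : ∀ {f S} → BT.Sumℤ f S → Sumℤ (λ k → ι (f k)) (ι S)
  ι-sumℤ = SumMap.mapℤ B-ring 𝓑-ring ι-cong refl ι-+

  ι-sumℕ : ∀ {f S} → BT.Sumℕ f S → Sumℕ (λ k → ι (f k)) (ι S)
  ι-sumℕ = SumMap.mapℕ B-ring 𝓑-ring ι-cong refl ι-+

  zz⁻¹ : z * z⁻¹ ≈ 1#
  zz⁻¹ = 𝓑Quot.relation z*z⁻¹≈1

  zpow : ℤ → 𝓑
  zpow (+ n)    = z ^ n
  zpow -[1+ n ] = z⁻¹ ^ suc n

  zpow-def : ∀ b m → (b z^ m) ≡ ι b * zpow m
  zpow-def b (+ n)    = ≡.refl
  zpow-def b -[1+ n ] = ≡.refl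

  zpow-suc : ∀ m → zpow (m ℤ.+ 1ℤ) ≈ z * zpow m
  zpow-suc (+ n)        = reflexive-cong (λ k → z ^ k) (ℕₚ.+-comm n 1)
  zpow-suc -[1+ zero ]  = sym (trans (sym (*-assoc _ _ _)) (trans (*-congʳ zz⁻¹) (*-identityˡ _)))
  zpow-suc -[1+ suc n ] = sym (trans (sym (*-assoc _ _ _)) (trans (*-congʳ zz⁻¹) (*-identityˡ _)))

  zpow-pred : ∀ m → zpow (m ℤ.- 1ℤ) ≈ z⁻¹ * zpow m
  zpow-pred (+ zero)  = refl
  zpow-pred (+ suc n) = sym (trans (sym (*-assoc _ _ _)) (trans (*-congʳ (trans (*-comm _ _) zz⁻¹)) (*-identityˡ _)))
  zpow-pred -[1+ n ]  = reflexive-cong (λ k → z⁻¹ ^ suc (suc k)) (ℕₚ.+-identityʳ n)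

-- Expansions of the operators on every element b z^m.

module Operators {c ℓ} (K : CommutativeRing c ℓ) where
  open ShiftedSymmetric K
  open Scalars K
  private module B = CommutativeRing B-ring
  private module BT = RingTools B-ring
  open CommutativeRing 𝓑-ring hiding (zero)
  open RingTools 𝓑-ring hiding (con)
  open ShiftedSchur K
  open Duality K
  open Strips K
  open Spanning K
  open BTerm using (con)
  open Relation.Binary.Reasoning.Setoid setoid

  module Linear {T : 𝓑 → 𝓑} (T-linear : IsLinear T) where
    open LeftModuleMorphisms.IsLeftModuleHomomorphism T-linear public
      using () renaming (⟦⟧-cong to T-cong; +ᴹ-homo to T-+; 0ᴹ-homo to T-0; *ₗ-homo to T-scale)

    module Homogeneous (T-z : ∀ x → T (z * x) ≈ z * T x) (T-z⁻¹ : ∀ x → T (z⁻¹ * x) ≈ z⁻¹ * T x) where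
      private
        power : ∀ y → (∀ x → T (y * x) ≈ y * T x) → ∀ n x → T (x * y ^ n) ≈ T x * y ^ n
        power y h zero    x = trans (T-cong (*-identityʳ x)) (sym (*-identityʳ _))
        power y h (suc n) x = begin
          T (x * (y * y ^ n))    ≈⟨ T-cong (solve 3 (λ x y w → x :* (y :* w) := y :* (x :* w)) refl x y (y ^ n)) ⟩
          T (y * (x * y ^ n))    ≈⟨ trans (h _) (*-congˡ (power y h n x)) ⟩
          y * (T x * y ^ n)      ≈⟨ solve 3 (λ x y w → y :* (x :* w) := x :* (y :* w)) refl (T x) y (y ^ n) ⟩
          T x * (y * y ^ n)      ∎

      T-z^ : ∀ b m → T (b z^ m) ≈ T (ι b) * zpow m
      T-z^ b (+ n)    = power z T-z n (ι b)
      T-z^ b -[1+ n ] = power z⁻¹ T-z⁻¹ (suc n) (ι b)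

  module Expansions {ψ ψ* D D⁽_⁾ : ℤ → 𝓑 → 𝓑} (ops : AreTheOperators ψ ψ* D D⁽_⁾) (m : ℤ) where
    open AreTheOperators ops

    private
      module ψL k   = Linear (ψ-linear k)
      module ψ*L k  = Linear (ψ*-linear k)
      module DL p   = Linear (D-linear p)
      module D⁽⁾L p = Linear (D⁽⁾-linear p)

    ψ-term : 𝓑 → ℤ → ℕ → 𝓑
    ψ-term x k j = sgn j * (ι (h⟨ + j ⟩ (k ℤ.- m ℤ.- 1ℤ)) * (z * D (+ j) x))

    ψ*-term : 𝓑 → ℤ → ℤ → 𝓑
    ψ*-term x k p = ι (φ^ (ℤ.- p) (ε (p ℤ.- (k ℤ.- m)))) * (z⁻¹ * D⁽ ℤ.- p ℤ.- 1ℤ ⁾ x)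

    -- Everything used later about the operators at `x`, in a form closed under linear combinations,
    -- so that spanning carries it from the s_λ z^m to all of 𝓑^(m). `bound` serves for all `k` at
    -- once.
    record Expands (x : 𝓑) : Set (c Level.⊔ ℓ) where
      field
        bound      : ℕ
        D-high     : ∀ p → bound ℕ.≤ p → D (+ p) x ≈ 0#
        D-negative : ∀ p → D -[1+ p ] x ≈ 0#
        D⁽⁾-low    : ∀ p → bound ℕ.≤ p → D⁽ -[1+ p ] ⁾ x ≈ 0#
        D⁽⁾-nonnegative : ∀ p → D⁽ + p ⁾ x ≈ 0#
        ψ-expands  : ∀ k → Sumℕ (ψ-term x k) (ψ k x)
        ψ*-expands : ∀ k → Sumℤ (ψ*-term x k) (ψ* k x)
    open Expands

    expands-≈ : ∀ {x y} → x ≈ y → Expands x → Expands y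
    expands-≈ x≈y E = record
      { bound = bound E
      ; D-high = λ p le → trans (DL.T-cong (+ p) (sym x≈y)) (D-high E p le)
      ; D-negative = λ p → trans (DL.T-cong -[1+ p ] (sym x≈y)) (D-negative E p)
      ; D⁽⁾-low = λ p le → trans (D⁽⁾L.T-cong -[1+ p ] (sym x≈y)) (D⁽⁾-low E p le)
      ; D⁽⁾-nonnegative = λ p → trans (D⁽⁾L.T-cong (+ p) (sym x≈y)) (D⁽⁾-nonnegative E p)
      ; ψ-expands = λ k → Σℕ.respʳ (ψL.T-cong k x≈y)
          (Σℕ.respˡ (λ j → *-congˡ (*-congˡ (*-congˡ (DL.T-cong (+ j) x≈y)))) (ψ-expands E k))
      ; ψ*-expands = λ k → Σℤ.respʳ (ψ*L.T-cong k x≈y)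
          (Σℤ.respˡ (λ p → *-congˡ (*-congˡ (D⁽⁾L.T-cong (ℤ.- p ℤ.- 1ℤ) x≈y))) (ψ*-expands E k))
      }

    expands-0 : Expands 0#
    expands-0 = record
      { bound = 0
      ; D-high = λ p _ → DL.T-0 (+ p)
      ; D-negative = λ p → DL.T-0 -[1+ p ]
      ; D⁽⁾-low = λ p _ → D⁽⁾L.T-0 -[1+ p ]
      ; D⁽⁾-nonnegative = λ p → D⁽⁾L.T-0 (+ p)
      ; ψ-expands = λ k → Σℕ.respʳ (sym (ψL.T-0 k)) (Σℕ.finite 0 λ j _ →
          trans (*-congˡ (*-congˡ (*-congˡ (DL.T-0 (+ j))))) (solve 3 (λ s h z → s :* (h :* (z :* :con 0ℤ)) := :con 0ℤ) refl _ _ _))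
      ; ψ*-expands = λ k → Σℤ.respʳ (sym (ψ*L.T-0 k)) (Σℤ.zero-sum λ p →
          trans (*-congˡ (*-congˡ (D⁽⁾L.T-0 (ℤ.- p ℤ.- 1ℤ)))) (solve 2 (λ h z → h :* (z :* :con 0ℤ) := :con 0ℤ) refl _ _))
      }
      where open RingTools 𝓑-ring using () renaming (con to :con)

    expands-+ : ∀ {x y} → Expands x → Expands y → Expands (x + y)
    expands-+ {x} {y} E F = record
      { bound = bound E ℕ.⊔ bound F
      ; D-high = λ p le → vanish (DL.T-+ (+ p) x y) (D-high E p (ℕₚ.≤-trans (ℕₚ.m≤m⊔n _ _) le)) (D-high F p (ℕₚ.≤-trans (ℕₚ.m≤n⊔m _ _) le))
      ; D-negative = λ p → vanish (DL.T-+ -[1+ p ] x y) (D-negative E p) (D-negative F p)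
      ; D⁽⁾-low = λ p le → vanish (D⁽⁾L.T-+ -[1+ p ] x y) (D⁽⁾-low E p (ℕₚ.≤-trans (ℕₚ.m≤m⊔n _ _) le)) (D⁽⁾-low F p (ℕₚ.≤-trans (ℕₚ.m≤n⊔m _ _) le))
      ; D⁽⁾-nonnegative = λ p → vanish (D⁽⁾L.T-+ (+ p) x y) (D⁽⁾-nonnegative E p) (D⁽⁾-nonnegative F p)
      ; ψ-expands = λ k → Σℕ.respʳ (sym (ψL.T-+ k x y)) (Σℕ.respˡ (λ j → sym (trans (*-congˡ (*-congˡ (*-congˡ (DL.T-+ (+ j) x y))))
          (solve 5 (λ s h z a b → s :* (h :* (z :* (a :+ b))) := s :* (h :* (z :* a)) :+ s :* (h :* (z :* b))) refl _ _ _ _ _)))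
          (Σℕ.plus (ψ-expands E k) (ψ-expands F k)))
      ; ψ*-expands = λ k → Σℤ.respʳ (sym (ψ*L.T-+ k x y)) (Σℤ.respˡ (λ p → sym (trans (*-congˡ (*-congˡ (D⁽⁾L.T-+ (ℤ.- p ℤ.- 1ℤ) x y)))
          (solve 4 (λ h z a b → h :* (z :* (a :+ b)) := h :* (z :* a) :+ h :* (z :* b)) refl _ _ _ _)))
          (Σℤ.plus (ψ*-expands E k) (ψ*-expands F k)))
      }
      where
      vanish : ∀ {u v w} → u ≈ v + w → v ≈ 0# → w ≈ 0# → u ≈ 0#
      vanish eq v≈0 w≈0 = trans eq (trans (+-cong v≈0 w≈0) (+-identityˡ 0#))

    expands-scale : ∀ a {x} → Expands x → Expands (ι (con a) * x)
    expands-scale a {x} E = record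
      { bound = bound E
      ; D-high = λ p le → vanish (DL.T-scale (+ p) a x) (D-high E p le)
      ; D-negative = λ p → vanish (DL.T-scale -[1+ p ] a x) (D-negative E p)
      ; D⁽⁾-low = λ p le → vanish (D⁽⁾L.T-scale -[1+ p ] a x) (D⁽⁾-low E p le)
      ; D⁽⁾-nonnegative = λ p → vanish (D⁽⁾L.T-scale (+ p) a x) (D⁽⁾-nonnegative E p)
      ; ψ-expands = λ k → Σℕ.respʳ (sym (ψL.T-scale k a x)) (Σℕ.respˡ (λ j → sym (trans (*-congˡ (*-congˡ (*-congˡ (DL.T-scale (+ j) a x))))
          (solve 5 (λ s h z a b → s :* (h :* (z :* (a :* b))) := a :* (s :* (h :* (z :* b)))) refl _ _ _ _ _)))
          (Σℕ.scale _ (ψ-expands E k)))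
      ; ψ*-expands = λ k → Σℤ.respʳ (sym (ψ*L.T-scale k a x)) (Σℤ.respˡ (λ p → sym (trans (*-congˡ (*-congˡ (D⁽⁾L.T-scale (ℤ.- p ℤ.- 1ℤ) a x)))
          (solve 4 (λ h z a b → h :* (z :* (a :* b)) := a :* (h :* (z :* b))) refl _ _ _ _)))
          (Σℤ.scale _ (ψ*-expands E k)))
      }
      where
      vanish : ∀ {u v} → u ≈ ι (con a) * v → v ≈ 0# → u ≈ 0#
      vanish eq v≈0 = trans eq (trans (*-congˡ v≈0) (zeroʳ _))

    D-s : ∀ p (lam : Partition) → let α = Partition.vector lam in D p (s α z^ m) ≈ ι (D-on-s p α) * zpow m
    D-s p lam = trans (DL.Homogeneous.T-z^ p (D-z p) (D-z⁻¹ p) _ m) (*-congʳ (D-basis p lam))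

    -- Homogeneity moves z^m out; then the specified sum and `D⁽⁾-on-s-sum` are sums of the same
    -- family.
    D⁽⁾-s : ∀ p (lam : Partition) → let α = Partition.vector lam in D⁽ p ⁾ (s α z^ m) ≈ ι (D⁽⁾-on-s p α) * zpow m
    D⁽⁾-s p lam = trans (D⁽⁾L.Homogeneous.T-z^ p (D⁽⁾-z p) (D⁽⁾-z⁻¹ p) _ m) (*-congʳ (Σℕ.unique (summed (D⁽⁾-basis p lam))
      (Σℕ.respˡ (λ t → trans (ι-* _ _) (trans (*-cong (ι-sgn t) (ι-* _ _)) (sym (*-assoc _ _ _)))) (ι-sumℕ (D⁽⁾-on-s-sum p α)))))
      where α = Partition.vector lam

    private
      arrange₁ : ∀ z w s h d → z * w * (s * (h * d)) ≈ s * (h * (z * (d * w)))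
      arrange₁ = solve 5 (λ z w s h d → z :* w :* (s :* (h :* d)) := s :* (h :* (z :* (d :* w)))) refl

      arrange₂ : ∀ z w s d x → z * w * (s * (d * x)) ≈ s * d * (x * (z * w))
      arrange₂ = solve 5 (λ z w s d x → z :* w :* (s :* (d :* x)) := s :* d :* (x :* (z :* w))) refl

      arrange₃ : ∀ z w s d → z * w * (s * d) ≈ s * (z * (d * w))
      arrange₃ = solve 4 (λ z w s d → z :* w :* (s :* d) := s :* (z :* (d :* w))) refl

    ψ-expands-s : ∀ lam k → Sumℕ (ψ-term (s (Partition.vector lam) z^ m) k) (ψ k (s (Partition.vector lam) z^ m))
    ψ-expands-s lam k = Σℕ.respʳ value (Σℕ.respˡ term (Σℕ.scale (z * zpow m) (ι-sumℕ (s-∷-sum k′ α))))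
      where
      α = Partition.vector lam
      k′ = k ℤ.- m ℤ.- 1ℤ
      value : z * zpow m * ι (s (k′ ∷ α)) ≈ ψ k (s α z^ m)
      value = sym (trans (ψ-basis k lam m) (trans (reflexive (zpow-def (s (k′ ∷ α)) (m ℤ.+ 1ℤ)))
        (trans (*-congˡ (zpow-suc m)) (*-comm (ι (s (k′ ∷ α))) (z * zpow m)))))
      term : ∀ j → z * zpow m * ι (BT.sgn j B.* (h⟨ + j ⟩ k′ B.* D-on-s (+ j) α)) ≈ ψ-term (s α z^ m) k j
      term j = begin
        z * zpow m * ι (BT.sgn j B.* (h B.* d))
          ≈⟨ *-congˡ {z * zpow m} (trans (ι-* (BT.sgn j) (h B.* d)) (*-cong (ι-sgn j) (ι-* h d))) ⟩
        z * zpow m * (sgn j * (ι h * ι d))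
          ≈⟨ arrange₁ z (zpow m) (sgn j) (ι h) (ι d) ⟩
        sgn j * (ι h * (z * (ι d * zpow m)))
          ≈⟨ *-congˡ {sgn j} (*-congˡ {ι h} (*-congˡ {z} (D-s (+ j) lam))) ⟨
        sgn j * (ι h * (z * D (+ j) (s α z^ m))) ∎
        where
        h = h⟨ + j ⟩ k′
        d = D-on-s (+ j) α

    ψ*-expands-s : ∀ lam k → Sumℤ (ψ*-term (s (Partition.vector lam) z^ m) k) (ψ* k (s (Partition.vector lam) z^ m))
    ψ*-expands-s lam k = Σℤ.respʳ (Σℕ.unique (Σℕ.respˡ termℕ (Σℕ.scale (z⁻¹ * zpow m) (ι-sumℕ (proj₁ (proj₂ expansion))))) (summed (ψ*-basis k lam m)))
        (Σℤ.respˡ termℤ (Σℤ.scale (z⁻¹ * zpow m) (ι-sumℤ (proj₂ (proj₂ expansion)))))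
      where
      α = Partition.vector lam
      k′ = k ℤ.- m ℤ.- 1ℤ
      expansion = ψ*-expand k′ α
      termℕ : ∀ t → z⁻¹ * zpow m * ι (selected k′ α t) ≈ sgn t * δ k′ (part α t ℤ.- + suc t) * (s (strip t α) z^ (m ℤ.- 1ℤ))
      termℕ t = begin
        z⁻¹ * zpow m * ι (BT.sgn t B.* (d B.* x))
          ≈⟨ *-congˡ {z⁻¹ * zpow m} (trans (ι-* (BT.sgn t) (d B.* x)) (*-cong (ι-sgn t) (trans (ι-* d x) (*-congʳ (ι-δ k′ i))))) ⟩
        z⁻¹ * zpow m * (sgn t * (δ k′ i * ι x))
          ≈⟨ arrange₂ z⁻¹ (zpow m) (sgn t) (δ k′ i) (ι x) ⟩
        sgn t * δ k′ i * (ι x * (z⁻¹ * zpow m))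
          ≈⟨ *-congˡ {sgn t * δ k′ i} (trans (reflexive (zpow-def x (m ℤ.- 1ℤ))) (*-congˡ {ι x} (zpow-pred m))) ⟨
        sgn t * δ k′ i * (x z^ (m ℤ.- 1ℤ)) ∎
        where
        i = part α t ℤ.- + suc t
        d = BT.δ k′ i
        x = s (strip t α)
      termℤ : ∀ p → z⁻¹ * zpow m * ι (φ^ (ℤ.- p) (ε (p ℤ.- (k′ ℤ.+ 1ℤ))) B.* D⁽⁾-on-s (ℤ.- p ℤ.- 1ℤ) α) ≈ ψ*-term (s α z^ m) k p
      termℤ p = begin
        z⁻¹ * zpow m * ι (φ^ (ℤ.- p) (ε (p ℤ.- (k′ ℤ.+ 1ℤ))) B.* d)
          ≈⟨ reflexive-cong (λ i → z⁻¹ * zpow m * ι (φ^ (ℤ.- p) (ε (p ℤ.- i)) B.* d)) (ℤ-identities.k-c+c≡k (k ℤ.- m) 1ℤ) ⟩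
        z⁻¹ * zpow m * ι (e B.* d)
          ≈⟨ *-congˡ {z⁻¹ * zpow m} (ι-* e d) ⟩
        z⁻¹ * zpow m * (ι e * ι d)
          ≈⟨ arrange₃ z⁻¹ (zpow m) (ι e) (ι d) ⟩
        ι e * (z⁻¹ * (ι d * zpow m))
          ≈⟨ *-congˡ {ι e} (*-congˡ {z⁻¹} (D⁽⁾-s (ℤ.- p ℤ.- 1ℤ) lam)) ⟨
        ι e * (z⁻¹ * D⁽ ℤ.- p ℤ.- 1ℤ ⁾ (s α z^ m)) ∎
        where
        e = φ^ (ℤ.- p) (ε (p ℤ.- (k ℤ.- m)))
        d = D⁽⁾-on-s (ℤ.- p ℤ.- 1ℤ) α

    expands-s : ∀ lam → Expands (s (Partition.vector lam) z^ m)
    expands-s lam = record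
      { bound = suc (length α) ℕ.⊔ P
      ; D-high = λ p le → vanish (D-s (+ p) lam) (D-on-s-vanish p α (ℕₚ.≤-trans (ℕₚ.m≤m⊔n _ P) le))
      ; D-negative = λ p → vanish (D-s -[1+ p ] lam) B.refl
      ; D⁽⁾-low = λ p le → vanish (D⁽⁾-s -[1+ p ] lam) (P-bound p (ℕₚ.≤-trans (ℕₚ.m≤n⊔m (suc (length α)) P) le))
      ; D⁽⁾-nonnegative = λ p → vanish (D⁽⁾-s (+ p) lam) (D⁽⁾-on-s-nonnegative p α)
      ; ψ-expands = ψ-expands-s lam
      ; ψ*-expands = ψ*-expands-s lam
      }
      where
      α = Partition.vector lam
      P = proj₁ (D⁽⁾-on-s-vanish α)
      P-bound = proj₂ (D⁽⁾-on-s-vanish α)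
      vanish : ∀ {u b} → u ≈ ι b * zpow m → b B.≈ B.0# → u ≈ 0#
      vanish eq b≈0 = trans eq (trans (*-congʳ (ι-cong b≈0)) (zeroˡ _))

    -- Each way of forming an element of the span is matched by a closure property of `Expands`.
    expands-span : ∀ {e b} → Span e b → Expands (b z^ m)
    expands-span (span-s α dec _)  = expands-s (partition α (decreasing⇒linked dec))
    expands-span span-0            = expands-≈ (sym (trans (reflexive (zpow-def B.0# m)) (zeroˡ _))) expands-0
    expands-span (span-+ {a} {b} p q) = expands-≈ eq (expands-+ (expands-span p) (expands-span q))
      where
      eq : (a z^ m) + (b z^ m) ≈ (a B.+ b z^ m)
      eq = trans (+-cong (reflexive (zpow-def a m)) (reflexive (zpow-def b m))) (trans (sym (distribʳ _ _ _))
        (trans (*-congʳ (sym (ι-+ a b))) (reflexive (≡.sym (zpow-def (a B.+ b) m)))))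
    expands-span (span-scale a {b} p) = expands-≈ eq (expands-scale a (expands-span p))
      where
      eq : ι (con a) * (b z^ m) ≈ (con a B.* b z^ m)
      eq = trans (*-congˡ (reflexive (zpow-def b m))) (trans (sym (*-assoc _ _ _))
        (trans (*-congʳ (sym (ι-* (con a) b))) (reflexive (≡.sym (zpow-def (con a B.* b) m)))))
    expands-span (span-≈ {a} {b} a≈b p) = expands-≈ (trans (reflexive (zpow-def a m)) (trans (*-congʳ (ι-cong a≈b)) (reflexive (≡.sym (zpow-def b m)))))
      (expands-span p)

    expands : ∀ b → Expands (b z^ m)
    expands b = expands-span (proj₂ (spanning b))

-- Shifted powers over an abstract ring with invertible linear factors.

module Products {c ℓ} (A : CommutativeRing c ℓ) where
  open CommutativeRing A using (Carrier; _*_; 1#)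

  ∏ : ℕ → (ℕ → Carrier) → Carrier
  ∏ zero    f = 1#
  ∏ (suc n) f = ∏ n f * f n

  shift : Affine → ℤ → Affine
  shift (u+ a)  j = u+ (a ℤ.+ j)
  shift (-u+ a) j = -u+ (a ℤ.+ j)

-- `L` and `L⁻¹` stay abstract because exchanging them turns (x|k) into 1/(x|k); all laws are thus
-- proved once for both.
module ShiftedPowers {c ℓ} (A : CommutativeRing c ℓ) (L L⁻¹ : Affine → CommutativeRing.Carrier A)
    (inverse : ∀ x → CommutativeRing._≈_ A (CommutativeRing._*_ A (L x) (L⁻¹ x)) (CommutativeRing.1# A)) where
  open CommutativeRing A hiding (zero)
  open Products A
  private module T = RingTools A

  poch : Affine → ℤ → Carrier
  poch x (+ k)    = ∏ k       λ j → L   (shift x (ℤ.- + j))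
  poch x -[1+ k ] = ∏ (suc k) λ j → L⁻¹ (shift x (+ suc j))

  cancel : ∀ f x → f ≈ f * L⁻¹ x * L x
  cancel f x = trans (sym (*-identityʳ f)) (trans (*-cong (refl {f}) (sym (inverse x)))
    (T.solve 3 (λ f g h → f T.:* (g T.:* h) T.:= f T.:* h T.:* g) refl f (L x) (L⁻¹ x)))

  -- One rule (x|k+1) = (x|k)(x-k) for both signs of k: for negative `k` the new factor cancels the
  -- last reciprocal.
  step : ∀ x k → poch x (ℤ.suc k) ≈ poch x k * L (shift x (ℤ.- k))
  step x (+ n)        = refl
  step x -[1+ zero ]  = cancel 1# (shift x 1ℤ)
  step x -[1+ suc n ] = cancel (poch x -[1+ n ]) (shift x (+ suc (suc n)))

  step-back : ∀ x k → poch x k ≈ poch x (ℤ.suc k) * L⁻¹ (shift x (ℤ.- k))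
  step-back x k = trans (cancel (poch x k) y) (trans
    (T.solve 3 (λ f g h → f T.:* h T.:* g T.:= f T.:* g T.:* h) refl (poch x k) (L y) (L⁻¹ y))
    (*-cong (sym (step x k)) (refl {L⁻¹ y})))
    where y = shift x (ℤ.- k)

  shifted : ∀ x m k → shift x (ℤ.- (k ℤ.+ m)) ≡ shift (shift x (ℤ.- m)) (ℤ.- k)
  shifted (u+ a)  m k = ≡.cong u+_ (ℤ-identities.a+-[k+m]≡a+-m+-k a m k)
  shifted (-u+ a) m k = ≡.cong -u+_ (ℤ-identities.a+-[k+m]≡a+-m+-k a m k)

  Additive : Affine → ℤ → ℤ → Set ℓ
  Additive x m k = poch x (k ℤ.+ m) ≈ poch x m * poch (shift x (ℤ.- m)) k

  up : ∀ x m k → Additive x m k → Additive x m (ℤ.suc k)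
  up x m k p = trans (T.reflexive-cong (poch x) (ℤ-identities.1+k+m≡1+[k+m] k m)) (trans (step x (k ℤ.+ m)) (trans
    (*-cong p (T.reflexive-cong L (shifted x m k))) (trans (*-assoc _ _ _) (*-cong (refl {poch x m}) (sym (step (shift x (ℤ.- m)) k))))))

  down : ∀ x m k → Additive x m (ℤ.suc k) → Additive x m k
  down x m k p = trans (step-back x (k ℤ.+ m)) (trans (*-cong (trans (T.reflexive-cong (poch x) (≡.sym (ℤ-identities.1+k+m≡1+[k+m] k m))) p) (T.reflexive-cong L⁻¹ (shifted x m k)))
    (trans (*-assoc _ _ _) (*-cong (refl {poch x m}) (sym (step-back (shift x (ℤ.- m)) k)))))

  additive : ∀ x m k → Additive x m k
  additive x m (+ zero)     = trans (T.reflexive-cong (poch x) (ℤₚ.+-identityˡ m)) (sym (*-identityʳ _))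
  additive x m (+ suc k)    = up x m (+ k) (additive x m (+ k))
  additive x m -[1+ zero ]  = down x m -1ℤ (additive x m 0ℤ)
  additive x m -[1+ suc k ] = down x m -[1+ suc k ] (additive x m -[1+ k ])

-- Shifted powers as Laurent series, and infinite sums of their multiples.

module Pochhammer {c ℓ} (R : CommutativeRing c ℓ) where
  open CommutativeRing R hiding (zero)
  open RingTools R
  open LaurentSeries R
  open LaurentRing R
  private module L = RingTools laurentRing

  shift-shift : ∀ x i j → shift (shift x i) j ≡ shift x (i ℤ.+ j)
  shift-shift (u+ a)  i j = ≡.cong u+_ (ℤₚ.+-assoc a i j)
  shift-shift (-u+ a) i j = ≡.cong -u+_ (ℤₚ.+-assoc a i j)

  linear-shift : ∀ x b → linear (shift x b) ≋ linear x ⊞ const (fromℤ b)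
  linear-shift (u+ a) b = same-top λ
    { zero → sym (+-identityʳ _) ; (suc zero) → fromℤ-+ a b ; (suc (suc i)) → sym (+-identityˡ _) }
  linear-shift (-u+ a) b = same-top λ
    { zero → sym (+-identityʳ _) ; (suc zero) → fromℤ-+ a b ; (suc (suc i)) → sym (+-identityˡ _) }

  linear-neg : ∀ a → linear (-u+ (ℤ.- a)) ≋ ⊟ linear (u+ a)
  linear-neg a = same-top λ { zero → refl ; (suc zero) → fromℤ-neg a ; (suc (suc i)) → sym -0#≈0# }

  linear⁻¹-neg : ∀ a → linear⁻¹ (-u+ (ℤ.- a)) ≋ ⊟ linear⁻¹ (u+ a)
  linear⁻¹-neg a = same-top λ i → refl

  private
    zeros-sum : ∀ n (b : ℕ → Carrier) → ∑[ i < n ] (0# * b (toℕ i)) ≈ 0#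
    zeros-sum n b = ∑-zero n {λ i → 0# * b i} (λ i → zeroˡ (b i))

    -- (1 + y u⁻¹)(1 + x u⁻¹ + x² u⁻² + ⋯) for y = −x.
    geometric : ∀ {w y x} (a b : ℕ → Carrier) → a 0 ≡ w → a 1 ≡ y → (∀ i → a (suc (suc i)) ≡ 0#) → (∀ i → b i ≈ w * x ^ i) →
      w * w ≈ 1# → y ≈ - (w * x) → (1ℤ ▷ a) ✶ (-1ℤ ▷ b) ≋ const 1#
    geometric {w} {y} {x} a b ≡.refl ≡.refl a-rest b-is ww y≈ = same-top coefficient
      where
      coefficient : ∀ n → ∑[ i < suc n ] (a (toℕ i) * b (n ∸ toℕ i)) ≈ Laurent.coeffs (const 1#) n
      coefficient zero = trans (+-identityʳ _) (trans (*-congˡ (trans (b-is 0) (*-identityʳ _))) ww)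
      coefficient (suc n) = trans (+-cong (*-congˡ (b-is (suc n))) (+-cong (*-cong y≈ (b-is n))
          (trans (∑-cong n {λ i → a (suc (suc i)) * b (n ∸ suc i)} {λ i → 0# * b (n ∸ suc i)} (λ i → *-congʳ (reflexive (a-rest i)))) (zeros-sum n (λ i → b (n ∸ suc i))))))
        (solve 3 (λ w x p → w :* (w :* (x :* p)) :+ ((:- (w :* x)) :* (w :* p) :+ con 0ℤ) := con 0ℤ) refl w x (x ^ n))

  linear-inverse : ∀ x → linear x ✶ linear⁻¹ x ≋ const 1#
  linear-inverse (u+ a) = geometric {1#} {fromℤ a} {fromℤ (ℤ.- a)} (Laurent.coeffs (linear (u+ a))) (Laurent.coeffs (linear⁻¹ (u+ a))) ≡.refl ≡.refl (λ i → ≡.refl) (λ i → sym (*-identityˡ _)) (*-identityˡ 1#)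
    (trans (trans (sym (-‿involutive _)) (-‿cong (sym (fromℤ-neg a)))) (-‿cong (sym (*-identityˡ _))))
  linear-inverse (-u+ a) = geometric { - 1#} {fromℤ a} {fromℤ a} (Laurent.coeffs (linear (-u+ a))) (Laurent.coeffs (linear⁻¹ (-u+ a))) ≡.refl ≡.refl (λ i → ≡.refl) (λ i → sym (-1*x≈-x _))
    (solve 0 (:- con 1ℤ :* :- con 1ℤ := con 1ℤ) refl)
    (solve 1 (λ x → x := :- (:- con 1ℤ :* x)) refl (fromℤ a))

  private
    inverse′ : ∀ x → linear⁻¹ x ✶ linear x ≋ const 1#
    inverse′ x = ≋-trans (✶-comm (linear⁻¹ x) (linear x)) (linear-inverse x)

    module P   = ShiftedPowers laurentRing linear linear⁻¹ linear-inverse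
    module P⁻¹ = ShiftedPowers laurentRing linear⁻¹ linear inverse′
    module Π   = Products laurentRing

    shift≡ : ∀ x i → Π.shift x i ≡ shift x i
    shift≡ (u+ a)  i = ≡.refl
    shift≡ (-u+ a) i = ≡.refl

    ∏-cong : ∀ n {f g : ℕ → Laurent} → (∀ i → f i ≡ g i) → Π.∏ n f ≡ ∏ n g
    ∏-cong zero    eq = ≡.refl
    ∏-cong (suc n) eq = ≡.cong₂ _✶_ (∏-cong n eq) (eq n)

    ⟨⟩-poch : ∀ x k → P.poch x k ≡ ⟨ x ∣ k ⟩
    ⟨⟩-poch x (+ k)    = ∏-cong k       λ i → ≡.cong linear   (shift≡ x (ℤ.- + i))
    ⟨⟩-poch x -[1+ k ] = ∏-cong (suc k) λ i → ≡.cong linear⁻¹ (shift≡ x (+ suc i))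

    1/⟨⟩-poch : ∀ x k → P⁻¹.poch x k ≡ 1/⟨ x ∣ k ⟩
    1/⟨⟩-poch x (+ k)    = ∏-cong k       λ i → ≡.cong linear⁻¹ (shift≡ x (ℤ.- + i))
    1/⟨⟩-poch x -[1+ k ] = ∏-cong (suc k) λ i → ≡.cong linear   (shift≡ x (+ suc i))

  ⟨⟩-suc : ∀ x k → ⟨ x ∣ ℤ.suc k ⟩ ≋ ⟨ x ∣ k ⟩ ✶ linear (shift x (ℤ.- k))
  ⟨⟩-suc x k = ≡.subst₂ _≋_ (⟨⟩-poch x (ℤ.suc k)) (≡.cong₂ (λ f y → f ✶ linear y) (⟨⟩-poch x k) (shift≡ x (ℤ.- k))) (P.step x k)

  ⟨⟩-pred : ∀ x k → ⟨ x ∣ k ⟩ ≋ ⟨ x ∣ ℤ.suc k ⟩ ✶ linear⁻¹ (shift x (ℤ.- k))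
  ⟨⟩-pred x k = ≡.subst₂ _≋_ (⟨⟩-poch x k) (≡.cong₂ (λ f y → f ✶ linear⁻¹ y) (⟨⟩-poch x (ℤ.suc k)) (shift≡ x (ℤ.- k))) (P.step-back x k)

  1/⟨⟩-suc : ∀ x k → 1/⟨ x ∣ ℤ.suc k ⟩ ≋ 1/⟨ x ∣ k ⟩ ✶ linear⁻¹ (shift x (ℤ.- k))
  1/⟨⟩-suc x k = ≡.subst₂ _≋_ (1/⟨⟩-poch x (ℤ.suc k)) (≡.cong₂ (λ f y → f ✶ linear⁻¹ y) (1/⟨⟩-poch x k) (shift≡ x (ℤ.- k))) (P⁻¹.step x k)

  1/⟨⟩-pred : ∀ x k → 1/⟨ x ∣ k ⟩ ≋ 1/⟨ x ∣ ℤ.suc k ⟩ ✶ linear (shift x (ℤ.- k))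
  1/⟨⟩-pred x k = ≡.subst₂ _≋_ (1/⟨⟩-poch x k) (≡.cong₂ (λ f y → f ✶ linear y) (1/⟨⟩-poch x (ℤ.suc k)) (shift≡ x (ℤ.- k))) (P⁻¹.step-back x k)

  ⟨⟩-+ : ∀ x m k → ⟨ x ∣ k ℤ.+ m ⟩ ≋ ⟨ x ∣ m ⟩ ✶ ⟨ shift x (ℤ.- m) ∣ k ⟩
  ⟨⟩-+ x m k = ≡.subst₂ _≋_ (⟨⟩-poch x (k ℤ.+ m)) (≡.cong₂ _✶_ (⟨⟩-poch x m)
    (≡.trans (≡.cong (λ y → P.poch y k) (shift≡ x (ℤ.- m))) (⟨⟩-poch (shift x (ℤ.- m)) k))) (P.additive x m k)

  1/⟨⟩-+ : ∀ x m k → 1/⟨ x ∣ k ℤ.+ m ⟩ ≋ 1/⟨ x ∣ m ⟩ ✶ 1/⟨ shift x (ℤ.- m) ∣ k ⟩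
  1/⟨⟩-+ x m k = ≡.subst₂ _≋_ (1/⟨⟩-poch x (k ℤ.+ m)) (≡.cong₂ _✶_ (1/⟨⟩-poch x m)
    (≡.trans (≡.cong (λ y → P⁻¹.poch y k) (shift≡ x (ℤ.- m))) (1/⟨⟩-poch (shift x (ℤ.- m)) k))) (P⁻¹.additive x m k)

  private
    top-linear : ∀ x → Laurent.top (linear x) ≡ 1ℤ
    top-linear (u+ a)  = ≡.refl
    top-linear (-u+ a) = ≡.refl

    top-linear⁻¹ : ∀ x → Laurent.top (linear⁻¹ x) ≡ -1ℤ
    top-linear⁻¹ (u+ a)  = ≡.refl
    top-linear⁻¹ (-u+ a) = ≡.refl

    top-∏ : ∀ d n (f : ℕ → Laurent) → (∀ j → Laurent.top (f j) ≡ d) → Laurent.top (∏ n f) ≡ + n ℤ.* d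
    top-∏ d zero    f eq = ≡.sym (ℤₚ.*-zeroˡ d)
    top-∏ d (suc n) f eq = ≡.trans (≡.cong₂ ℤ._+_ (top-∏ d n f eq) (eq n))
      (≡.trans (ℤₚ.+-comm (+ n ℤ.* d) d) (≡.sym (ℤₚ.suc-* (+ n) d)))

    times-one : ∀ k → k ℤ.* 1ℤ ≡ k
    times-one = ℤₚ.*-identityʳ

    times-minus-one : ∀ k → k ℤ.* -1ℤ ≡ ℤ.- k
    times-minus-one k = ≡.trans (ℤₚ.*-comm k -1ℤ) (ℤₚ.-1*i≡-i k)

    top-⟨⟩ : ∀ x k → Laurent.top ⟨ x ∣ k ⟩ ≡ k
    top-⟨⟩ x (+ n)    = ≡.trans (top-∏ 1ℤ n (λ j → linear (shift x (ℤ.- + j))) (λ j → top-linear (shift x (ℤ.- + j)))) (times-one (+ n))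
    top-⟨⟩ x -[1+ n ] = ≡.trans (top-∏ -1ℤ (suc n) (λ j → linear⁻¹ (shift x (+ suc j))) (λ j → top-linear⁻¹ (shift x (+ suc j)))) (times-minus-one (+ suc n))

    top-1/⟨⟩ : ∀ x k → Laurent.top 1/⟨ x ∣ k ⟩ ≡ ℤ.- k
    top-1/⟨⟩ x (+ n)    = ≡.trans (top-∏ -1ℤ n (λ j → linear⁻¹ (shift x (ℤ.- + j))) (λ j → top-linear⁻¹ (shift x (ℤ.- + j)))) (times-minus-one (+ n))
    top-1/⟨⟩ x -[1+ n ] = ≡.trans (top-∏ 1ℤ (suc n) (λ j → linear (shift x (+ suc j))) (λ j → top-linear (shift x (+ suc j)))) (times-one (+ suc n))

  ⟨⟩-above : ∀ x k n → k ℤ.< n → coeff ⟨ x ∣ k ⟩ n ≈ 0#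
  ⟨⟩-above x k n lt = above-top ⟨ x ∣ k ⟩ n (≡.subst (ℤ._< n) (≡.sym (top-⟨⟩ x k)) lt)

  1/⟨⟩-above : ∀ x k n → ℤ.- k ℤ.< n → coeff 1/⟨ x ∣ k ⟩ n ≈ 0#
  1/⟨⟩-above x k n lt = above-top 1/⟨ x ∣ k ⟩ n (≡.subst (ℤ._< n) (≡.sym (top-1/⟨⟩ x k)) lt)

  -- The pattern of all series in shifted powers below: the family is zero before index `lo`, and
  -- the k-th member starts at power C-k at most. Each coefficient then has finitely many
  -- contributions, and C-lo bounds all powers.
  record Descending (lo C : ℤ) (f : ℤ → Laurent) : Set ℓ where
    field
      vanish : ∀ k n → k ℤ.< lo → coeff (f k) n ≈ 0#
      above  : ∀ k n → C ℤ.- k ℤ.< n → coeff (f k) n ≈ 0#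
  open Descending public

  descending-bounded : ∀ {lo C f} → Descending lo C f → BoundedBy (C ℤ.- lo) f
  descending-bounded {lo} {C} {f} D k n lt with k ℤₚ.<? lo
  ... | yes k<lo = vanish D k n k<lo
  ... | no  k≮lo = above D k n (ℤₚ.≤-<-trans (ℤₚ.+-monoʳ-≤ C (ℤₚ.neg-mono-≤ (ℤₚ.≮⇒≥ k≮lo))) lt)

  descending-beyond : ∀ {lo C f} → Descending lo C f → ∀ k n → ℤ.suc (C ℤ.- n) ℤ.≤ k → coeff (f k) n ≈ 0#
  descending-beyond {C = C} D k n le = above D k n (ℤ-identities.C-n<k⇒C-k<n C n k (ℤₚ.suc[i]≤j⇒i<j le))

  descending-sum : ∀ {lo C f} → Descending lo C f → ∃ λ S → LSum f S
  descending-sum {lo} {C} {f} D = series (C ℤ.- lo) S , λ n → Σℤ.respʳ (sym (coeff-series (C ℤ.- lo) S S-bounded n)) (proj₂ (sums n))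
    where
    sums : ∀ n → ∃ λ S → Sumℤ (λ k → coeff (f k) n) S
    sums n = Σℤ.exists lo (ℤ.suc (C ℤ.- n)) (λ k → vanish D k n) (λ k → descending-beyond D k n)
    S : ℤ → Carrier
    S n = proj₁ (sums n)
    S-bounded : ∀ n → C ℤ.- lo ℤ.< n → S n ≈ 0#
    S-bounded n lt = Σℤ.unique (proj₂ (sums n)) (Σℤ.zero-sum (λ k → descending-bounded D k n lt))

  coeff-∑ : ∀ N (f : ℕ → Laurent) n → coeff (L.∑[ i < N ] f (toℕ i)) n ≈ ∑[ i < N ] coeff (f (toℕ i)) n
  coeff-∑ zero f n = trans (coeff-const✶′ n) refl
    where
    coeff-const✶′ : ∀ n → coeff (const 0#) n ≈ 0#
    coeff-const✶′ (+ zero)  = refl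
    coeff-const✶′ (+ suc n) = refl
    coeff-const✶′ -[1+ n ]  = refl
  coeff-∑ (suc N) f n = trans (coeff-⊞ (f 0) (L.∑[ i < N ] f (suc (toℕ i))) n) (+-congˡ (coeff-∑ N (λ i → f (suc i)) n))

  LSum-∑ : ∀ N (f : ℕ → ℤ → Laurent) (S : ℕ → Laurent) → (∀ i → LSum (f i) (S i)) →
           LSum (λ k → L.∑[ i < N ] f (toℕ i) k) (L.∑[ i < N ] S (toℕ i))
  LSum-∑ N f S p n = Σℤ.respʳ (sym (coeff-∑ N S n)) (Σℤ.respˡ (λ k → sym (coeff-∑ N (λ i → f i k) n))
    (Σℤ.finite-sum N (λ i → p i n)))

  const-∑ : ∀ N (f : ℕ → Carrier) → const (∑[ i < N ] f (toℕ i)) ≋ L.∑[ i < N ] const (f (toℕ i))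
  const-∑ zero    f = ≋-refl
  const-∑ (suc N) f = coeffwise λ n → trans (coeff-≈ (const-+ (f 0) (∑[ i < N ] f (suc (toℕ i)))) n)
    (trans (coeff-⊞ (const (f 0)) (const (∑[ i < N ] f (suc (toℕ i)))) n)
      (trans (+-congˡ (coeff-≈ (const-∑ N (λ i → f (suc i))) n)) (sym (coeff-⊞ (const (f 0)) (L.∑[ i < N ] const (f (suc (toℕ i)))) n))))

  -- The bounds may vary with `j`, of which there are finitely many, but not with `k`.
  LSum-combine : ∀ N (E : ℕ → Laurent) (f : ℕ → ℤ → Laurent) (G : ℕ → Laurent) (T : ℕ → ℤ) →
    (∀ j → BoundedBy (T j) (f j)) → (∀ j → LSum (f j) (G j)) →
    LSum (λ k → L.∑[ j < N ] (E (toℕ j) ✶ f (toℕ j) k)) (L.∑[ j < N ] (E (toℕ j) ✶ G (toℕ j)))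
  LSum-combine N E f G T bounded p =
    LSum-∑ N (λ j k → E j ✶ f j k) (λ j → E j ✶ G j) (λ j → LSum-✶ {f j} {G j} (E j) (T j) (bounded j) (p j))

-- Ring identities to be applied to Laurent series.

module RingIdentities {c ℓ} (A : CommutativeRing c ℓ) where
  open CommutativeRing A hiding (zero)
  open RingTools A
  open Relation.Binary.Reasoning.Setoid setoid

  -- If w′ takes the shifted power P to its neighbour P′ and w differs from w′ by a constant e, then
  -- w produces the neighbour plus an e-multiple of P. This is how the recurrences enter.
  multiply-term : ∀ w w′ e c P P′ → w ≈ w′ + e → P′ ≈ P * w′ → w * (c * P) ≈ c * P′ + e * (c * P)
  multiply-term w w′ e c P P′ hw hP = begin
    w * (c * P)                    ≈⟨ *-congʳ hw ⟩
    (w′ + e) * (c * P)             ≈⟨ solve 4 (λ w e c P → (w :+ e) :* (c :* P) := c :* (P :* w) :+ e :* (c :* P)) refl w′ e c P ⟩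
    c * (P * w′) + e * (c * P)     ≈⟨ +-congʳ (*-congˡ hP) ⟨
    c * P′ + e * (c * P)           ∎

  multiply-term′ : ∀ w w′ e c P P′ → w′ ≈ w + e → P′ ≈ P * w′ → w * (c * P) ≈ c * P′ - e * (c * P)
  multiply-term′ w w′ e c P P′ hw hP = begin
    w * (c * P)                          ≈⟨ solve 4 (λ w e c P → w :* (c :* P) := c :* (P :* (w :+ e)) :- e :* (c :* P)) refl w e c P ⟩
    c * (P * (w + e)) - e * (c * P)      ≈⟨ +-congʳ (*-congˡ (trans hP (*-congˡ hw))) ⟨
    c * P′ - e * (c * P)                 ∎

  rotate : ∀ w H Q Q′ → Q′ ≈ Q * w → w * (H * Q) ≈ H * Q′
  rotate w H Q Q′ hQ = trans (solve 3 (λ w H Q → w :* (H :* Q) := H :* (Q :* w)) refl w H Q) (*-congˡ (sym hQ))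

  rotate-neg : ∀ y l E s s′ Q → y ≈ - l → s′ ≈ - s → y * (E * (s * Q)) ≈ E * (s′ * (Q * l))
  rotate-neg y l E s s′ Q hy hs = begin
    y * (E * (s * Q))         ≈⟨ *-congʳ hy ⟩
    - l * (E * (s * Q))       ≈⟨ solve 4 (λ l E s Q → (:- l) :* (E :* (s :* Q)) := E :* ((:- s) :* (Q :* l))) refl l E s Q ⟩
    E * (- s * (Q * l))       ≈⟨ *-congˡ (*-congʳ hs) ⟨
    E * (s′ * (Q * l))        ∎

  reflect-base : ∀ l m → l ≈ - m → 1# * (1# * l) ≈ - m * 1#
  reflect-base l m hl = trans (*-congˡ (trans (*-identityˡ l) hl)) (trans (*-identityˡ _) (sym (*-identityʳ _)))

  reflect-step : ∀ s s′ T T′ m Q Q′ y y′ → s * T ≈ m * Q → T′ ≈ T * y′ → y′ ≈ - y → Q′ ≈ Q * y → s′ ≈ - s → s′ * T′ ≈ m * Q′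
  reflect-step s s′ T T′ m Q Q′ y y′ ih hT hy hQ hs = begin
    s′ * T′              ≈⟨ *-cong hs (trans hT (*-congˡ hy)) ⟩
    - s * (T * - y)      ≈⟨ solve 3 (λ s T y → (:- s) :* (T :* (:- y)) := s :* T :* y) refl s T y ⟩
    s * T * y            ≈⟨ *-congʳ ih ⟩
    m * Q * y            ≈⟨ *-assoc m Q y ⟩
    m * (Q * y)          ≈⟨ *-congˡ hQ ⟨
    m * Q′               ∎

  negate-base : ∀ l l′ E s → s ≈ - 1# → l′ ≈ l → - l * E ≈ E * (s * (1# * l′))
  negate-base l l′ E s hs hl = trans (solve 2 (λ l E → (:- l) :* E := E :* ((:- con 1ℤ) :* (con 1ℤ :* l))) refl l E)
    (*-congˡ (*-cong (sym hs) (*-congˡ (sym hl))))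

  substitute-product : ∀ m e Q se S T → se ≈ S * e → S * T ≈ m * Q → se * T ≈ m * (e * Q)
  substitute-product m e Q se S T h₁ h₂ = begin
    se * T          ≈⟨ *-congʳ h₁ ⟩
    S * e * T       ≈⟨ solve 3 (λ S e T → S :* e :* T := e :* (S :* T)) refl S e T ⟩
    e * (S * T)     ≈⟨ *-congˡ h₂ ⟩
    e * (m * Q)     ≈⟨ solve 3 (λ e m Q → e :* (m :* Q) := m :* (e :* Q)) refl e m Q ⟩
    m * (e * Q)     ∎

  sum-term : ∀ N (e h t : ℕ → Carrier) U Q W C → (∀ j → t j ≈ e j * h j) → W ≈ U * Q → C ≈ ∑[ j < N ] t (toℕ j) →
             ∑[ j < N ] (e (toℕ j) * U * (h (toℕ j) * Q)) ≈ C * W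
  sum-term N e h t U Q W C ht hW hC = begin
    ∑[ j < N ] (e (toℕ j) * U * (h (toℕ j) * Q))
      ≈⟨ ∑-cong N (λ j → trans (solve 4 (λ e U h Q → e :* U :* (h :* Q) := U :* Q :* (e :* h)) refl (e j) U (h j) Q) (*-cong (sym hW) (sym (ht j)))) ⟩
    ∑[ j < N ] (W * t (toℕ j))
      ≈⟨ ∑-* N W t ⟨
    W * ∑[ j < N ] t (toℕ j)
      ≈⟨ trans (*-comm _ _) (*-congʳ (sym hC)) ⟩
    C * W ∎

  sum-total : ∀ N (a b : ℕ → Carrier) X → (∀ j → a j ≈ X * b j) → ∑[ j < N ] a (toℕ j) ≈ X * ∑[ j < N ] b (toℕ j)
  sum-total N a b X h = trans (∑-cong N h) (sym (∑-* N X b))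

  ψ-total : ∀ e s z d U H Q → e ≈ s * (z * d) → e * U * (H * Q) ≈ z * U * H * (d * s * Q)
  ψ-total e s z d U H Q he = trans (*-congʳ (*-congʳ he))
    (solve 6 (λ s z d U H Q → s :* (z :* d) :* U :* (H :* Q) := z :* U :* H :* (d :* s :* Q)) refl s z d U H Q)

  ψ*-total : ∀ e s z d U H Q → e ≈ z * d → e * U * (H * (s * Q)) ≈ z * U * H * (d * s * Q)
  ψ*-total e s z d U H Q he = trans (*-congʳ (*-congʳ he))
    (solve 6 (λ s z d U H Q → z :* d :* U :* (H :* (s :* Q)) := z :* U :* H :* (d :* s :* Q)) refl s z d U H Q)

-- Summation of the series in shifted powers.

module Series {c ℓ} (K : CommutativeRing c ℓ) where
  open ShiftedSymmetric K
  open Scalars K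
  private module B = CommutativeRing B-ring
  private module BT = RingTools B-ring
  open CommutativeRing 𝓑-ring hiding (zero)
  open RingTools 𝓑-ring
  open ShiftedSchur K
  open Duality K
  open LaurentRing 𝓑-ring
  open Pochhammer 𝓑-ring
  private module R = RingIdentities laurentRing

  coeff-term : ∀ a f n → a ≈ 0# → coeff (const a ✶ f) n ≈ 0#
  coeff-term a f n a≈0 = trans (coeff-const✶ a f n) (trans (*-congʳ a≈0) (zeroˡ _))

  coeff-term′ : ∀ a f n → coeff f n ≈ 0# → coeff (const a ✶ f) n ≈ 0#
  coeff-term′ a f n f≈0 = trans (coeff-const✶ a f n) (trans (*-congˡ f≈0) (zeroʳ _))

  -- φ^(-p) applied to `φ⁻¹-ε`; it fixes the integer factor.
  φ^-ε-suc : ∀ p r → ι (φ^ (ℤ.- + suc p) (ε r)) ≈ ι (φ^ (ℤ.- + p) (ε r)) - fromℤ (ℤ.pred r) * ι (φ^ (ℤ.- + p) (ε (ℤ.pred r)))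
  φ^-ε-suc p r = trans (ι-cong (B.trans (B.reflexive (≡.cong (λ q → φ^ q (ε r)) (ℤ-identities.-[1+p]≡-p+-1 (+ p))))
      (B.trans (φ^-∘ (ℤ.- + p) -1ℤ (ε r)) (B.trans (φ^-cong (ℤ.- + p) (B.trans (φ⁻¹-ε r)
          (B.reflexive (≡.cong (λ q → ε r B.- BT.fromℤ q B.* ε q) (ℤ-identities.r-1≡-1+r r)))))
        (B.trans (B.reflexive (φ^-+ (ℤ.- + p) (ε r) (B.- (BT.fromℤ (ℤ.pred r) B.* ε (ℤ.pred r)))))
          (B.+-congˡ (B.trans (B.reflexive (φ^-neg (ℤ.- + p) (BT.fromℤ (ℤ.pred r) B.* ε (ℤ.pred r))))
            (B.-‿cong (φ^-scale (ℤ.- + p) (ℤ.pred r) (ε (ℤ.pred r)))))))))))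
    (trans (ι-+ (φ^ (ℤ.- + p) (ε r)) (B.- (BT.fromℤ (ℤ.pred r) B.* φ^ (ℤ.- + p) (ε (ℤ.pred r)))))
      (+-congˡ (trans (ι-neg (BT.fromℤ (ℤ.pred r) B.* φ^ (ℤ.- + p) (ε (ℤ.pred r))))
        (-‿cong (trans (ι-* (BT.fromℤ (ℤ.pred r)) (φ^ (ℤ.- + p) (ε (ℤ.pred r)))) (*-congʳ (ι-fromℤ (ℤ.pred r))))))))

  module HSeries (a : ℤ) where
    v : Affine
    v = u+ a

    H̃-family : ℤ → Laurent
    H̃-family r = const (ι (h* r)) ✶ 1/⟨ v ∣ r ⟩

    H̃-descending : Descending 0ℤ 0ℤ H̃-family
    H̃-descending = record
      { vanish = λ k n lt → coeff-term (ι (h* k)) 1/⟨ v ∣ k ⟩ n (ι-cong (B.reflexive (h*-neg lt)))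
      ; above  = λ k n lt → coeff-term′ (ι (h* k)) 1/⟨ v ∣ k ⟩ n (1/⟨⟩-above v k n (≡.subst (ℤ._< n) (ℤₚ.+-identityˡ (ℤ.- k)) lt)) }

    H̃ : Laurent
    H̃ = proj₁ (descending-sum H̃-descending)

    H̃-sum : LSum H̃-family H̃
    H̃-sum = proj₂ (descending-sum H̃-descending)

    family : ℕ → ℤ → Laurent
    family j k = const (ι (h⟨ + j ⟩ k)) ✶ 1/⟨ v ∣ k ⟩

    family-descending : ∀ j → Descending (ℤ.- + j) 0ℤ (family j)
    family-descending j = record
      { vanish = λ k n lt → coeff-term (ι (h⟨ + j ⟩ k)) 1/⟨ v ∣ k ⟩ n (ι-cong (h-vanish (+ j) k (ℤ-identities.k<-j⇒k+j<0 lt)))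
      ; above  = λ k n lt → coeff-term′ (ι (h⟨ + j ⟩ k)) 1/⟨ v ∣ k ⟩ n (1/⟨⟩-above v k n (≡.subst (ℤ._< n) (ℤₚ.+-identityˡ (ℤ.- k)) lt)) }

    -- The recurrence of h⟨ j ⟩ amounts to multiplication of the series by v + j + 1.
    family-sum : ∀ j → LSum (family j) (H̃ ✶ 1/⟨ v ∣ ℤ.- + j ⟩)
    family-sum zero n = Σℤ.respʳ (coeff-≈ (≋-sym (CommutativeRing.*-identityʳ laurentRing H̃)) n)
      (Σℤ.respˡ (λ k → trans (coeff-const✶ (ι (h* k)) 1/⟨ v ∣ k ⟩ n)
          (trans (*-congʳ (reflexive-cong (λ i → ι (h* i)) (≡.sym (ℤₚ.+-identityʳ k)))) (sym (coeff-const✶ (ι (h⟨ 0ℤ ⟩ k)) 1/⟨ v ∣ k ⟩ n))))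
        (H̃-sum n))
    family-sum (suc j) n = Σℤ.respʳ total (Σℤ.respˡ term (Σℤ.plus shifted C-sum))
      where
      w : Laurent
      w = linear (shift v (+ suc j))
      x : ℤ → 𝓑
      x k = ι (h⟨ + j ⟩ k)
      t : ℤ → 𝓑
      t k = coeff 1/⟨ v ∣ k ⟩ n
      multiplied : ∀ k → coeff (w ✶ family j k) n ≈ x k * t (ℤ.pred k) + fromℤ (k ℤ.+ + j) * (x k * t k)
      multiplied k = trans (coeff-≈ (R.multiply-term w w′ (const e) (const (x k)) 1/⟨ v ∣ k ⟩ 1/⟨ v ∣ ℤ.pred k ⟩ w-eq P-eq) n)
        (trans (coeff-⊞ (const (x k) ✶ 1/⟨ v ∣ ℤ.pred k ⟩) (const e ✶ family j k) n)
          (+-cong (coeff-const✶ (x k) 1/⟨ v ∣ ℤ.pred k ⟩ n)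
            (trans (coeff-const✶ e (family j k) n) (*-congˡ (coeff-const✶ (x k) 1/⟨ v ∣ k ⟩ n)))))
        where
        e = fromℤ (k ℤ.+ + j)
        w′ = linear (shift v (ℤ.- ℤ.pred k))
        -- Here w = v+j+1, while 1/(v|k-1) is 1/(v|k) times v-(k-1). The difference k+j is exactly
        -- the coefficient in `h-rec`.
        w-eq : w ≋ w′ ⊞ const e
        w-eq = ≡.subst (λ y → linear y ≋ w′ ⊞ const e)
          (≡.trans (shift-shift v (ℤ.- ℤ.pred k) (k ℤ.+ + j)) (≡.cong (shift v) (ℤ-identities.-[-1+k]+[k+j]≡1+j (+ j) k)))
          (linear-shift (shift v (ℤ.- ℤ.pred k)) (k ℤ.+ + j))
        P-eq : 1/⟨ v ∣ ℤ.pred k ⟩ ≋ 1/⟨ v ∣ k ⟩ ✶ w′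
        P-eq = ≡.subst (λ i → 1/⟨ v ∣ ℤ.pred k ⟩ ≋ 1/⟨ v ∣ i ⟩ ✶ w′) (ℤₚ.suc-pred k) (1/⟨⟩-pred v (ℤ.pred k))
      -- Of the two parts of the product only the one with 1/(v|k-1) is to be reindexed. So the
      -- other is summed separately, subtracted, and added back after the shift.
      C-exists : ∃ λ C → Sumℤ (λ k → fromℤ (k ℤ.+ + j) * (x k * t k)) C
      C-exists = Σℤ.exists (ℤ.- + j) (ℤ.suc (0ℤ ℤ.- n))
        (λ k lt → trans (*-congˡ (trans (sym (coeff-const✶ (x k) 1/⟨ v ∣ k ⟩ n)) (vanish (family-descending j) k n lt))) (zeroʳ _))
        (λ k le → trans (*-congˡ (trans (sym (coeff-const✶ (x k) 1/⟨ v ∣ k ⟩ n)) (descending-beyond (family-descending j) k n le))) (zeroʳ _))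
      C = proj₁ C-exists
      C-sum = proj₂ C-exists
      T = coeff (w ✶ (H̃ ✶ 1/⟨ v ∣ ℤ.- + j ⟩)) n
      product : Sumℤ (λ k → x k * t (ℤ.pred k) + fromℤ (k ℤ.+ + j) * (x k * t k)) T
      product = Σℤ.respˡ multiplied
        (LSum-✶ {family j} {H̃ ✶ 1/⟨ v ∣ ℤ.- + j ⟩} w (0ℤ ℤ.- ℤ.- + j) (descending-bounded (family-descending j)) (family-sum j) n)
      A-sum : Sumℤ (λ k → x k * t (ℤ.pred k)) (T + - 1# * C)
      A-sum = Σℤ.respˡ (λ k → solve 2 (λ a c → a :+ c :+ (:- con 1ℤ) :* c := a) refl (x k * t (ℤ.pred k)) (fromℤ (k ℤ.+ + j) * (x k * t k)))
        (Σℤ.plus product (Σℤ.scale (- 1#) C-sum))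
      shifted : Sumℤ (λ k → x (ℤ.suc k) * t k) (T + - 1# * C)
      shifted = Σℤ.respˡ (λ k → reflexive-cong (λ i → x (ℤ.suc k) * t i) (ℤₚ.pred-suc k)) (Σℤ.suc-shift A-sum)
      term : ∀ k → x (ℤ.suc k) * t k + fromℤ (k ℤ.+ + j) * (x k * t k) ≈ coeff (family (suc j) k) n
      term k = sym (trans (coeff-const✶ (ι (h⟨ + suc j ⟩ k)) 1/⟨ v ∣ k ⟩ n) (trans (*-congʳ (trans (ι-cong (h-rec (+ j) k))
          (trans (ι-+ (h⟨ + j ⟩ (ℤ.suc k)) (BT.fromℤ (k ℤ.+ + j) B.* h⟨ + j ⟩ k))
            (+-congˡ (trans (ι-* (BT.fromℤ (k ℤ.+ + j)) (h⟨ + j ⟩ k)) (*-congʳ (ι-fromℤ (k ℤ.+ + j))))))))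
        (solve 4 (λ y f z t → (y :+ f :* z) :* t := y :* t :+ f :* (z :* t)) refl (x (ℤ.suc k)) (fromℤ (k ℤ.+ + j)) (x k) (t k))))
      total : T + - 1# * C + C ≈ coeff (H̃ ✶ 1/⟨ v ∣ ℤ.- + suc j ⟩) n
      total = trans (solve 2 (λ t c → t :+ (:- con 1ℤ) :* c :+ c := t) refl T C)
        (coeff-≈ (R.rotate w H̃ 1/⟨ v ∣ ℤ.- + j ⟩ 1/⟨ v ∣ -[1+ j ] ⟩
          (≡.subst (λ i → 1/⟨ v ∣ -[1+ j ] ⟩ ≋ 1/⟨ v ∣ i ⟩ ✶ w) (ℤ-identities.1+-[1+j]≡-j j) (1/⟨⟩-pred v -[1+ j ]))) n)

  module ESeries (a : ℤ) where
    v v⁻ v′ : Affine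
    v  = u+ a
    v⁻ = -u+ (ℤ.- a)
    v′ = u+ (a ℤ.- 1ℤ)

    Ẽ-family : ℤ → Laurent
    Ẽ-family r = const (ι (e* r)) ✶ 1/⟨ v ∣ r ⟩

    e*-neg : ∀ {r} → r ℤ.< 0ℤ → e* r ≡ B.0#
    e*-neg {+ _}      (ℤ.+<+ ())
    e*-neg { -[1+ _ ]} _ = ≡.refl

    Ẽ-descending : Descending 0ℤ 0ℤ Ẽ-family
    Ẽ-descending = record
      { vanish = λ k n lt → coeff-term (ι (e* k)) 1/⟨ v ∣ k ⟩ n (ι-cong (B.reflexive (e*-neg lt)))
      ; above  = λ k n lt → coeff-term′ (ι (e* k)) 1/⟨ v ∣ k ⟩ n (1/⟨⟩-above v k n (≡.subst (ℤ._< n) (ℤₚ.+-identityˡ (ℤ.- k)) lt)) }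

    Ẽ : Laurent
    Ẽ = proj₁ (descending-sum Ẽ-descending)

    Ẽ-sum : LSum Ẽ-family Ẽ
    Ẽ-sum = proj₂ (descending-sum Ẽ-descending)

    -- With v⁻ = -v the exponent p+1-r is chosen so that raising `p` by one, or lowering `r` by one,
    -- gives the same shifted power; the two terms of the recurrence then combine.
    family : ℕ → ℤ → Laurent
    family p r = const (ι (φ^ (ℤ.- + p) (ε r))) ✶ ⟨ v⁻ ∣ + suc p ℤ.- r ⟩

    family-descending : ∀ p → Descending 0ℤ (+ suc p) (family p)
    family-descending p = record
      { vanish = λ k n lt → coeff-term (ι (φ^ (ℤ.- + p) (ε k))) ⟨ v⁻ ∣ + suc p ℤ.- k ⟩ n
          (ι-cong (B.reflexive (≡.trans (≡.cong (φ^ (ℤ.- + p)) (ε-neg lt)) (φ^-con (ℤ.- + p) (CommutativeRing.0# K)))))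
      ; above  = λ k n lt → coeff-term′ (ι (φ^ (ℤ.- + p) (ε k))) ⟨ v⁻ ∣ + suc p ℤ.- k ⟩ n (⟨⟩-above v⁻ (+ suc p ℤ.- k) n lt) }

    -- Since v′ = v-1, this is (-1)^(p+1) v(v+1)...(v+p).
    factor : ℕ → Laurent
    factor p = const (sgn (suc p)) ✶ 1/⟨ v′ ∣ -[1+ p ] ⟩

    const-sgn-suc : ∀ p → const (sgn (suc p)) ≋ ⊟ const (sgn p)
    const-sgn-suc p = ≋-trans (const-cong (-1*x≈-x (sgn p))) (const-neg (sgn p))

    -- Reflection of shifted powers. Passing from r to r+1 divides the left side by -v+r and the
    -- right side by v-r; the change of sign is absorbed by sgn.
    reflected : ∀ r → const (sgn r) ✶ ⟨ v⁻ ∣ 1ℤ ℤ.- + r ⟩ ≋ (⊟ linear v) ✶ 1/⟨ v ∣ + r ⟩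
    reflected zero = R.reflect-base (linear (shift v⁻ 0ℤ)) (linear v)
      (≋-trans (≡.subst (λ i → linear (-u+ (ℤ.- a ℤ.+ 0ℤ)) ≋ linear (-u+ i)) (ℤₚ.+-identityʳ (ℤ.- a)) ≋-refl) (linear-neg a))
    reflected (suc r) = R.reflect-step (const (sgn r)) (const (sgn (suc r))) ⟨ v⁻ ∣ 1ℤ ℤ.- + r ⟩ ⟨ v⁻ ∣ k ⟩ (⊟ linear v) 1/⟨ v ∣ + r ⟩ 1/⟨ v ∣ + suc r ⟩
        (linear⁻¹ (shift v (ℤ.- + r))) (linear⁻¹ (shift v⁻ (ℤ.- k)))
        (reflected r)
        (≡.subst (λ i → ⟨ v⁻ ∣ k ⟩ ≋ ⟨ v⁻ ∣ i ⟩ ✶ linear⁻¹ (shift v⁻ (ℤ.- k))) (ℤ-identities.1+[1-[1+r]]≡1-r (+ r)) (⟨⟩-pred v⁻ k))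
        (≡.subst (λ i → linear⁻¹ (-u+ i) ≋ ⊟ linear⁻¹ (shift v (ℤ.- + r))) (≡.sym (ℤ-identities.-a+-[1-[1+r]]≡-[a+-r] a (+ r))) (linear⁻¹-neg (a ℤ.+ ℤ.- + r)))
        (1/⟨⟩-suc v (+ r))
        (const-sgn-suc r)
      where k = 1ℤ ℤ.- + suc r

    -- The recurrence of φ⁻ᵖ(ε) amounts to multiplication of the series by -(v + p + 1).
    family-sum : ∀ p → LSum (family p) (Ẽ ✶ factor p)
    family-sum zero n = Σℤ.respʳ (coeff-≈ (R.negate-base (linear v) (linear (shift v′ 1ℤ)) Ẽ (const (sgn 1)) (const-sgn-suc 0)
          (≡.subst (λ i → linear (u+ i) ≋ linear v) (≡.sym (ℤ-identities.k-c+c≡k a 1ℤ)) ≋-refl)) n)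
      (Σℤ.respˡ term (LSum-✶ {Ẽ-family} {Ẽ} (⊟ linear v) (0ℤ ℤ.- 0ℤ) (descending-bounded Ẽ-descending) Ẽ-sum n))
      where
      term : ∀ r → coeff ((⊟ linear v) ✶ Ẽ-family r) n ≈ coeff (family 0 r) n
      term (+ r) = coeff-≈ (≋-sym (R.substitute-product (⊟ linear v) (const (ι (e* (+ r)))) 1/⟨ v ∣ + r ⟩ (const (ι (ε (+ r)))) (const (sgn r)) ⟨ v⁻ ∣ 1ℤ ℤ.- + r ⟩
        (≋-trans (const-cong (trans (ι-* (BT.sgn r) (e* (+ r))) (*-congʳ (ι-sgn r)))) (const-* (sgn r) (ι (e* (+ r))))) (reflected r))) n
      term -[1+ r ] = trans (coeff-≈ (R.rotate (⊟ linear v) (const 0#) 1/⟨ v ∣ -[1+ r ] ⟩ (1/⟨ v ∣ -[1+ r ] ⟩ ✶ ⊟ linear v) ≋-refl) n)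
        (trans (coeff-term 0# (1/⟨ v ∣ -[1+ r ] ⟩ ✶ ⊟ linear v) n refl) (sym (coeff-term 0# ⟨ v⁻ ∣ 1ℤ ℤ.- -[1+ r ] ⟩ n refl)))
    family-sum (suc p) n = Σℤ.respʳ total (Σℤ.respˡ term (Σℤ.plus A-sum (Σℤ.scale (- 1#) (Σℤ.pred-shift C-sum))))
      where
      y : Laurent
      y = linear (shift v⁻ (ℤ.- + suc p))
      x : ℤ → 𝓑
      x r = ι (φ^ (ℤ.- + p) (ε r))
      i : ℤ → ℤ
      i r = + suc p ℤ.- r
      t : ℤ → 𝓑
      t k = coeff ⟨ v⁻ ∣ k ⟩ n
      multiplied : ∀ r → coeff (y ✶ family p r) n ≈ x r * t (ℤ.suc (i r)) - fromℤ r * (x r * t (i r))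
      multiplied r = trans (coeff-≈ (R.multiply-term′ y w (const (fromℤ r)) (const (x r)) ⟨ v⁻ ∣ i r ⟩ ⟨ v⁻ ∣ ℤ.suc (i r) ⟩ w-eq (⟨⟩-suc v⁻ (i r))) n)
        (trans (coeff-⊞ (const (x r) ✶ ⟨ v⁻ ∣ ℤ.suc (i r) ⟩) (⊟ (const (fromℤ r) ✶ family p r)) n)
          (+-cong (coeff-const✶ (x r) ⟨ v⁻ ∣ ℤ.suc (i r) ⟩ n)
            (trans (coeff-⊟ (const (fromℤ r) ✶ family p r) n) (-‿cong
              (trans (coeff-const✶ (fromℤ r) (family p r) n) (*-congˡ (coeff-const✶ (x r) ⟨ v⁻ ∣ i r ⟩ n)))))))
        where
        -- The next factor of (-v|p+1-r) is -v-(p+1)+r, which exceeds `y` by the constant r.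
        w = linear (shift v⁻ (ℤ.- i r))
        w-eq : w ≋ y ⊞ const (fromℤ r)
        w-eq = ≡.subst (λ s → linear s ≋ y ⊞ const (fromℤ r))
          (≡.trans (shift-shift v⁻ (ℤ.- + suc p) r) (≡.cong (shift v⁻) (≡.sym (ℤ-identities.-[1+p-r]≡-[1+p]+r (+ p) r))))
          (linear-shift (shift v⁻ (ℤ.- + suc p)) r)
      C-exists : ∃ λ C → Sumℤ (λ r → fromℤ r * (x r * t (i r))) C
      C-exists = Σℤ.exists 0ℤ (ℤ.suc (+ suc p ℤ.- n))
        (λ k lt → trans (*-congˡ (trans (sym (coeff-const✶ (x k) ⟨ v⁻ ∣ i k ⟩ n)) (vanish (family-descending p) k n lt))) (zeroʳ _))
        (λ k le → trans (*-congˡ (trans (sym (coeff-const✶ (x k) ⟨ v⁻ ∣ i k ⟩ n)) (descending-beyond (family-descending p) k n le))) (zeroʳ _))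
      C = proj₁ C-exists
      C-sum = proj₂ C-exists
      T = coeff (y ✶ (Ẽ ✶ factor p)) n
      product : Sumℤ (λ r → x r * t (ℤ.suc (i r)) - fromℤ r * (x r * t (i r))) T
      product = Σℤ.respˡ multiplied
        (LSum-✶ {family p} {Ẽ ✶ factor p} y (+ suc p ℤ.- 0ℤ) (descending-bounded (family-descending p)) (family-sum p) n)
      A-sum : Sumℤ (λ r → x r * t (ℤ.suc (i r))) (T + C)
      A-sum = Σℤ.respˡ (λ r → solve 2 (λ a c → a :- c :+ c := a) refl (x r * t (ℤ.suc (i r))) (fromℤ r * (x r * t (i r))))
        (Σℤ.plus product C-sum)
      -- Lowering the index by one in the sum `C` raises its shifted power to (-v|p+2-r), that of
      -- the first sum; the joint coefficient is φ^(-p-1)(ε_r).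
      term : ∀ r → x r * t (ℤ.suc (i r)) + - 1# * (fromℤ (ℤ.pred r) * (x (ℤ.pred r) * t (i (ℤ.pred r)))) ≈ coeff (family (suc p) r) n
      term r = trans (+-congˡ (*-congˡ (*-congˡ (*-congˡ (reflexive-cong t (ℤ-identities.1+p-[-1+r]≡1+[1+p-r] (+ p) r))))))
        (trans (solve 4 (λ a t f b → a :* t :+ (:- con 1ℤ) :* (f :* (b :* t)) := (a :- f :* b) :* t) refl
            (x r) (t (ℤ.suc (i r))) (fromℤ (ℤ.pred r)) (x (ℤ.pred r)))
          (sym (trans (coeff-const✶ (ι (φ^ (ℤ.- + suc p) (ε r))) ⟨ v⁻ ∣ + suc (suc p) ℤ.- r ⟩ n)
            (*-cong (φ^-ε-suc p r) (reflexive-cong t (ℤ-identities.1+[1+p]-r≡1+[1+p-r] (+ p) r))))))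
      total : T + C + - 1# * C ≈ coeff (Ẽ ✶ factor (suc p)) n
      total = trans (solve 2 (λ t c → t :+ c :+ (:- con 1ℤ) :* c := t) refl T C)
        (coeff-≈ (R.rotate-neg y (linear (shift v′ (+ suc (suc p)))) Ẽ (const (sgn (suc p))) (const (sgn (suc (suc p)))) 1/⟨ v′ ∣ -[1+ p ] ⟩
          (≡.subst (λ j → linear (-u+ j) ≋ ⊟ linear (shift v′ (+ suc (suc p)))) (≡.sym (ℤ-identities.-a+-[1+p]≡-[a-1+[1+[1+p]]] a (+ p))) (linear-neg (a ℤ.- 1ℤ ℤ.+ + suc (suc p))))
          (const-sgn-suc (suc p))) n)

-- The four generating functions at a fixed element b z^m.

module GeneratingFunctions {c ℓ} (K : CommutativeRing c ℓ) {ψ ψ* D D⁽_⁾ : ℤ → ShiftedSymmetric.𝓑 K → ShiftedSymmetric.𝓑 K}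
    (ops : ShiftedSymmetric.AreTheOperators K ψ ψ* D D⁽_⁾) (m : ℤ) (b : ShiftedSymmetric.B K) where
  open ShiftedSymmetric K
  open Scalars K
  private module B = CommutativeRing B-ring
  private module BT = RingTools B-ring
  open CommutativeRing 𝓑-ring hiding (zero)
  open RingTools 𝓑-ring
  open ShiftedSchur K
  open Duality K
  open Operators K
  open Expansions ops m
  open LaurentRing 𝓑-ring
  open Pochhammer 𝓑-ring
  open Series K
  private
    module R = RingIdentities laurentRing
    module L = RingTools laurentRing
  open Relation.Binary.Reasoning.Setoid setoid

  private
    x : 𝓑
    x = b z^ m

    open Expands (expands b)
    P = bound

  D⁽⁾-low′ : ∀ p → P ℕ.≤ p → D⁽ ℤ.- + p ℤ.- 1ℤ ⁾ x ≈ 0#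
  D⁽⁾-low′ p le = trans (reflexive-cong (λ i → D⁽ i ⁾ x) (ℤ-identities.-p-1≡-[1+p] p)) (D⁽⁾-low p le)

  -- The bound `P` does not depend on `k`, so each generating function becomes a combination of `P`
  -- series.
  ψ-value : ∀ k → ψ k x ≈ ∑[ j < P ] ψ-term x k (toℕ j)
  ψ-value k = Σℕ.value P (λ j le → trans (*-congˡ {sgn j} (*-congˡ {ι (h⟨ + j ⟩ (k ℤ.- m ℤ.- 1ℤ))} (*-congˡ {z} (D-high j le))))
    (solve 3 (λ s h z → s :* (h :* (z :* con 0ℤ)) := con 0ℤ) refl (sgn j) (ι (h⟨ + j ⟩ (k ℤ.- m ℤ.- 1ℤ))) z)) (ψ-expands k)

  ψ*-value : ∀ k → ψ* k x ≈ ∑[ p < P ] ψ*-term x k (+ toℕ p)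
  ψ*-value k = Σℕ.value P (λ p le → kills (+ p) (D⁽⁾-low′ p le))
    (Σℤ.to-ℕ (λ p → kills -[1+ p ] (D⁽⁾-nonnegative p)) (ψ*-expands k))
    where
    kills : ∀ p → D⁽ ℤ.- p ℤ.- 1ℤ ⁾ x ≈ 0# → ψ*-term x k p ≈ 0#
    kills p eq = trans (*-congˡ {ι (φ^ (ℤ.- p) (ε (p ℤ.- (k ℤ.- m))))} (*-congˡ {z⁻¹} eq))
      (solve 2 (λ h z → h :* (z :* con 0ℤ) := con 0ℤ) refl (ι (φ^ (ℤ.- p) (ε (p ℤ.- (k ℤ.- m))))) z⁻¹)

  coeff-const✶✶ : ∀ a g f n → coeff (const a ✶ g ✶ f) n ≈ a * coeff (g ✶ f) n
  coeff-const✶✶ a g f n = trans (coeff-≈ (✶-assoc (const a) g f) n) (coeff-const✶ a (g ✶ f) n)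

  coeff-✶const✶u^ : ∀ f a d n → coeff (f ✶ const a ✶ u^ d) n ≈ coeff f (n ℤ.- d) * a
  coeff-✶const✶u^ f a d n = trans (coeff-✶u^ d (f ✶ const a) n) (coeff-✶const a f (n ℤ.- d))

  -- As `e` is an involution, the power u^n occurs only in the member k = e n. It is used with
  -- negation and with the identity.
  single-power : ∀ (g : ℤ → 𝓑) (e : ℤ → ℤ) (e-inverse : ∀ k → e (e k) ≡ k) S → (∀ n → g (e n) ≈ coeff S n) →
    LSum (λ k → const (g k) ✶ u^ (e k)) S
  single-power g e e-inverse S h n = Σℤ.respʳ
    (trans (coeff-const✶ (g (e n)) (u^ (e (e n))) n)
      (trans (*-congˡ (trans (reflexive-cong (λ i → coeff (u^ i) n) (e-inverse n)) (coeff-u^-top n))) (trans (*-identityʳ (g (e n))) (h n))))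
    (Σℤ.single (e n) (λ k k≢ → trans (coeff-const✶ (g k) (u^ (e k)) n)
      (trans (*-congˡ (coeff-u^ (e k) n (λ eq → k≢ (≡.trans (≡.sym (e-inverse k)) (≡.cong e (≡.sym eq)))))) (zeroʳ (g k)))))

  private
    at-ι : ∀ {f : ℕ → 𝓑} (g : ℤ → B) → (∀ i → f i ≈ ι (g (+ i))) → (∀ i → g -[1+ i ] ≡ B.0#) → ∀ i → at f i ≈ ι (g i)
    at-ι g pos neg (+ i)    = pos i
    at-ι g pos neg -[1+ i ] = reflexive-cong ι (≡.sym (neg i))

  -- ∂ multiplies by n+1 the coefficient at n+1. With k = -n-p-1 this factor is -(k+p), so the step
  -- from p to p+1 is `h-rec` up to the sign (-1)^(p+1).
  coeff-[∂-1] : ∀ p n → coeff (([∂-1]^ p) H[1/u]) n ≈ sgn p * ι (h⟨ + p ⟩ (ℤ.- n ℤ.- + p))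
  coeff-[∂-1] zero n = trans (at-ι h* (λ i → refl) (λ i → ≡.refl) (0ℤ ℤ.- n))
    (trans (reflexive-cong (λ i → ι (h* i)) (≡.trans (ℤₚ.+-identityˡ (ℤ.- n)) (≡.sym (≡.trans (ℤₚ.+-identityʳ _) (ℤₚ.+-identityʳ (ℤ.- n))))))
      (sym (*-identityˡ _)))
  coeff-[∂-1] (suc p) n = begin
    coeff (∂ g ⊞ ⊟ g) n
      ≈⟨ trans (coeff-⊞ (∂ g) (⊟ g) n) (+-cong (coeff-∂ g n) (coeff-⊟ g n)) ⟩
    fromℤ (ℤ.suc n) * coeff g (ℤ.suc n) - coeff g n
      ≈⟨ +-cong (*-congˡ (coeff-[∂-1] p (ℤ.suc n))) (-‿cong (coeff-[∂-1] p n)) ⟩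
    fromℤ (ℤ.suc n) * (sgn p * ι (h⟨ + p ⟩ (ℤ.- ℤ.suc n ℤ.- + p))) - sgn p * ι (h⟨ + p ⟩ (ℤ.- n ℤ.- + p))
      ≈⟨ solve 4 (λ f s a b → f :* (s :* a) :- s :* b := (:- con 1ℤ) :* s :* (b :+ (:- f) :* a)) refl
           (fromℤ (ℤ.suc n)) (sgn p) (ι (h⟨ + p ⟩ (ℤ.- ℤ.suc n ℤ.- + p))) (ι (h⟨ + p ⟩ (ℤ.- n ℤ.- + p))) ⟩
    sgn (suc p) * (ι (h⟨ + p ⟩ (ℤ.- n ℤ.- + p)) + - fromℤ (ℤ.suc n) * ι (h⟨ + p ⟩ (ℤ.- ℤ.suc n ℤ.- + p)))
      ≈⟨ *-congˡ (+-cong (reflexive-cong (λ i → ι (h⟨ + p ⟩ i)) (≡.sym (ℤ-identities.1+[-n-[1+p]]≡-n-p n (+ p))))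
           (*-cong (trans (sym (fromℤ-neg (ℤ.suc n))) (trans (reflexive-cong fromℤ (≡.sym (ℤ-identities.-n-[1+p]+p≡-[1+n] n (+ p)))) (sym (ι-fromℤ (k ℤ.+ + p)))))
             (reflexive-cong (λ i → ι (h⟨ + p ⟩ i)) (≡.sym (ℤ-identities.-n-[1+p]≡-[1+n]-p n (+ p)))))) ⟩
    sgn (suc p) * (ι (h⟨ + p ⟩ (ℤ.suc k)) + ι (BT.fromℤ (k ℤ.+ + p)) * ι (h⟨ + p ⟩ k))
      ≈⟨ *-congˡ (trans (ι-cong (h-rec (+ p) k)) (trans (ι-+ (h⟨ + p ⟩ (ℤ.suc k)) (BT.fromℤ (k ℤ.+ + p) B.* h⟨ + p ⟩ k))
           (+-congˡ (ι-* (BT.fromℤ (k ℤ.+ + p)) (h⟨ + p ⟩ k))))) ⟨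
    sgn (suc p) * ι (h⟨ + suc p ⟩ k) ∎
    where
    g = ([∂-1]^ p) H[1/u]
    k = ℤ.- n ℤ.- + suc p

  -- The factor n+1 coming from ∂ is -(r-1) for r = -n, which makes the induction step the
  -- recurrence `φ^-ε-suc`.
  coeff-[∂+1] : ∀ p n → coeff (([∂+1]^ p) E[-1/u]) n ≈ ι (φ^ (ℤ.- + p) (ε (ℤ.- n)))
  coeff-[∂+1] zero n = trans (at-ι ε (λ i → sym (trans (ι-* (BT.sgn i) (e* (+ i))) (*-congʳ (ι-sgn i)))) (λ i → ≡.refl) (0ℤ ℤ.- n))
    (reflexive-cong (λ i → ι (ε i)) (ℤₚ.+-identityˡ (ℤ.- n)))
  coeff-[∂+1] (suc p) n = begin
    coeff (∂ g ⊞ g) n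
      ≈⟨ trans (coeff-⊞ (∂ g) g n) (+-congʳ (coeff-∂ g n)) ⟩
    fromℤ (ℤ.suc n) * coeff g (ℤ.suc n) + coeff g n
      ≈⟨ +-cong (*-congˡ (coeff-[∂+1] p (ℤ.suc n))) (coeff-[∂+1] p n) ⟩
    fromℤ (ℤ.suc n) * y (ℤ.- ℤ.suc n) + y (ℤ.- n)
      ≈⟨ solve 3 (λ f a b → f :* a :+ b := b :- (:- f) :* a) refl (fromℤ (ℤ.suc n)) (y (ℤ.- ℤ.suc n)) (y (ℤ.- n)) ⟩
    y (ℤ.- n) - - fromℤ (ℤ.suc n) * y (ℤ.- ℤ.suc n)
      ≈⟨ +-congˡ (-‿cong (trans (*-congʳ (sym (fromℤ-neg (ℤ.suc n))))
           (reflexive-cong (λ i → fromℤ i * y i) (≡.sym (ℤ-identities.-1+-n≡-[1+n] n))))) ⟩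
    y (ℤ.- n) - fromℤ (ℤ.pred (ℤ.- n)) * y (ℤ.pred (ℤ.- n))
      ≈⟨ φ^-ε-suc p (ℤ.- n) ⟨
    ι (φ^ (ℤ.- + suc p) (ε (ℤ.- n))) ∎
    where
    g = ([∂+1]^ p) E[-1/u]
    y : ℤ → 𝓑
    y i = ι (φ^ (ℤ.- + p) (ε i))

  module Ψ where
    F : ℕ → Laurent
    F p = ([∂-1]^ p) H[1/u] ✶ const (D (+ p) x) ✶ u^ (+ p)

    S : Laurent
    S = L.∑[ p < P ] F (toℕ p)

    coeff-F : ∀ p n → coeff (F p) n ≈ sgn p * ι (h⟨ + p ⟩ (ℤ.- (n ℤ.- + p) ℤ.- + p)) * D (+ p) x
    coeff-F p n = trans (coeff-✶const✶u^ (([∂-1]^ p) H[1/u]) (D (+ p) x) (+ p) n) (*-congʳ (coeff-[∂-1] p (n ℤ.- + p)))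

    S-sum : LSumℕ F S
    S-sum n = hasSum (Σℕ.respʳ (sym (coeff-∑ P F n)) (Σℕ.finite P
      (λ p le → trans (coeff-F p n) (trans (*-congˡ (D-high p le)) (zeroʳ _)))))

    series-sum : LSum (λ k → const (ψ k x) ✶ u^ (ℤ.- k)) (const z ✶ u^ (ℤ.- m ℤ.- 1ℤ) ✶ S)
    series-sum = single-power (λ k → ψ k x) ℤ.-_ ℤₚ.neg-involutive (const z ✶ u^ (ℤ.- m ℤ.- 1ℤ) ✶ S) value
      where
      d = ℤ.- m ℤ.- 1ℤ
      value : ∀ n → ψ (ℤ.- n) x ≈ coeff (const z ✶ u^ d ✶ S) n
      value n = begin
        ψ (ℤ.- n) x
          ≈⟨ ψ-value (ℤ.- n) ⟩
        ∑[ j < P ] ψ-term x (ℤ.- n) (toℕ j)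
          ≈⟨ ∑-cong P {λ j → ψ-term x (ℤ.- n) j} {λ j → z * coeff (F j) (n ℤ.- d)} term ⟩
        ∑[ j < P ] (z * coeff (F (toℕ j)) (n ℤ.- d))
          ≈⟨ ∑-* P z (λ j → coeff (F j) (n ℤ.- d)) ⟨
        z * ∑[ j < P ] coeff (F (toℕ j)) (n ℤ.- d)
          ≈⟨ *-congˡ (trans (coeff-u^✶ d S n) (coeff-∑ P F (n ℤ.- d))) ⟨
        z * coeff (u^ d ✶ S) n
          ≈⟨ coeff-const✶✶ z (u^ d) S n ⟨
        coeff (const z ✶ u^ d ✶ S) n ∎
        where
        term : ∀ j → ψ-term x (ℤ.- n) j ≈ z * coeff (F j) (n ℤ.- d)
        term j = trans (solve 4 (λ s h z D → s :* (h :* (z :* D)) := z :* (s :* h :* D)) refl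
            (sgn j) (ι (h⟨ + j ⟩ (ℤ.- n ℤ.- m ℤ.- 1ℤ))) z (D (+ j) x))
          (*-congˡ {z} (trans (reflexive-cong (λ i → sgn j * ι (h⟨ + j ⟩ i) * D (+ j) x) (≡.sym (ℤ-identities.-[n-[-m-1]-p]-p≡-n-m-1 n m (+ j))))
            (sym (coeff-F j (n ℤ.- d)))))

  module Ψ* where
    F : ℕ → Laurent
    F p = ([∂+1]^ p) E[-1/u] ✶ const (D⁽ ℤ.- (+ p) ℤ.- 1ℤ ⁾ x) ✶ u^ (+ p)

    S : Laurent
    S = L.∑[ p < P ] F (toℕ p)

    coeff-F : ∀ p n → coeff (F p) n ≈ ι (φ^ (ℤ.- + p) (ε (ℤ.- (n ℤ.- + p)))) * D⁽ ℤ.- + p ℤ.- 1ℤ ⁾ x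
    coeff-F p n = trans (coeff-✶const✶u^ (([∂+1]^ p) E[-1/u]) (D⁽ ℤ.- + p ℤ.- 1ℤ ⁾ x) (+ p) n) (*-congʳ (coeff-[∂+1] p (n ℤ.- + p)))

    S-sum : LSumℕ F S
    S-sum n = hasSum (Σℕ.respʳ (sym (coeff-∑ P F n)) (Σℕ.finite P
      (λ p le → trans (coeff-F p n) (trans (*-congˡ (D⁽⁾-low′ p le)) (zeroʳ _)))))

    series-sum : LSum (λ k → const (ψ* k x) ✶ u^ k) (const z⁻¹ ✶ u^ m ✶ S)
    series-sum = single-power (λ k → ψ* k x) (λ k → k) (λ k → ≡.refl) (const z⁻¹ ✶ u^ m ✶ S) value
      where
      value : ∀ n → ψ* n x ≈ coeff (const z⁻¹ ✶ u^ m ✶ S) n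
      value n = begin
        ψ* n x
          ≈⟨ ψ*-value n ⟩
        ∑[ p < P ] ψ*-term x n (+ toℕ p)
          ≈⟨ ∑-cong P {λ p → ψ*-term x n (+ p)} {λ p → z⁻¹ * coeff (F p) (n ℤ.- m)} term ⟩
        ∑[ p < P ] (z⁻¹ * coeff (F (toℕ p)) (n ℤ.- m))
          ≈⟨ ∑-* P z⁻¹ (λ p → coeff (F p) (n ℤ.- m)) ⟨
        z⁻¹ * ∑[ p < P ] coeff (F (toℕ p)) (n ℤ.- m)
          ≈⟨ *-congˡ (trans (coeff-u^✶ m S n) (coeff-∑ P F (n ℤ.- m))) ⟨
        z⁻¹ * coeff (u^ m ✶ S) n
          ≈⟨ coeff-const✶✶ z⁻¹ (u^ m) S n ⟨
        coeff (const z⁻¹ ✶ u^ m ✶ S) n ∎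
        where
        term : ∀ p → ψ*-term x n (+ p) ≈ z⁻¹ * coeff (F p) (n ℤ.- m)
        term p = trans (solve 3 (λ h z D → h :* (z :* D) := z :* (h :* D)) refl
            (ι (φ^ (ℤ.- + p) (ε (+ p ℤ.- (n ℤ.- m))))) z⁻¹ (D⁽ ℤ.- + p ℤ.- 1ℤ ⁾ x))
          (*-congˡ {z⁻¹} (trans (reflexive-cong (λ i → ι (φ^ (ℤ.- + p) (ε i)) * D⁽ ℤ.- + p ℤ.- 1ℤ ⁾ x) (≡.sym (ℤ-identities.-[n-m-p]≡p-[n-m] n m (+ p))))
            (sym (coeff-F p (n ℤ.- m)))))

  module Ψ̃ where
    open HSeries (ℤ.- m) public

    U : Laurent
    U = 1/⟨ u+ 0ℤ ∣ m ⟩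

    DẼ-family : ℤ → Laurent
    DẼ-family p = const (D p x) ✶ (± p) ✶ 1/⟨ v ∣ ℤ.- p ⟩

    DẼ : Laurent
    DẼ = L.∑[ p < P ] DẼ-family (+ toℕ p)

    DẼ-sum : LSum DẼ-family DẼ
    DẼ-sum n = Σℤ.from-ℕ (λ p → zero-coefficient -[1+ p ] (D-negative p))
      (Σℕ.respʳ (sym (coeff-∑ P (λ p → DẼ-family (+ p)) n)) (Σℕ.finite P (λ p le → zero-coefficient (+ p) (D-high p le))))
      where
      zero-coefficient : ∀ p → D p x ≈ 0# → coeff (DẼ-family p) n ≈ 0#
      zero-coefficient p eq = trans (coeff-const✶✶ (D p x) (± p) 1/⟨ v ∣ ℤ.- p ⟩ n) (trans (*-congʳ eq) (zeroˡ _))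

    -- Both the label of the row that ψ_k puts in front and the exponent left over from 1/(u|k-1) =
    -- 1/(u|m) · 1/(u-m|κ k). This coincidence is why H̃ and DẼ are taken at u-m.
    κ : ℤ → ℤ
    κ k = k ℤ.- m ℤ.- 1ℤ

    weight : ℕ → 𝓑
    weight j = sgn j * (z * D (+ j) x)

    shifted-sum : ∀ j → LSum (λ k → family j (κ k)) (H̃ ✶ 1/⟨ v ∣ ℤ.- + j ⟩)
    shifted-sum j n = Σℤ.respˡ (λ k → reflexive-cong (λ i → coeff (family j i) n) (ℤ-identities.k+[-m-1]≡k-m-1 k m))
      (Σℤ.shift {f = λ k → coeff (family j k) n} (ℤ.- m ℤ.- 1ℤ) (family-sum j n))

    series-sum : LSum (λ k → const (ψ k x) ✶ 1/⟨ u+ 0ℤ ∣ k ℤ.- 1ℤ ⟩) (const z ✶ U ✶ H̃ ✶ DẼ)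
    series-sum = LSum-respʳ {λ k → const (ψ k x) ✶ 1/⟨ u+ 0ℤ ∣ k ℤ.- 1ℤ ⟩} {combined} {const z ✶ U ✶ H̃ ✶ DẼ} total
      (LSum-respˡ {combination} {λ k → const (ψ k x) ✶ 1/⟨ u+ 0ℤ ∣ k ℤ.- 1ℤ ⟩} {combined} term
      (LSum-combine P (λ j → const (weight j) ✶ U) (λ j k → family j (κ k)) (λ j → H̃ ✶ 1/⟨ v ∣ ℤ.- + j ⟩)
        (λ j → 0ℤ ℤ.- ℤ.- + j) (λ j k → descending-bounded (family-descending j) (κ k)) shifted-sum))
      where
      combined : Laurent
      combined = L.∑[ j < P ] (const (weight (toℕ j)) ✶ U ✶ (H̃ ✶ 1/⟨ v ∣ ℤ.- + toℕ j ⟩))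
      combination : ℤ → Laurent
      combination k = L.∑[ j < P ] (const (weight (toℕ j)) ✶ U ✶ family (toℕ j) (κ k))
      total : combined ≋ const z ✶ U ✶ H̃ ✶ DẼ
      total = R.sum-total P (λ j → const (weight j) ✶ U ✶ (H̃ ✶ 1/⟨ v ∣ ℤ.- + j ⟩)) (λ j → DẼ-family (+ j)) (const z ✶ U ✶ H̃)
        (λ j → R.ψ-total (const (weight j)) (const (sgn j)) (const z) (const (D (+ j) x)) U H̃ 1/⟨ v ∣ ℤ.- + j ⟩
          (≋-trans (const-* (sgn j) (z * D (+ j) x)) (✶-cong {const (sgn j)} {const (sgn j)} {const (z * D (+ j) x)} {const z ✶ const (D (+ j) x)}
            ≋-refl (const-* z (D (+ j) x)))))
      term : ∀ k → combination k ≋ const (ψ k x) ✶ 1/⟨ u+ 0ℤ ∣ k ℤ.- 1ℤ ⟩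
      term k = R.sum-term P (λ j → const (weight j)) (λ j → const (ι (h⟨ + j ⟩ (κ k)))) (λ j → const (ψ-term x k j)) U 1/⟨ v ∣ κ k ⟩ 1/⟨ u+ 0ℤ ∣ k ℤ.- 1ℤ ⟩ (const (ψ k x))
        (λ j → ≋-trans (const-cong (solve 4 (λ s h z D → s :* (h :* (z :* D)) := s :* (z :* D) :* h) refl (sgn j) (ι (h⟨ + j ⟩ (κ k))) z (D (+ j) x)))
          (const-* (weight j) (ι (h⟨ + j ⟩ (κ k)))))
        (≡.subst₂ (λ i a → 1/⟨ u+ 0ℤ ∣ i ⟩ ≋ U ✶ 1/⟨ u+ a ∣ κ k ⟩) (ℤ-identities.k-m-1+m≡k-1 k m) (ℤₚ.+-identityˡ (ℤ.- m)) (1/⟨⟩-+ (u+ 0ℤ) m (κ k)))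
        (≋-trans (const-cong (ψ-value k)) (const-∑ P (ψ-term x k)))

  module Ψ̃* where
    open ESeries m public

    U : Laurent
    U = ⟨ -u+ 0ℤ ∣ m ⟩

    DH̃-family : ℤ → Laurent
    DH̃-family p = const (D⁽ p ⁾ x) ✶ (± p) ✶ 1/⟨ v′ ∣ p ⟩

    DH̃ : Laurent
    DH̃ = L.∑[ p < P ] DH̃-family -[1+ toℕ p ]

    DH̃-sum : LSum DH̃-family DH̃
    DH̃-sum n = Σℤ.respʳ (+-identityˡ _) (Σℤ.halves
      (Σℕ.finite 0 (λ p _ → zero-coefficient (+ p) (D⁽⁾-nonnegative p)))
      (Σℕ.respʳ (sym (coeff-∑ P (λ p → DH̃-family -[1+ p ]) n)) (Σℕ.finite P (λ p le → zero-coefficient -[1+ p ] (D⁽⁾-low p le)))))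
      where
      zero-coefficient : ∀ p → D⁽ p ⁾ x ≈ 0# → coeff (DH̃-family p) n ≈ 0#
      zero-coefficient p eq = trans (coeff-const✶✶ (D⁽ p ⁾ x) (± p) 1/⟨ v′ ∣ p ⟩ n) (trans (*-congʳ eq) (zeroˡ _))

    weight : ℕ → 𝓑
    weight p = z⁻¹ * D⁽ -[1+ p ] ⁾ x

    y : ℕ → ℤ → 𝓑
    y p k = ι (φ^ (ℤ.- + p) (ε (+ p ℤ.- (k ℤ.- m))))

    -- `family p` reindexed by r = p+m-k: the ε index becomes p-(k-m) and the exponent p+1-r becomes
    -- k+1-m, independent of `p`. So all the terms of ψ*_k carry one shifted power, and (-u|m) times
    -- it is (-u|k+1).
    reflected-family : ℕ → ℤ → Laurent
    reflected-family p k = const (y p k) ✶ ⟨ v⁻ ∣ k ℤ.+ 1ℤ ℤ.- m ⟩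

    reflected-family-≡ : ∀ p k → family p (+ p ℤ.+ m ℤ.- k) ≡ reflected-family p k
    reflected-family-≡ p k = ≡.cong₂ (λ i j → const (ι (φ^ (ℤ.- + p) (ε i))) ✶ ⟨ v⁻ ∣ j ⟩) (ℤ-identities.p+m-k≡p-[k-m] (+ p) m k) (ℤ-identities.1+p-[p+m-k]≡k+1-m (+ p) m k)

    reflected-sum : ∀ p → LSum (reflected-family p) (Ẽ ✶ factor p)
    reflected-sum p n = Σℤ.respˡ (λ k → reflexive-cong (λ f → coeff f n) (reflected-family-≡ p k))
      (Σℤ.reflect {f = λ k → coeff (family p k) n} (+ p ℤ.+ m) (family-sum p n))

    reflected-bounded : ∀ p → BoundedBy (+ suc p ℤ.- 0ℤ) (reflected-family p)
    reflected-bounded p k n lt = trans (reflexive-cong (λ f → coeff f n) (≡.sym (reflected-family-≡ p k)))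
      (descending-bounded (family-descending p) (+ p ℤ.+ m ℤ.- k) n lt)

    series-sum : LSum (λ k → const (ψ* k x) ✶ ⟨ -u+ 0ℤ ∣ k ℤ.+ 1ℤ ⟩) (const z⁻¹ ✶ U ✶ Ẽ ✶ DH̃)
    series-sum = LSum-respʳ {λ k → const (ψ* k x) ✶ ⟨ -u+ 0ℤ ∣ k ℤ.+ 1ℤ ⟩} {combined} {const z⁻¹ ✶ U ✶ Ẽ ✶ DH̃} total
      (LSum-respˡ {combination} {λ k → const (ψ* k x) ✶ ⟨ -u+ 0ℤ ∣ k ℤ.+ 1ℤ ⟩} {combined} term
      (LSum-combine P (λ p → const (weight p) ✶ U) reflected-family (λ p → Ẽ ✶ factor p)
        (λ p → + suc p ℤ.- 0ℤ) reflected-bounded reflected-sum))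
      where
      combined : Laurent
      combined = L.∑[ p < P ] (const (weight (toℕ p)) ✶ U ✶ (Ẽ ✶ factor (toℕ p)))
      combination : ℤ → Laurent
      combination k = L.∑[ p < P ] (const (weight (toℕ p)) ✶ U ✶ reflected-family (toℕ p) k)
      total : combined ≋ const z⁻¹ ✶ U ✶ Ẽ ✶ DH̃
      total = R.sum-total P (λ p → const (weight p) ✶ U ✶ (Ẽ ✶ factor p)) (λ p → DH̃-family -[1+ p ]) (const z⁻¹ ✶ U ✶ Ẽ)
        (λ p → R.ψ*-total (const (weight p)) (const (sgn (suc p))) (const z⁻¹) (const (D⁽ -[1+ p ] ⁾ x)) U Ẽ 1/⟨ v′ ∣ -[1+ p ] ⟩
          (const-* z⁻¹ (D⁽ -[1+ p ] ⁾ x)))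
      term : ∀ k → combination k ≋ const (ψ* k x) ✶ ⟨ -u+ 0ℤ ∣ k ℤ.+ 1ℤ ⟩
      term k = R.sum-term P (λ p → const (weight p)) (λ p → const (y p k)) (λ p → const (ψ*-term x k (+ p))) U ⟨ v⁻ ∣ k ℤ.+ 1ℤ ℤ.- m ⟩ ⟨ -u+ 0ℤ ∣ k ℤ.+ 1ℤ ⟩ (const (ψ* k x))
        (λ p → ≋-trans (const-cong (trans (*-comm (y p k) (z⁻¹ * D⁽ ℤ.- + p ℤ.- 1ℤ ⁾ x))
            (reflexive-cong (λ i → z⁻¹ * D⁽ i ⁾ x * y p k) (ℤ-identities.-p-1≡-[1+p] p))))
          (const-* (weight p) (y p k)))
        (≡.subst₂ (λ i a → ⟨ -u+ 0ℤ ∣ i ⟩ ≋ U ✶ ⟨ -u+ a ∣ k ℤ.+ 1ℤ ℤ.- m ⟩) (ℤ-identities.k-c+c≡k (k ℤ.+ 1ℤ) m) (ℤₚ.+-identityˡ (ℤ.- m))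
          (⟨⟩-+ (-u+ 0ℤ) m (k ℤ.+ 1ℤ ℤ.- m)))
        (≋-trans (const-cong (ψ*-value k)) (const-∑ P (λ p → ψ*-term x k (+ p))))

open import Data.Integer.Base using (-_; _+_; _-_)

proposition5p3 : ∀ {c ℓ₁ ℓ₂} (K : HeytingField c ℓ₁ ℓ₂) →
  RingNotions.CharacteristicZero (field→ring K) →
  let open ShiftedSymmetric (field→ring K) in
  (ψ ψ* D D⁽_⁾ : ℤ → 𝓑 → 𝓑) → AreTheOperators ψ ψ* D D⁽_⁾ →
  (m : ℤ) (b : B) →
  let x = b z^ m in
  -- Ψ(1/u,m)
  (∃[ S ]
    LSumℕ (λ p → ([∂-1]^ p) H[1/u] ✶ const (D (+ p) x) ✶ u^ (+ p)) S ×
    LSumℤ (λ k → const (ψ k x) ✶ u^ (- k))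
          (const z ✶ u^ (- m - 1ℤ) ✶ S))
  ×
  -- Ψ*(1/u,m)
  (∃[ S ]
    LSumℕ (λ p → ([∂+1]^ p) E[-1/u] ✶ const (D⁽ - (+ p) - 1ℤ ⁾ x) ✶ u^ (+ p)) S ×
    LSumℤ (λ k → const (ψ* k x) ✶ u^ k)
          (const z⁻¹ ✶ u^ m ✶ S))
  ×
  -- Ψ̃(u,m), with H̃ = H̃(u-m) and DẼ = DẼ(u-m)
  (∃[ H̃ ] ∃[ DẼ ]
    LSumℤ (λ r → const (ι (h* r)) ✶ 1/⟨ u+ (- m) ∣ r ⟩) H̃ ×
    LSumℤ (λ p → const (D p x) ✶ ± p ✶ 1/⟨ u+ (- m) ∣ - p ⟩) DẼ ×
    LSumℤ (λ k → const (ψ k x) ✶ 1/⟨ u+ 0ℤ ∣ k - 1ℤ ⟩)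
          (const z ✶ 1/⟨ u+ 0ℤ ∣ m ⟩ ✶ H̃ ✶ DẼ))
  ×
  -- Ψ̃*(u,m), with Ẽ = Ẽ(u+m) and DH̃ = DH̃(u+m-1)
  (∃[ Ẽ ] ∃[ DH̃ ]
    LSumℤ (λ r → const (ι (e* r)) ✶ 1/⟨ u+ m ∣ r ⟩) Ẽ ×
    LSumℤ (λ p → const (D⁽ p ⁾ x) ✶ ± p ✶ 1/⟨ u+ (m - 1ℤ) ∣ p ⟩) DH̃ ×
    LSumℤ (λ k → const (ψ* k x) ✶ ⟨ -u+ 0ℤ ∣ k + 1ℤ ⟩)
          (const z⁻¹ ✶ ⟨ -u+ 0ℤ ∣ m ⟩ ✶ Ẽ ✶ DH̃))
proposition5p3 K _ ψ ψ* D D⁽_⁾ ops m b =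
    (Ψ.S , Ψ.S-sum , λ n → hasSum (Ψ.series-sum n))
  , (Ψ*.S , Ψ*.S-sum , λ n → hasSum (Ψ*.series-sum n))
  , (Ψ̃.H̃ , Ψ̃.DẼ , (λ n → hasSum (Ψ̃.H̃-sum n)) , (λ n → hasSum (Ψ̃.DẼ-sum n)) , λ n → hasSum (Ψ̃.series-sum n))
  , (Ψ̃*.Ẽ , Ψ̃*.DH̃ , (λ n → hasSum (Ψ̃*.Ẽ-sum n)) , (λ n → hasSum (Ψ̃*.DH̃-sum n)) , λ n → hasSum (Ψ̃*.series-sum n))
  where
  open ShiftedSymmetric (field→ring K) using (𝓑-ring)
  open RingTools 𝓑-ring using (hasSum)
  open GeneratingFunctions (field→ring K) ops m b
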